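{- Let $K$ be an infinite field and $\mathsf{M}$ a loopless matroid on $[n]$ with $k$ connected components, $E=K\langle e_1,\dots,e_n\rangle$ and $J$ the Orlik–Solomon ideal of $\mathsf{M}$. Then $\operatorname{depth}E/J=k$.
   Context: A matroid on $[n]$ is a nonempty family of subsets of $[n]$ (independent sets) containing $\emptyset$, closed under subsets, satisfying the exchange axiom; other subsets are dependent, minimal dependent sets are circuits; a loop is an $i$ with $\{i\}$ dependent. The connected components are the equivalence classes of the relation $x\sim y$ iff $x=y$ or some circuit contains both $x$ and $y$. $E$ is the standard graded exterior algebra; for $S=\{i_0<\dots<i_m\}$, $e_S=e_{i_0}\wedge\dots\wedge e_{i_m}$ and $\partial e_S=\sum_{j=0}^m(-1)^je_{S\setminus\{i_j\}}$; the Orlik–Solomon ideal is $J=(\partial e_S:S\text{ dependent})$. For a graded module $N$, $v\in E_1$ is $N$-regular if $0:_Nv=vN$; a sequence $v_1,\dots,v_s\in E_1$ is $N$-regular if $v_i$ is $N/(v_1,\dots,v_{i-1})N$-regular for each $i$ and $N/(v_1,\dots,v_s)N\neq0$; $\operatorname{depth}N$ is the common length of maximal $N$-regular sequences. -}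

module Defs where

open import Level using (Level; _⊔_) renaming (suc to lsuc)
open import Algebra.Bundles using (CommutativeRing)
open import Data.Nat.ListAction using (sum)
open import Data.Nat as ℕ using (ℕ; zero; suc; _<_; _<ᵇ_; _≡ᵇ_)
open import Data.Fin as Fin using (Fin; toℕ)
import Data.Fin.Subset
open import Data.Fin.Subset using (Subset; ⊥; ⁅_⁆; _∈_; _∉_; _⊆_; _⊂_; _∩_; _∪_; ∣_∣; inside; outside)
open import Data.Vec as Vec using (Vec; []; _∷_; lookup)
open import Data.Vec.Properties using (≡-dec)
open import Data.Bool as Bool using (Bool; true; false; if_then_else_; _∧_)
open import Data.List as List using (List; []; _∷_; _++_; [_]; length; allFin)
open import Data.List.Relation.Unary.All using (All)
open import Data.List.Membership.Propositional using () renaming (_∈_ to _∈ₗ_)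
open import Data.Product using (Σ; ∃; _×_; _,_)
open import Data.Sum using (_⊎_)
open import Relation.Nullary using (¬_; Dec)
open import Relation.Nullary.Decidable using (⌊_⌋)
open import Relation.Binary.PropositionalEquality using (_≡_)

record Field c ℓ : Set (lsuc (c ⊔ ℓ)) where
  field
    commutativeRing : CommutativeRing c ℓ
  open CommutativeRing commutativeRing public
  field
    0≉1     : ¬ (0# ≈ 1#)
    inverse : ∀ x → ¬ (x ≈ 0#) → ∃ λ y → (x * y) ≈ 1#

Infinite : ∀ {c ℓ} → Field c ℓ → Set (c ⊔ ℓ)
Infinite K = ∀ (xs : List Carrier) → ∃ λ x → All (λ y → ¬ (x ≈ y)) xs
  where open Field K

record Matroid (n : ℕ) : Set where
  field
    indep       : Subset n → Bool
    empty-indep : indep ⊥ ≡ true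
    hereditary  : ∀ {A B} → A ⊆ B → indep B ≡ true → indep A ≡ true
    exchange    : ∀ A B → indep A ≡ true → indep B ≡ true → ∣ A ∣ < ∣ B ∣ →
                  ∃ λ x → x ∈ B × x ∉ A × indep (A ∪ ⁅ x ⁆) ≡ true

module _ {n : ℕ} (M : Matroid n) where
  open Matroid M

  Independent : Subset n → Set
  Independent S = indep S ≡ true

  Dependent : Subset n → Set
  Dependent S = indep S ≡ false

  Circuit : Subset n → Set
  Circuit C = Dependent C × (∀ D → D ⊂ C → Independent D)

  Loop : Fin n → Set
  Loop i = Dependent ⁅ i ⁆

  Loopless : Set
  Loopless = ∀ i → ¬ Loop i

  Connected : Fin n → Fin n → Set
  Connected x y = x ≡ y ⊎ (∃ λ C → Circuit C × x ∈ C × y ∈ C)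

  HasComponents : ℕ → Set
  HasComponents k = Σ (Fin n → Fin k) λ f →
    (∀ c → ∃ λ x → f x ≡ c) ×
    (∀ x y → (f x ≡ f y → Connected x y) × (Connected x y → f x ≡ f y))

-- The exterior algebra E = K⟨e_1,…,e_n⟩, elements represented by their
-- coefficient function on the basis {e_S : S ⊆ [n]}.

allSubsets : (m : ℕ) → List (Subset m)
allSubsets zero    = [ [] ]
allSubsets (suc m) = List.map (inside ∷_) (allSubsets m) ++ List.map (outside ∷_) (allSubsets m)

_≟S_ : ∀ {m} → (S T : Subset m) → Dec (S ≡ T)
_≟S_ = ≡-dec Bool._≟_

countBelow : ∀ {m} → Subset m → Fin m → ℕ
countBelow {m} S i = sum (List.map (λ j → if lookup S j ∧ (toℕ j <ᵇ toℕ i) then 1 else 0) (allFin m))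

-- #{(s,t) : s ∈ S, t ∈ T, t < s}; e_S ∧ e_T = (-1)^this e_{S∪T} if S∩T = ∅
inversions : ∀ {m} → Subset m → Subset m → ℕ
inversions {m} S T = sum (List.map (λ s → if lookup S s then countBelow T s else 0) (allFin m))

module Exterior {c ℓ} (K : Field c ℓ) (n : ℕ) where
  open Field K

  E : Set c
  E = Subset n → Carrier

  _≈E_ : E → E → Set ℓ
  f ≈E g = ∀ S → f S ≈ g S

  ∑ : List Carrier → Carrier
  ∑ = List.foldr _+_ 0#

  sgn : ℕ → Carrier
  sgn zero    = 1#
  sgn (suc m) = - sgn m

  0E : E
  0E _ = 0#

  _+E_ : E → E → E
  (f +E g) S = f S + g S

  -E_ : E → E
  (-E f) S = - f S

  wedgeCoeff : Subset n → Subset n → Subset n → Carrier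
  wedgeCoeff S T U =
    if (∣ S ∩ T ∣ ≡ᵇ 0) ∧ ⌊ (S ∪ T) ≟S U ⌋ then sgn (inversions S T) else 0#

  _∧E_ : E → E → E
  (f ∧E g) U = ∑ (List.map (λ S → ∑ (List.map (λ T → (f S * g T) * wedgeCoeff S T U) (allSubsets n))) (allSubsets n))

  InE₁ : E → Set ℓ
  InE₁ v = ∀ S → ¬ (∣ S ∣ ≡ 1) → v S ≈ 0#

  -- ∂ e_S = Σ_j (-1)^j e_{S ∖ {i_j}},  S = {i_0 < … < i_m}
  ∂e : Subset n → E
  ∂e S T = ∑ (List.map (λ i → if lookup S i ∧ ⌊ T ≟S (S Data.Fin.Subset.- i) ⌋ then sgn (countBelow S i) else 0#) (allFin n))

  data ⟨_⟩ {a} (G : E → Set a) : E → Set (c ⊔ ℓ ⊔ a) where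
    gen  : ∀ {g} → G g → ⟨ G ⟩ g
    zer  : ⟨ G ⟩ 0E
    add  : ∀ {x y} → ⟨ G ⟩ x → ⟨ G ⟩ y → ⟨ G ⟩ (x +E y)
    mulˡ : ∀ a {x} → ⟨ G ⟩ x → ⟨ G ⟩ (a ∧E x)
    mulʳ : ∀ a {x} → ⟨ G ⟩ x → ⟨ G ⟩ (x ∧E a)
    resp : ∀ {x y} → x ≈E y → ⟨ G ⟩ x → ⟨ G ⟩ y

  module _ (M : Matroid n) where

    Gens : List E → E → Set c
    Gens vs x = (∃ λ S → Dependent M S × x ≡ ∂e S) ⊎ x ∈ₗ vs

    OSIdeal : E → Set (c ⊔ ℓ)
    OSIdeal = ⟨ Gens [] ⟩

    -- For N = E/J, N/(v_1,…,v_s)N = E/(J + (v_1,…,v_s)); an element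
    -- x ∈ E is zero there iff ⟨ Gens vs ⟩ x.
    -- v is regular on E/I:  0 :_{E/I} v = v (E/I), elementwise.
    RegularOn : (E → Set (c ⊔ ℓ)) → E → Set (c ⊔ ℓ)
    RegularOn I v = ∀ x →
      (I (v ∧E x) → ∃ λ y → I (x +E (-E (v ∧E y)))) ×
      ((∃ λ y → I (x +E (-E (v ∧E y)))) → I (v ∧E x))

    -- RegFrom pre rest: the sequence pre ++ rest is regular on E/J,
    -- given the prefix pre has already been checked.
    RegFrom : List E → List E → Set (c ⊔ ℓ)
    RegFrom pre []         = ¬ (∀ x → ⟨ Gens pre ⟩ x)   -- N/(v)N ≠ 0
    RegFrom pre (v ∷ rest) = InE₁ v × RegularOn ⟨ Gens pre ⟩ v × RegFrom (pre ++ [ v ]) rest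

    IsRegular : List E → Set (c ⊔ ℓ)
    IsRegular vs = RegFrom [] vs

    IsMaximalRegular : List E → Set (c ⊔ ℓ)
    IsMaximalRegular vs = IsRegular vs × (∀ v → ¬ IsRegular (vs ++ [ v ]))

    DepthEq : ℕ → Set (c ⊔ ℓ)
    DepthEq d = (∃ λ vs → IsMaximalRegular vs × length vs ≡ d) ×
                (∀ vs → IsMaximalRegular vs → length vs ≡ d)

{-# OPTIONS --safe #-}

-- If the weights d are constant on connected components, the interior product ι_d preserves J.  A linear
-- form v with ι_d v = 1 is then regular modulo J and linear forms killed by ι_d, by the homotopy
-- x = ι_d (v ∧ x) + v ∧ ι_d x.  So the e_i for one i in each component form a regular sequence of length k,
-- and since s < k homogeneous linear equations in k unknowns have a non-zero solution, every regular
-- sequence of length s < k can be extended.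
--
-- Conversely a regular sequence of length s makes the Hilbert series of E / J divisible by (1 + t) ^ s.
-- The monomials of the sets without broken circuits form a basis of E / J, so deletion and contraction
-- give this series for any order of the ground set.  Fix a basis B of M and order the elements so that
-- all except one root in each component have a smaller neighbour in the fundamental graph of B.
-- Following B in the deletion-contraction tree shows that the order of vanishing at t = −1 is at most k,
-- since all contributions to its leading coefficient have the same sign.

module Submission where

open import Level using (_⊔_)
open import Algebra.Bundles using (CommutativeRing; RawRing)
open import Algebra.Solver.Ring.AlmostCommutativeRing using (fromCommutativeRing; _-Raw-AlmostCommutative⟶_)
import Algebra.Solver.Ring
import Algebra.Properties.Ring
import Algebra.Properties.AbelianGroup
import Algebra.Properties.Semiring.Sum
import Algebra.Properties.Semiring.Mult
import Algebra.Properties.Monoid.Mult.TCOptimised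
import Relation.Binary.Reasoning.Setoid
open import Data.Nat as ℕ using (ℕ; zero; suc; z≤n; s≤s; _<ᵇ_; _≡ᵇ_)
import Data.Nat.Properties as ℕₚ
import Data.Nat.Solver
open import Relation.Binary.Definitions using (tri<; tri≈; tri>)
import Data.Nat.ListAction
open import Data.Nat.Induction using (<-wellFounded)
open import Induction.WellFounded using (Acc; acc)
open import Data.Fin as Fin using (Fin; zero; suc; toℕ; punchIn)
import Data.Fin.Properties as Finₚ
open import Data.Fin.Subset using (Subset; inside; outside; ⁅_⁆; ∣_∣; _∈_; _∉_; _⊆_; _∩_; _∪_; ∁; ⊤) renaming (⊥ to ∅; _-_ to _∖_)
import Data.Fin.Subset.Properties as Sub
open import Data.Bool as Bool using (Bool; true; false; if_then_else_; _∧_; _∨_)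
import Data.Bool.Properties as Boolₚ
open import Data.Vec as Vec using (Vec; []; _∷_; lookup; tabulate; here; there)
import Data.Vec.Properties as Vecₚ
import Data.Vec.Functional as VF
import Data.Vec.Functional.Properties as VFₚ
open import Data.List as List using (List; []; _∷_; _++_; [_]; length; allFin)
import Data.List.Properties as Listₚ
open import Data.List.Relation.Unary.All as All using (All; []; _∷_)
import Data.List.Relation.Unary.All.Properties as Allₚ
open import Data.List.Relation.Unary.Any as Any using (Any; here; there)
import Data.List.Relation.Unary.Any.Properties as Anyₚ
open import Data.List.Relation.Unary.AllPairs using ([]; _∷_)
open import Data.List.Relation.Unary.Unique.Propositional using (Unique)
import Data.List.Relation.Unary.Unique.Propositional.Properties as Uniqueₚ
open import Data.List.Membership.Propositional using () renaming (_∈_ to _∈ₗ_; _∉_ to _∉ₗ_)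
import Data.List.Membership.Propositional.Properties as ∈ₗₚ
open import Data.Product using (Σ; ∃; _×_; _,_; proj₁; proj₂)
open import Data.Sum using (_⊎_; inj₁; inj₂; [_,_]′)
open import Data.Integer as ℤ using (ℤ; 0ℤ; 1ℤ)
import Data.Integer.Properties as ℤₚ
import Data.Integer.Solver
open import Data.Unit using (tt) renaming (⊤ to Unit)
open import Data.Empty using (⊥)
open import Data.Maybe using (Maybe; just; nothing)
open import Function using (_∘_; id; case_of_)
open import Relation.Nullary using (¬_; Dec; yes; no; does)
open import Relation.Nullary.Decidable using (⌊_⌋; ¬?; _×-dec_; _⊎-dec_; decidable-stable)
open import Relation.Nullary.Negation using (contradiction)
open import Relation.Binary.PropositionalEquality as ≡ using (_≡_; _≢_)
open import Defs

-- For N = E / I and a regular linear form `v`, multiplication by `v` identifies N / vN, shifted by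
-- one degree, with vN; this is the source of each factor 1 + t. The difficulty is to bound the
-- multiplicity of the root t = -1 from above. The coefficient of (1 + t) ^ k is, up to sign, the
-- product of Crapo's beta invariants of the components. Its non-vanishing is usually shown by an
-- induction through connected deletions or contractions; an order read off from the fundamental
-- graph replaces this induction by one branch that is visibly non-zero. The monomial basis carries
-- the count over to E / J. Its independence comes from dual functionals, iterated interior products
-- defined by the flag of closures of a set without broken circuits. Dimensions over `K` cannot be
-- computed by testing scalars for zero. The bound on the length is nevertheless obtained outright,
-- because an inequality of natural numbers is stable under double negation.

≡ᵇ-true : ∀ {m k} → m ≡ k → (m ≡ᵇ k) ≡ true
≡ᵇ-true {zero}   ≡.refl = ≡.refl
≡ᵇ-true {suc m}  ≡.refl = ≡ᵇ-true {m} ≡.refl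

≡ᵇ-false : ∀ {m k} → m ≢ k → (m ≡ᵇ k) ≡ false
≡ᵇ-false {m} {k} m≢k with m ≡ᵇ k in eq
... | true   = contradiction (ℕₚ.≡ᵇ⇒≡ m k (≡.subst Bool.T (≡.sym eq) tt)) m≢k
... | false  = ≡.refl

-- A ring solver with integer coefficients over an arbitrary commutative ring.

module RingSolver {r ℓ} (R : CommutativeRing r ℓ) where
  open CommutativeRing R
  open Algebra.Properties.Ring ring using (-‿distribˡ-*; -‿distribʳ-*; -‿involutive)
  open Algebra.Properties.AbelianGroup +-abelianGroup using (⁻¹-∙-comm; ε⁻¹≈ε)
  open Algebra.Properties.Semiring.Mult semiring using (×-homo-+; ×1-homo-*) renaming (_×_ to _·ₙ_)
  open Algebra.Properties.Monoid.Mult.TCOptimised +-monoid using (×ᵤ≈×) renaming (_×_ to _×ₒ_)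
  open Relation.Binary.Reasoning.Setoid setoid

  private
    interchange : ∀ a b c d → (a + b) + (c + d) ≈ (a + c) + (b + d)
    interchange a b c d = begin
      (a + b) + (c + d)   ≈⟨ +-assoc a b (c + d) ⟩
      a + (b + (c + d))   ≈⟨ +-congˡ (+-assoc b c d) ⟨
      a + ((b + c) + d)   ≈⟨ +-congˡ (+-congʳ (+-comm b c)) ⟩
      a + ((c + b) + d)   ≈⟨ +-congˡ (+-assoc c b d) ⟩
      a + (c + (b + d))   ≈⟨ +-assoc a c (b + d) ⟨
      (a + c) + (b + d)   ∎

  -- The coefficient (a , b) stands for the integer a − b.
  Coeff : RawRing _ _
  Coeff = record
    { Carrier = ℕ × ℕ
    ; _≈_ = _≡_
    ; _+_ = λ (a , b) (c , d) → a ℕ.+ c , b ℕ.+ d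
    ; _*_ = λ (a , b) (c , d) → a ℕ.* c ℕ.+ b ℕ.* d , a ℕ.* d ℕ.+ b ℕ.* c
    ; -_  = λ (a , b) → b , a
    ; 0#  = 0 , 0
    ; 1#  = 1 , 0
    }
  private module C = RawRing Coeff

  -- Arranged so that the coefficients 0 and 1 evaluate to 0# and 1# definitionally.
  eval : C.Carrier → Carrier
  eval (a , zero)  = a ×ₒ 1#
  eval (a , suc b) = a ×ₒ 1# + - (suc b ×ₒ 1#)

  private
    diff : C.Carrier → Carrier
    diff (a , b) = a ·ₙ 1# + - (b ·ₙ 1#)

    eval≈diff : ∀ x → eval x ≈ diff x
    eval≈diff (a , zero)  = begin
      a ×ₒ 1#          ≈⟨ ×ᵤ≈× a 1# ⟨
      a ·ₙ 1#           ≈⟨ +-identityʳ _ ⟨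
      a ·ₙ 1# + 0#      ≈⟨ +-congˡ ε⁻¹≈ε ⟨
      a ·ₙ 1# + - 0#    ∎
    eval≈diff (a , suc b) = +-cong (sym (×ᵤ≈× a 1#)) (-‿cong (sym (×ᵤ≈× (suc b) 1#)))

    diff-+ : ∀ x y → diff (x C.+ y) ≈ diff x + diff y
    diff-+ (a , b) (c , d) = begin
      (a ℕ.+ c) ·ₙ 1# + - ((b ℕ.+ d) ·ₙ 1#)              ≈⟨ +-cong (×-homo-+ 1# a c) (-‿cong (×-homo-+ 1# b d)) ⟩
      (a ·ₙ 1# + c ·ₙ 1#) + - (b ·ₙ 1# + d ·ₙ 1#)          ≈⟨ +-congˡ (⁻¹-∙-comm _ _) ⟨
      (a ·ₙ 1# + c ·ₙ 1#) + (- (b ·ₙ 1#) + - (d ·ₙ 1#))    ≈⟨ interchange _ _ _ _ ⟩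
      diff (a , b) + diff (c , d)                      ∎

    diff-* : ∀ x y → diff (x C.* y) ≈ diff x * diff y
    diff-* (m , n) (p , q) = begin
      diff (m ℕ.* p ℕ.+ n ℕ.* q , m ℕ.* q ℕ.+ n ℕ.* p)
        ≈⟨ +-cong (trans (×-homo-+ 1# (m ℕ.* p) (n ℕ.* q)) (+-cong (×1-homo-* m p) (×1-homo-* n q)))
                  (-‿cong (trans (×-homo-+ 1# (m ℕ.* q) (n ℕ.* p)) (+-cong (×1-homo-* m q) (×1-homo-* n p)))) ⟩
      (a * c + b * d) + - (a * d + b * c)
        ≈⟨ +-congˡ (⁻¹-∙-comm _ _) ⟨
      (a * c + b * d) + (- (a * d) + - (b * c))
        ≈⟨ +-congˡ (+-comm _ _) ⟩
      (a * c + b * d) + (- (b * c) + - (a * d))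
        ≈⟨ interchange _ _ _ _ ⟩
      (a * c + - (b * c)) + (b * d + - (a * d))
        ≈⟨ +-cong (+-congˡ (-‿distribˡ-* b c)) (+-comm _ _) ⟩
      (a * c + - b * c) + (- (a * d) + b * d)
        ≈⟨ +-cong (distribʳ c a (- b)) (+-cong (sym (-‿distribʳ-* a d)) (trans (sym (-‿distribʳ-* (- b) d)) (trans (-‿cong (sym (-‿distribˡ-* b d))) (-‿involutive _)))) ⟨
      (a + - b) * c + (a * - d + - b * - d)
        ≈⟨ +-congˡ (distribʳ (- d) a (- b)) ⟨
      (a + - b) * c + (a + - b) * - d
        ≈⟨ distribˡ (a + - b) c (- d) ⟨
      (a + - b) * (c + - d) ∎
      where a = m ·ₙ 1#; b = n ·ₙ 1#; c = p ·ₙ 1#; d = q ·ₙ 1#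

    diff-neg : ∀ x → diff (C.- x) ≈ - diff x
    diff-neg (a , b) = begin
      b ·ₙ 1# + - (a ·ₙ 1#)          ≈⟨ +-comm _ _ ⟩
      - (a ·ₙ 1#) + b ·ₙ 1#          ≈⟨ +-congˡ (-‿involutive _) ⟨
      - (a ·ₙ 1#) + - - (b ·ₙ 1#)    ≈⟨ ⁻¹-∙-comm _ _ ⟩
      - (a ·ₙ 1# + - (b ·ₙ 1#))      ∎

  morphism : Coeff -Raw-AlmostCommutative⟶ fromCommutativeRing R
  morphism = record
    { ⟦_⟧    = eval
    ; +-homo = λ x y → trans (eval≈diff (x C.+ y)) (trans (diff-+ x y) (sym (+-cong (eval≈diff x) (eval≈diff y))))
    ; *-homo = λ x y → trans (eval≈diff (x C.* y)) (trans (diff-* x y) (sym (*-cong (eval≈diff x) (eval≈diff y))))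
    ; -‿homo = λ x → trans (eval≈diff (C.- x)) (trans (diff-neg x) (-‿cong (sym (eval≈diff x))))
    ; 0-homo = refl
    ; 1-homo = refl
    }

  private
    eval-cong : ∀ x y → proj₁ x ℕ.+ proj₂ y ≡ proj₁ y ℕ.+ proj₂ x → eval x ≈ eval y
    eval-cong x@(a , b) y@(c , d) eq = trans (eval≈diff x) (trans diff≈ (sym (eval≈diff y)))
      where
      A B C D : Carrier
      A = a ·ₙ 1#; B = b ·ₙ 1#; C = c ·ₙ 1#; D = d ·ₙ 1#
      eq′ : A + D ≈ C + B
      eq′ = trans (sym (×-homo-+ 1# a d)) (trans (reflexive (≡.cong (_·ₙ 1#) eq)) (×-homo-+ 1# c b))
      shift : ∀ x y z → x + - y ≈ (x + z) + (- y + - z)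
      shift x y z = begin
        x + - y                  ≈⟨ +-identityʳ _ ⟨
        (x + - y) + 0#           ≈⟨ +-congˡ (-‿inverseʳ z) ⟨
        (x + - y) + (z + - z)    ≈⟨ interchange _ _ _ _ ⟩
        (x + z) + (- y + - z)    ∎
      diff≈ : A + - B ≈ C + - D
      diff≈ = begin
        A + - B                  ≈⟨ shift A B D ⟩
        (A + D) + (- B + - D)    ≈⟨ +-cong eq′ (+-comm _ _) ⟩
        (C + B) + (- D + - B)    ≈⟨ shift C D B ⟨
        C + - D                  ∎

    _coeff≟_ : ∀ x y → Maybe (eval x ≈ eval y)
    x coeff≟ y with (proj₁ x ℕ.+ proj₂ y) ℕ.≟ (proj₁ y ℕ.+ proj₂ x)
    ... | yes eq = just (eval-cong x y eq)
    ... | no  _  = nothing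

  open Algebra.Solver.Ring Coeff (fromCommutativeRing R) morphism _coeff≟_ public
    using (solve; _:=_; _:+_; _:*_; :-_; con)

  :0 :1 : ∀ {n} → Algebra.Solver.Ring.Polynomial Coeff (fromCommutativeRing R) morphism _coeff≟_ n
  :0 = con (0 , 0)
  :1 = con (1 , 0)

-- The exterior algebra, by recursion on the first generator.

module ExteriorAlgebra {c ℓ} (K : Field c ℓ) where
  open Field K hiding (zero)
  open RingSolver commutativeRing
  open Algebra.Properties.Ring ring using (-‿distribˡ-*; -‿distribʳ-*; -‿involutive)
  open Algebra.Properties.AbelianGroup +-abelianGroup using (⁻¹-∙-comm; ε⁻¹≈ε)
  open Algebra.Properties.Semiring.Sum semiring using (sum; sum-cong-≋; *-distribˡ-sum)
  open Relation.Binary.Reasoning.Setoid setoid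

  A : ℕ → Set c
  A n = Subset n → Carrier

  infix 4 _≋_
  _≋_ : ∀ {n} → A n → A n → Set ℓ
  x ≋ y = ∀ S → x S ≈ y S

  ≋-refl : ∀ {n} {x : A n} → x ≋ x
  ≋-refl S = refl

  ≋-sym : ∀ {n} {x y : A n} → x ≋ y → y ≋ x
  ≋-sym p S = sym (p S)

  ≋-trans : ∀ {n} {x y z : A n} → x ≋ y → y ≋ z → x ≋ z
  ≋-trans p q S = trans (p S) (q S)

  infixl 6 _⊕_
  infixr 7 _⊙_
  infixl 8 _·_

  𝟎 : ∀ {n} → A n
  𝟎 S = 0#

  _⊕_ : ∀ {n} → A n → A n → A n
  (x ⊕ y) S = x S + y S

  _⊙_ : ∀ {n} → Carrier → A n → A n
  (a ⊙ x) S = a * x S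

  neg : ∀ {n} → A n → A n
  neg x S = - x S

  hd tl : ∀ {n} → A (suc n) → A n
  hd x S = x (inside ∷ S)
  tl x S = x (outside ∷ S)

  -- The grade involution, with sign (-1) ^ ∣S∣ on `e S`. It records the sign of moving a vector of
  -- degree one past an element, which is how it enters `_·_` and the Leibniz rule `ι-·`.
  inv : ∀ {n} → A n → A n
  inv x []             = x []
  inv x (inside  ∷ S)  = - inv (hd x) S
  inv x (outside ∷ S)  = inv (tl x) S

  -- The exterior product, computed from x = e₀ ∧ hd x + tl x.
  _·_ : ∀ {n} → A n → A n → A n
  (x · y) []             = x [] * y []
  (x · y) (inside  ∷ S)  = (hd x · tl y) S + (inv (tl x) · hd y) S
  (x · y) (outside ∷ S)  = (tl x · tl y) S

  -- The interior product, i.e. the antiderivation with e_i ↦ d i.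
  ι : ∀ {n} → (Fin n → Carrier) → A n → A n
  ι d x []             = 0#
  ι d x (inside  ∷ S)  = - ι (d ∘ suc) (hd x) S
  ι d x (outside ∷ S)  = d zero * x (inside ∷ S) + ι (d ∘ suc) (tl x) S

  inv-cong : ∀ {n} {x y : A n} → x ≋ y → inv x ≋ inv y
  inv-cong p []             = p []
  inv-cong p (inside  ∷ S)  = -‿cong (inv-cong (p ∘ (inside ∷_)) S)
  inv-cong p (outside ∷ S)  = inv-cong (p ∘ (outside ∷_)) S

  ·-cong : ∀ {n} {x x′ y y′ : A n} → x ≋ x′ → y ≋ y′ → x · y ≋ x′ · y′
  ·-cong p q []             = *-cong (p []) (q [])
  ·-cong p q (inside  ∷ S)  = +-cong (·-cong (p ∘ (inside ∷_)) (q ∘ (outside ∷_)) S)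
                                     (·-cong (inv-cong (p ∘ (outside ∷_))) (q ∘ (inside ∷_)) S)
  ·-cong p q (outside ∷ S)  = ·-cong (p ∘ (outside ∷_)) (q ∘ (outside ∷_)) S

  ·-congˡ : ∀ {n} {x y y′ : A n} → y ≋ y′ → x · y ≋ x · y′
  ·-congˡ = ·-cong ≋-refl

  ·-congʳ : ∀ {n} {x x′ y : A n} → x ≋ x′ → x · y ≋ x′ · y
  ·-congʳ p = ·-cong p ≋-refl

  ι-cong : ∀ {n} {d d′ : Fin n → Carrier} {x y : A n} → (∀ i → d i ≈ d′ i) → x ≋ y → ι d x ≋ ι d′ y
  ι-cong p q []             = refl
  ι-cong p q (inside  ∷ S)  = -‿cong (ι-cong (p ∘ suc) (q ∘ (inside ∷_)) S)
  ι-cong p q (outside ∷ S)  = +-cong (*-cong (p zero) (q (inside ∷ S))) (ι-cong (p ∘ suc) (q ∘ (outside ∷_)) S)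

  ι-congʳ : ∀ {n} {d : Fin n → Carrier} {x y : A n} → x ≋ y → ι d x ≋ ι d y
  ι-congʳ = ι-cong (λ _ → refl)

  inv-⊕ : ∀ {n} (x y : A n) → inv (x ⊕ y) ≋ inv x ⊕ inv y
  inv-⊕ x y []             = refl
  inv-⊕ x y (inside  ∷ S)  = trans (-‿cong (inv-⊕ (hd x) (hd y) S)) (sym (⁻¹-∙-comm _ _))
  inv-⊕ x y (outside ∷ S)  = inv-⊕ (tl x) (tl y) S

  inv-⊙ : ∀ {n} a (x : A n) → inv (a ⊙ x) ≋ a ⊙ inv x
  inv-⊙ a x []             = refl
  inv-⊙ a x (inside  ∷ S)  = trans (-‿cong (inv-⊙ a (hd x) S)) (-‿distribʳ-* _ _)
  inv-⊙ a x (outside ∷ S)  = inv-⊙ a (tl x) S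

  inv-involutive : ∀ {n} (x : A n) → inv (inv x) ≋ x
  inv-involutive x []             = refl
  inv-involutive x (inside  ∷ S)  = trans (-‿cong (lemma (hd x) S)) (-‿involutive _)
    where
    neg-inv : ∀ {n} (x : A n) → inv (neg x) ≋ neg (inv x)
    neg-inv x []             = refl
    neg-inv x (inside  ∷ S)  = -‿cong (neg-inv (hd x) S)
    neg-inv x (outside ∷ S)  = neg-inv (tl x) S
    lemma : ∀ {n} (x : A n) → inv (neg (inv x)) ≋ neg x
    lemma x S = trans (neg-inv (inv x) S) (-‿cong (inv-involutive x S))
  inv-involutive x (outside ∷ S)  = inv-involutive (tl x) S

  ·-distribʳ : ∀ {n} (z x y : A n) → (x ⊕ y) · z ≋ x · z ⊕ y · z
  ·-distribʳ z x y []             = distribʳ _ _ _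
  ·-distribʳ z x y (inside  ∷ S)  = begin
    ((hd x ⊕ hd y) · tl z) S + (inv (tl x ⊕ tl y) · hd z) S
      ≈⟨ +-cong (·-distribʳ (tl z) (hd x) (hd y) S)
                (trans (·-congʳ (inv-⊕ (tl x) (tl y)) S) (·-distribʳ (hd z) (inv (tl x)) (inv (tl y)) S)) ⟩
    _ ≈⟨ solve 4 (λ a b c d → (a :+ b) :+ (c :+ d) := (a :+ c) :+ (b :+ d)) refl _ _ _ _ ⟩
    _ ∎
  ·-distribʳ z x y (outside ∷ S)  = ·-distribʳ (tl z) (tl x) (tl y) S

  ·-distribˡ : ∀ {n} (z x y : A n) → z · (x ⊕ y) ≋ z · x ⊕ z · y
  ·-distribˡ z x y []             = distribˡ _ _ _
  ·-distribˡ z x y (inside  ∷ S)  = begin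
    (hd z · (tl x ⊕ tl y)) S + (inv (tl z) · (hd x ⊕ hd y)) S
      ≈⟨ +-cong (·-distribˡ (hd z) (tl x) (tl y) S) (·-distribˡ (inv (tl z)) (hd x) (hd y) S) ⟩
    _ ≈⟨ solve 4 (λ a b c d → (a :+ b) :+ (c :+ d) := (a :+ c) :+ (b :+ d)) refl _ _ _ _ ⟩
    _ ∎
  ·-distribˡ z x y (outside ∷ S)  = ·-distribˡ (tl z) (tl x) (tl y) S

  ⊙-·ˡ : ∀ {n} a (x y : A n) → (a ⊙ x) · y ≋ a ⊙ (x · y)
  ⊙-·ˡ a x y []             = *-assoc _ _ _
  ⊙-·ˡ a x y (inside  ∷ S)  = trans
    (+-cong (⊙-·ˡ a (hd x) (tl y) S)
            (trans (·-congʳ (inv-⊙ a (tl x)) S) (⊙-·ˡ a (inv (tl x)) (hd y) S)))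
    (sym (distribˡ _ _ _))
  ⊙-·ˡ a x y (outside ∷ S)  = ⊙-·ˡ a (tl x) (tl y) S

  ⊙-·ʳ : ∀ {n} a (x y : A n) → x · (a ⊙ y) ≋ a ⊙ (x · y)
  ⊙-·ʳ a x y []             = solve 3 (λ a x y → x :* (a :* y) := a :* (x :* y)) refl _ _ _
  ⊙-·ʳ a x y (inside  ∷ S)  = trans
    (+-cong (⊙-·ʳ a (hd x) (tl y) S) (⊙-·ʳ a (inv (tl x)) (hd y) S))
    (sym (distribˡ _ _ _))
  ⊙-·ʳ a x y (outside ∷ S)  = ⊙-·ʳ a (tl x) (tl y) S

  neg≋⊙ : ∀ {n} (x : A n) → neg x ≋ (- 1#) ⊙ x
  neg≋⊙ x S = solve 1 (λ x → :- x := (:- :1) :* x) refl (x S)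

  𝟎≋⊙ : ∀ {n} (x : A n) → 𝟎 ≋ 0# ⊙ x
  𝟎≋⊙ x S = sym (zeroˡ (x S))

  neg-·ˡ : ∀ {n} (x y : A n) → neg x · y ≋ neg (x · y)
  neg-·ˡ x y = ≋-trans (·-congʳ (neg≋⊙ x)) (≋-trans (⊙-·ˡ _ x y) (≋-sym (neg≋⊙ (x · y))))

  neg-·ʳ : ∀ {n} (x y : A n) → x · neg y ≋ neg (x · y)
  neg-·ʳ x y = ≋-trans (·-congˡ (neg≋⊙ y)) (≋-trans (⊙-·ʳ _ x y) (≋-sym (neg≋⊙ (x · y))))

  ·-zeroˡ : ∀ {n} (y : A n) → 𝟎 · y ≋ 𝟎
  ·-zeroˡ y = ≋-trans (·-congʳ (𝟎≋⊙ 𝟎)) (≋-trans (⊙-·ˡ _ 𝟎 y) (≋-sym (𝟎≋⊙ (𝟎 · y))))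

  ·-zeroʳ : ∀ {n} (x : A n) → x · 𝟎 ≋ 𝟎
  ·-zeroʳ x = ≋-trans (·-congˡ (𝟎≋⊙ 𝟎)) (≋-trans (⊙-·ʳ _ x 𝟎) (≋-sym (𝟎≋⊙ (x · 𝟎))))

  inv-neg : ∀ {n} (x : A n) → inv (neg x) ≋ neg (inv x)
  inv-neg x = ≋-trans (inv-cong (neg≋⊙ x)) (≋-trans (inv-⊙ _ x) (≋-sym (neg≋⊙ (inv x))))

  inv-· : ∀ {n} (x y : A n) → inv (x · y) ≋ inv x · inv y
  inv-· x y []             = refl
  inv-· x y (inside  ∷ S)  = begin
    - inv (hd x · tl y ⊕ inv (tl x) · hd y) S
      ≈⟨ -‿cong (trans (inv-⊕ (hd x · tl y) _ S) (+-cong (inv-· (hd x) (tl y) S) (inv-· (inv (tl x)) (hd y) S))) ⟩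
    - ((inv (hd x) · inv (tl y)) S + (inv (inv (tl x)) · inv (hd y)) S)
      ≈⟨ ⁻¹-∙-comm _ _ ⟨
    - (inv (hd x) · inv (tl y)) S + - (inv (inv (tl x)) · inv (hd y)) S
      ≈⟨ +-cong (neg-·ˡ (inv (hd x)) (inv (tl y)) S) (neg-·ʳ (inv (inv (tl x))) (inv (hd y)) S) ⟨
    (neg (inv (hd x)) · inv (tl y)) S + (inv (inv (tl x)) · neg (inv (hd y))) S ∎
  inv-· x y (outside ∷ S)  = inv-· (tl x) (tl y) S

  ·-assoc : ∀ {n} (x y z : A n) → (x · y) · z ≋ x · (y · z)
  ·-assoc x y z []             = *-assoc _ _ _
  ·-assoc x y z (inside  ∷ S)  = begin
    ((x₁ · y₀ ⊕ inv x₀ · y₁) · z₀) S + (inv (x₀ · y₀) · z₁) S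
      ≈⟨ +-cong (·-distribʳ z₀ (x₁ · y₀) _ S) (·-congʳ (inv-· x₀ y₀) S) ⟩
    ((x₁ · y₀) · z₀) S + ((inv x₀ · y₁) · z₀) S + ((inv x₀ · inv y₀) · z₁) S
      ≈⟨ +-cong (+-cong (·-assoc x₁ y₀ z₀ S) (·-assoc (inv x₀) y₁ z₀ S)) (·-assoc (inv x₀) (inv y₀) z₁ S) ⟩
    (x₁ · (y₀ · z₀)) S + (inv x₀ · (y₁ · z₀)) S + (inv x₀ · (inv y₀ · z₁)) S
      ≈⟨ +-assoc _ _ _ ⟩
    (x₁ · (y₀ · z₀)) S + ((inv x₀ · (y₁ · z₀)) S + (inv x₀ · (inv y₀ · z₁)) S)
      ≈⟨ +-congˡ (·-distribˡ (inv x₀) (y₁ · z₀) _ S) ⟨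
    (x₁ · (y₀ · z₀)) S + (inv x₀ · (y₁ · z₀ ⊕ inv y₀ · z₁)) S ∎
    where
    x₁ = hd x
    x₀ = tl x
    y₁ = hd y
    y₀ = tl y
    z₁ = hd z
    z₀ = tl z
  ·-assoc x y z (outside ∷ S)  = ·-assoc (tl x) (tl y) (tl z) S

  ι-⊕ : ∀ {n} (d : Fin n → Carrier) (x y : A n) → ι d (x ⊕ y) ≋ ι d x ⊕ ι d y
  ι-⊕ d x y []             = sym (+-identityˡ _)
  ι-⊕ d x y (inside  ∷ S)  = trans (-‿cong (ι-⊕ (d ∘ suc) (hd x) (hd y) S)) (sym (⁻¹-∙-comm _ _))
  ι-⊕ d x y (outside ∷ S)  = trans (+-congˡ (ι-⊕ (d ∘ suc) (tl x) (tl y) S))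
    (solve 5 (λ d a b c e → d :* (a :+ b) :+ (c :+ e) := (d :* a :+ c) :+ (d :* b :+ e)) refl _ _ _ _ _)

  ι-⊙ : ∀ {n} (d : Fin n → Carrier) a (x : A n) → ι d (a ⊙ x) ≋ a ⊙ ι d x
  ι-⊙ d a x []             = sym (zeroʳ _)
  ι-⊙ d a x (inside  ∷ S)  = trans (-‿cong (ι-⊙ (d ∘ suc) a (hd x) S)) (-‿distribʳ-* _ _)
  ι-⊙ d a x (outside ∷ S)  = trans (+-congˡ (ι-⊙ (d ∘ suc) a (tl x) S))
    (solve 4 (λ d a b c → d :* (a :* b) :+ a :* c := a :* (d :* b :+ c)) refl _ _ _ _)

  ι-neg : ∀ {n} (d : Fin n → Carrier) (x : A n) → ι d (neg x) ≋ neg (ι d x)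
  ι-neg d x = ≋-trans (ι-congʳ (neg≋⊙ x)) (≋-trans (ι-⊙ d _ x) (≋-sym (neg≋⊙ (ι d x))))

  ι-𝟎 : ∀ {n} (d : Fin n → Carrier) → ι {n} d 𝟎 ≋ 𝟎
  ι-𝟎 d = ≋-trans (ι-congʳ (𝟎≋⊙ 𝟎)) (≋-trans (ι-⊙ d _ 𝟎) (≋-sym (𝟎≋⊙ (ι d 𝟎))))

  ι-inv : ∀ {n} (d : Fin n → Carrier) (x : A n) → ι d (inv x) ≋ neg (inv (ι d x))
  ι-inv d x []             = sym ε⁻¹≈ε
  ι-inv d x (inside  ∷ S)  = begin
    - ι d′ (neg (inv (hd x))) S           ≈⟨ -‿cong (ι-neg d′ (inv (hd x)) S) ⟩
    - - ι d′ (inv (hd x)) S               ≈⟨ -‿cong (-‿cong (ι-inv d′ (hd x) S)) ⟩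
    - - - inv (ι d′ (hd x)) S             ≈⟨ -‿cong (-‿cong (inv-neg (ι d′ (hd x)) S)) ⟨
    - - inv (neg (ι d′ (hd x))) S         ∎
    where d′ = d ∘ suc
  ι-inv d x (outside ∷ S)  = begin
    d zero * - inv (hd x) S + ι d′ (inv (tl x)) S
      ≈⟨ +-cong (sym (-‿distribʳ-* _ _)) (ι-inv d′ (tl x) S) ⟩
    - (d zero * inv (hd x) S) + - inv (ι d′ (tl x)) S
      ≈⟨ ⁻¹-∙-comm _ _ ⟩
    - (d zero * inv (hd x) S + inv (ι d′ (tl x)) S)
      ≈⟨ -‿cong (+-congʳ (inv-⊙ (d zero) (hd x) S)) ⟨
    - (inv (d zero ⊙ hd x) S + inv (ι d′ (tl x)) S)
      ≈⟨ -‿cong (inv-⊕ (d zero ⊙ hd x) _ S) ⟨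
    - inv (d zero ⊙ hd x ⊕ ι d′ (tl x)) S ∎
    where d′ = d ∘ suc

  ι-· : ∀ {n} (d : Fin n → Carrier) (x y : A n) → ι d (x · y) ≋ ι d x · y ⊕ inv x · ι d y
  ι-· d x y []             = solve 2 (λ x y → :0 := :0 :* y :+ x :* :0) refl _ _
  ι-· d x y (inside  ∷ S)  = begin
    - ι d′ (x₁ · y₀ ⊕ inv x₀ · y₁) S
      ≈⟨ -‿cong (trans (ι-⊕ d′ (x₁ · y₀) _ S) (+-cong (ι-· d′ x₁ y₀ S) (trans (ι-· d′ (inv x₀) y₁ S)
           (+-cong (trans (·-congʳ (ι-inv d′ x₀) S) (neg-·ˡ _ y₁ S)) (·-congʳ (inv-involutive x₀) S))))) ⟩
    - (((ι d′ x₁ · y₀) S + (inv x₁ · ι d′ y₀) S) + (- (inv (ι d′ x₀) · y₁) S + (x₀ · ι d′ y₁) S))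
      -- The cross term `d zero * (inv x₁ · y₁) S` occurs in the result with both signs and is
      -- inserted here.
      ≈⟨ solve 6 (λ d a b c e f → :- ((a :+ b) :+ (:- c :+ e))
                  := (:- a :+ (d :* f :+ c)) :+ (:- (d :* f :+ b) :+ :- e)) refl (d zero) _ _ _ _ ((inv x₁ · y₁) S) ⟩
    (- (ι d′ x₁ · y₀) S + (d zero * (inv x₁ · y₁) S + (inv (ι d′ x₀) · y₁) S))
      + (- (d zero * (inv x₁ · y₁) S + (inv x₁ · ι d′ y₀) S) + - (x₀ · ι d′ y₁) S)
      ≈⟨ +-cong (+-cong (neg-·ˡ (ι d′ x₁) y₀ S) (+-congʳ (⊙-·ˡ (d zero) (inv x₁) y₁ S)))
                (+-cong (-‿cong (+-congʳ (⊙-·ʳ (d zero) (inv x₁) y₁ S))) (trans (·-congʳ (inv-involutive x₀) S) (neg-·ʳ x₀ (ι d′ y₁) S) )) ⟨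
    ((neg (ι d′ x₁) · y₀) S + (((d zero ⊙ inv x₁) · y₁) S + (inv (ι d′ x₀) · y₁) S))
      + (- ((inv x₁ · (d zero ⊙ y₁)) S + (inv x₁ · ι d′ y₀) S) + (inv (inv x₀) · neg (ι d′ y₁)) S)
      ≈⟨ +-cong (+-congˡ (trans (·-congʳ (≋-trans (inv-⊕ (d zero ⊙ x₁) _) (λ S → +-congʳ (inv-⊙ (d zero) x₁ S))) S)
                                (·-distribʳ y₁ (d zero ⊙ inv x₁) _ S)))
                (+-congʳ (trans (neg-·ˡ (inv x₁) _ S) (-‿cong (·-distribˡ (inv x₁) (d zero ⊙ y₁) _ S)))) ⟨
    ((neg (ι d′ x₁) · y₀) S + (inv (d zero ⊙ x₁ ⊕ ι d′ x₀) · y₁) S)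
      + ((neg (inv x₁) · (d zero ⊙ y₁ ⊕ ι d′ y₀)) S + (inv (inv x₀) · neg (ι d′ y₁)) S) ∎
    where
    d′ = d ∘ suc
    x₁ = hd x
    x₀ = tl x
    y₁ = hd y
    y₀ = tl y
  ι-· d x y (outside ∷ S)  = begin
    d zero * (x₁ · y₀ ⊕ inv x₀ · y₁) S + ι d′ (x₀ · y₀) S
      ≈⟨ +-congˡ (ι-· d′ x₀ y₀ S) ⟩
    d zero * ((x₁ · y₀) S + (inv x₀ · y₁) S) + ((ι d′ x₀ · y₀) S + (inv x₀ · ι d′ y₀) S)
      ≈⟨ solve 5 (λ d a b c e → d :* (a :+ b) :+ (c :+ e) := (d :* a :+ c) :+ (d :* b :+ e)) refl _ _ _ _ _ ⟩
    (d zero * (x₁ · y₀) S + (ι d′ x₀ · y₀) S) + (d zero * (inv x₀ · y₁) S + (inv x₀ · ι d′ y₀) S)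
      ≈⟨ +-cong (+-congʳ (⊙-·ˡ (d zero) x₁ y₀ S)) (+-congʳ (⊙-·ʳ (d zero) (inv x₀) y₁ S)) ⟨
    (((d zero ⊙ x₁) · y₀) S + (ι d′ x₀ · y₀) S) + ((inv x₀ · (d zero ⊙ y₁)) S + (inv x₀ · ι d′ y₀) S)
      ≈⟨ +-cong (·-distribʳ y₀ (d zero ⊙ x₁) _ S) (·-distribˡ (inv x₀) (d zero ⊙ y₁) _ S) ⟨
    ((d zero ⊙ x₁ ⊕ ι d′ x₀) · y₀) S + (inv x₀ · (d zero ⊙ y₁ ⊕ ι d′ y₀)) S ∎
    where
    d′ = d ∘ suc
    x₁ = hd x
    x₀ = tl x
    y₁ = hd y
    y₀ = tl y

  ι-anticomm : ∀ {n} (d d′ : Fin n → Carrier) (x : A n) → ι d (ι d′ x) ≋ neg (ι d′ (ι d x))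
  ι-anticomm d d′ x []             = sym ε⁻¹≈ε
  ι-anticomm d d′ x (inside  ∷ S)  = begin
    - ι (d ∘ suc) (neg (ι (d′ ∘ suc) (hd x))) S      ≈⟨ -‿cong (ι-neg _ _ S) ⟩
    - - ι (d ∘ suc) (ι (d′ ∘ suc) (hd x)) S          ≈⟨ -‿cong (-‿cong (ι-anticomm _ _ (hd x) S)) ⟩
    - - - ι (d′ ∘ suc) (ι (d ∘ suc) (hd x)) S        ≈⟨ -‿cong (-‿cong (ι-neg _ _ S)) ⟨
    - - ι (d′ ∘ suc) (neg (ι (d ∘ suc) (hd x))) S    ∎
  ι-anticomm d d′ x (outside ∷ S)  = begin
    d zero * - ι e′ (hd x) S + ι e (d′ zero ⊙ hd x ⊕ ι e′ (tl x)) S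
      ≈⟨ +-congˡ (trans (ι-⊕ e (d′ zero ⊙ hd x) _ S) (+-cong (ι-⊙ e (d′ zero) (hd x) S) (ι-anticomm e e′ (tl x) S))) ⟩
    d zero * - ι e′ (hd x) S + (d′ zero * ι e (hd x) S + - ι e′ (ι e (tl x)) S)
      ≈⟨ solve 5 (λ d d′ a b c → d :* (:- a) :+ (d′ :* b :+ :- c) := :- (d′ :* (:- b) :+ (d :* a :+ c))) refl _ _ _ _ _ ⟩
    - (d′ zero * - ι e (hd x) S + (d zero * ι e′ (hd x) S + ι e′ (ι e (tl x)) S))
      ≈⟨ -‿cong (+-congˡ (trans (ι-⊕ e′ (d zero ⊙ hd x) _ S) (+-congʳ (ι-⊙ e′ (d zero) (hd x) S)))) ⟨
    - (d′ zero * - ι e (hd x) S + ι e′ (d zero ⊙ hd x ⊕ ι e (tl x)) S) ∎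
    where
    e = d ∘ suc
    e′ = d′ ∘ suc

  -- Proved on its own: taking `d′ = d` in `ι-anticomm` shows only that twice the value vanishes,
  -- which says nothing in characteristic 2.
  ι²≋𝟎 : ∀ {n} (d : Fin n → Carrier) (x : A n) → ι d (ι d x) ≋ 𝟎
  ι²≋𝟎 d x []             = refl
  ι²≋𝟎 d x (inside  ∷ S)  = begin
    - ι (d ∘ suc) (neg (ι (d ∘ suc) (hd x))) S    ≈⟨ -‿cong (ι-neg _ _ S) ⟩
    - - ι (d ∘ suc) (ι (d ∘ suc) (hd x)) S        ≈⟨ -‿involutive _ ⟩
    ι (d ∘ suc) (ι (d ∘ suc) (hd x)) S            ≈⟨ ι²≋𝟎 (d ∘ suc) (hd x) S ⟩
    0#                                            ∎
  ι²≋𝟎 d x (outside ∷ S)  = begin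
    d zero * - ι e (hd x) S + ι e (d zero ⊙ hd x ⊕ ι e (tl x)) S
      ≈⟨ +-congˡ (trans (ι-⊕ e (d zero ⊙ hd x) _ S) (+-cong (ι-⊙ e (d zero) (hd x) S) (ι²≋𝟎 e (tl x) S))) ⟩
    d zero * - ι e (hd x) S + (d zero * ι e (hd x) S + 0#)
      ≈⟨ solve 2 (λ d a → d :* (:- a) :+ (d :* a :+ :0) := :0) refl _ _ ⟩
    0# ∎
    where e = d ∘ suc

  𝟏 : ∀ {n} → A n
  𝟏 []             = 1#
  𝟏 (inside  ∷ S)  = 0#
  𝟏 (outside ∷ S)  = 𝟏 S

  e : ∀ {n} → Subset n → A n
  e []             []             = 1#
  e (inside  ∷ S)  (inside  ∷ T)  = e S T
  e (inside  ∷ S)  (outside ∷ T)  = 0#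
  e (outside ∷ S)  (inside  ∷ T)  = 0#
  e (outside ∷ S)  (outside ∷ T)  = e S T

  lin : ∀ {n} → (Fin n → Carrier) → A n
  lin a []             = 0#
  lin a (inside  ∷ S)  = a zero * 𝟏 S
  lin a (outside ∷ S)  = lin (a ∘ suc) S

  e∅≋𝟏 : ∀ {n} → e (∅ {n}) ≋ 𝟏
  e∅≋𝟏 []             = refl
  e∅≋𝟏 (inside  ∷ S)  = refl
  e∅≋𝟏 (outside ∷ S)  = e∅≋𝟏 S

  inv-𝟎 : ∀ {n} → inv {n} 𝟎 ≋ 𝟎
  inv-𝟎 []             = refl
  inv-𝟎 (inside  ∷ S)  = trans (-‿cong (inv-𝟎 S)) ε⁻¹≈ε
  inv-𝟎 (outside ∷ S)  = inv-𝟎 S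

  inv-𝟏 : ∀ {n} → inv {n} 𝟏 ≋ 𝟏
  inv-𝟏 []             = refl
  inv-𝟏 (inside  ∷ S)  = trans (-‿cong (inv-𝟎 S)) ε⁻¹≈ε
  inv-𝟏 (outside ∷ S)  = inv-𝟏 S

  ·-identityˡ : ∀ {n} (x : A n) → 𝟏 · x ≋ x
  ·-identityˡ x []             = *-identityˡ _
  ·-identityˡ x (inside  ∷ S)  = trans
    (+-cong (·-zeroˡ (tl x) S) (trans (·-congʳ inv-𝟏 S) (·-identityˡ (hd x) S))) (+-identityˡ _)
  ·-identityˡ x (outside ∷ S)  = ·-identityˡ (tl x) S

  ·-identityʳ : ∀ {n} (x : A n) → x · 𝟏 ≋ x
  ·-identityʳ x []             = *-identityʳ _
  ·-identityʳ x (inside  ∷ S)  = trans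
    (+-cong (·-identityʳ (hd x) S) (·-zeroʳ (inv (tl x)) S)) (+-identityʳ _)
  ·-identityʳ x (outside ∷ S)  = ·-identityʳ (tl x) S

  ι-𝟏 : ∀ {n} (d : Fin n → Carrier) → ι d 𝟏 ≋ 𝟎
  ι-𝟏 d []             = refl
  ι-𝟏 d (inside  ∷ S)  = trans (-‿cong (ι-𝟎 (d ∘ suc) S)) ε⁻¹≈ε
  ι-𝟏 d (outside ∷ S)  = trans (+-cong (zeroʳ _) (ι-𝟏 (d ∘ suc) S)) (+-identityʳ _)

  lin-0 : ∀ {n} → lin {n} (λ _ → 0#) ≋ 𝟎
  lin-0 []             = refl
  lin-0 (inside  ∷ S)  = zeroˡ _
  lin-0 (outside ∷ S)  = lin-0 S

  lin-neg : ∀ {n} (a : Fin n → Carrier) → lin (λ i → - a i) ≋ neg (lin a)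
  lin-neg a []             = sym ε⁻¹≈ε
  lin-neg a (inside  ∷ S)  = sym (-‿distribˡ-* _ _)
  lin-neg a (outside ∷ S)  = lin-neg (a ∘ suc) S

  inv-lin : ∀ {n} (a : Fin n → Carrier) → inv (lin a) ≋ neg (lin a)
  inv-lin a []             = sym ε⁻¹≈ε
  inv-lin a (inside  ∷ S)  = -‿cong (trans (inv-⊙ (a zero) 𝟏 S) (*-congˡ (inv-𝟏 S)))
  inv-lin a (outside ∷ S)  = inv-lin (a ∘ suc) S

  -- Moves a linear form from the right to the left, so that two-sided ideals can be handled with
  -- left multiplications.
  ·-lin : ∀ {n} (x : A n) (a : Fin n → Carrier) → x · lin a ≋ lin a · inv x
  ·-lin x a []             = *-comm _ _
  ·-lin x a (inside  ∷ S)  = begin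
    (x₁ · L) S + (inv x₀ · (a zero ⊙ 𝟏)) S
      ≈⟨ +-cong (·-lin x₁ (a ∘ suc) S) (trans (⊙-·ʳ (a zero) (inv x₀) 𝟏 S) (*-congˡ (·-identityʳ (inv x₀) S))) ⟩
    (L · inv x₁) S + a zero * inv x₀ S
      ≈⟨ +-comm _ _ ⟩
    a zero * inv x₀ S + (L · inv x₁) S
      ≈⟨ +-cong (trans (⊙-·ˡ (a zero) 𝟏 (inv x₀) S) (*-congˡ (·-identityˡ (inv x₀) S)))
                (trans (·-congʳ (inv-lin (a ∘ suc)) S) (trans (neg-·ˡ L _ S)
                  (trans (-‿cong (neg-·ʳ L (inv x₁) S)) (-‿involutive _)))) ⟨
    ((a zero ⊙ 𝟏) · inv x₀) S + (inv L · neg (inv x₁)) S ∎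
    where
    x₁ = hd x
    x₀ = tl x
    L = lin (a ∘ suc)
  ·-lin x a (outside ∷ S)  = ·-lin (tl x) (a ∘ suc) S

  -- As for `ι²≋𝟎`, anticommutativity does not give this in characteristic 2; the two mixed terms
  -- cancel at each generator.
  lin² : ∀ {n} (a : Fin n → Carrier) → lin a · lin a ≋ 𝟎
  lin² a []             = zeroˡ _
  lin² a (inside  ∷ S)  = begin
    ((a zero ⊙ 𝟏) · L) S + (inv L · (a zero ⊙ 𝟏)) S
      ≈⟨ +-cong (trans (⊙-·ˡ (a zero) 𝟏 L S) (*-congˡ (·-identityˡ L S)))
                (trans (⊙-·ʳ (a zero) (inv L) 𝟏 S) (*-congˡ (trans (·-identityʳ (inv L) S) (inv-lin (a ∘ suc) S)))) ⟩
    a zero * L S + a zero * - L S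
      ≈⟨ solve 2 (λ a x → a :* x :+ a :* (:- x) := :0) refl _ _ ⟩
    0# ∎
    where L = lin (a ∘ suc)
  lin² a (outside ∷ S)  = lin² (a ∘ suc) S

  ι-lin : ∀ {n} (d a : Fin n → Carrier) → ι d (lin a) ≋ sum (λ i → a i * d i) ⊙ 𝟏
  ι-lin d a []             = sym (zeroˡ _)
  ι-lin d a (inside  ∷ S)  = trans (-‿cong (trans (ι-⊙ (d ∘ suc) (a zero) 𝟏 S) (trans (*-congˡ (ι-𝟏 (d ∘ suc) S)) (zeroʳ _))))
                                   (trans ε⁻¹≈ε (sym (zeroʳ _)))
  ι-lin d a (outside ∷ S)  = trans (+-congˡ (ι-lin (d ∘ suc) (a ∘ suc) S))
    (solve 4 (λ d a i s → d :* (a :* i) :+ s :* i := (a :* d :+ s) :* i) refl _ _ _ _)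

  -- An induction principle for multipliers: a product with an arbitrary element is reduced to
  -- products with linear forms, whose effect on degrees is known.
  data Generated {n} : A n → Set (c ⊔ ℓ) where
    gen-𝟏 : Generated 𝟏
    gen-⊕ : ∀ {x y} → Generated x → Generated y → Generated (x ⊕ y)
    gen-⊙ : ∀ a {x} → Generated x → Generated (a ⊙ x)
    gen-· : ∀ a {x} → Generated x → Generated (lin a · x)
    gen-≋ : ∀ {x y} → x ≋ y → Generated x → Generated y

  private
    embed : ∀ {n} → A n → A (suc n)
    embed x (inside  ∷ S)  = 0#
    embed x (outside ∷ S)  = x S

    cons₀ : ∀ {n} → Carrier → (Fin n → Carrier) → Fin (suc n) → Carrier
    cons₀ a f zero     = a
    cons₀ a f (suc i)  = f i

    gen-embed : ∀ {n} {x : A n} → Generated x → Generated (embed x)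
    gen-embed gen-𝟏 = gen-≋ (λ { (inside ∷ S) → refl ; (outside ∷ S) → refl }) gen-𝟏
    gen-embed (gen-⊕ p q) = gen-≋ (λ { (inside ∷ S) → +-identityˡ _ ; (outside ∷ S) → refl }) (gen-⊕ (gen-embed p) (gen-embed q))
    gen-embed (gen-⊙ a p) = gen-≋ (λ { (inside ∷ S) → zeroʳ _ ; (outside ∷ S) → refl }) (gen-⊙ a (gen-embed p))
    gen-embed (gen-· a {x} p) = gen-≋
      (λ { (inside ∷ S) → trans (+-cong (trans (⊙-·ˡ 0# 𝟏 x S) (zeroˡ _)) (·-zeroʳ (inv (lin a)) S)) (+-identityˡ _)
         ; (outside ∷ S) → refl })
      (gen-· (cons₀ 0# a) (gen-embed p))
    gen-embed (gen-≋ p q) = gen-≋ (λ { (inside ∷ S) → refl ; (outside ∷ S) → p S }) (gen-embed q)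

  generated : ∀ {n} (x : A n) → Generated x
  generated {zero}  x = gen-≋ (λ { [] → *-identityʳ _ }) (gen-⊙ (x []) gen-𝟏)
  generated {suc n} x = gen-≋
    (λ { (inside ∷ S) → trans (+-identityʳ _) (trans (+-cong (trans (⊙-·ˡ 1# 𝟏 (hd x) S) (trans (*-identityˡ _) (·-identityˡ (hd x) S)))
                                                (·-zeroʳ (inv (lin (λ _ → 0#))) S)) (+-identityʳ _))
       ; (outside ∷ S) → trans (+-congʳ (trans (·-congʳ lin-0 S) (·-zeroˡ (hd x) S))) (+-identityˡ _) })
    (gen-⊕ (gen-· (cons₀ 1# (λ _ → 0#)) (gen-embed (generated (hd x)))) (gen-embed (generated (tl x))))

  sgn : ℕ → Carrier
  sgn zero     = 1#
  sgn (suc m)  = - sgn m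

  sgn² : ∀ m → sgn m * sgn m ≈ 1#
  sgn² zero     = *-identityˡ _
  sgn² (suc m)  = trans (solve 1 (λ s → (:- s) :* (:- s) := s :* s) refl _) (sgn² m)

  sgn-+ : ∀ m k → sgn (m ℕ.+ k) ≈ sgn m * sgn k
  sgn-+ zero     k = sym (*-identityˡ _)
  sgn-+ (suc m)  k = trans (-‿cong (sgn-+ m k)) (-‿distribˡ-* _ _)

  inv-coeff : ∀ {n} (x : A n) S → inv x S ≈ sgn ∣ S ∣ * x S
  inv-coeff x []             = sym (*-identityˡ _)
  inv-coeff x (inside  ∷ S)  = trans (-‿cong (inv-coeff (hd x) S)) (-‿distribˡ-* _ _)
  inv-coeff x (outside ∷ S)  = inv-coeff (tl x) S

  e-diag : ∀ {n} (S : Subset n) → e S S ≈ 1#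
  e-diag []             = refl
  e-diag (inside  ∷ S)  = e-diag S
  e-diag (outside ∷ S)  = e-diag S

  e-off : ∀ {n} (S T : Subset n) → S ≢ T → e S T ≈ 0#
  e-off []             []             p = contradiction ≡.refl p
  e-off (inside  ∷ S)  (inside  ∷ T)  p = e-off S T (λ { ≡.refl → p ≡.refl })
  e-off (inside  ∷ S)  (outside ∷ T)  p = refl
  e-off (outside ∷ S)  (inside  ∷ T)  p = refl
  e-off (outside ∷ S)  (outside ∷ T)  p = e-off S T (λ { ≡.refl → p ≡.refl })

  𝟏-∅ : ∀ n → 𝟏 (∅ {n}) ≈ 1#
  𝟏-∅ zero     = refl
  𝟏-∅ (suc n)  = 𝟏-∅ n

  𝟏-off : ∀ {n} (S : Subset n) → S ≢ ∅ → 𝟏 S ≈ 0#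
  𝟏-off S S≢∅ = trans (sym (e∅≋𝟏 S)) (e-off ∅ S (S≢∅ ∘ ≡.sym))

  inv-e : ∀ {n} (S : Subset n) → inv (e S) ≋ sgn ∣ S ∣ ⊙ e S
  inv-e S T with S ≟S T
  ... | yes ≡.refl = inv-coeff (e S) S
  ... | no  S≢T    = trans (inv-coeff (e S) T) (trans (*-congˡ (e-off S T S≢T)) (trans (zeroʳ _)
                       (sym (trans (*-congˡ (e-off S T S≢T)) (zeroʳ _)))))

  Hom : ∀ {n} → ℕ → A n → Set ℓ
  Hom p x = ∀ S → ∣ S ∣ ≢ p → x S ≈ 0#

  π : ∀ {n} → ℕ → A n → A n
  π p x S = if ∣ S ∣ ≡ᵇ p then x S else 0#

  π-cong : ∀ {n} p {x y : A n} → x ≋ y → π p x ≋ π p y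
  π-cong p q S with ∣ S ∣ ≡ᵇ p
  ... | true   = q S
  ... | false  = refl

  π-⊕ : ∀ {n} p (x y : A n) → π p (x ⊕ y) ≋ π p x ⊕ π p y
  π-⊕ p x y S with ∣ S ∣ ≡ᵇ p
  ... | true   = refl
  ... | false  = sym (+-identityˡ _)

  π-⊙ : ∀ {n} p a (x : A n) → π p (a ⊙ x) ≋ a ⊙ π p x
  π-⊙ p a x S with ∣ S ∣ ≡ᵇ p
  ... | true   = refl
  ... | false  = sym (zeroʳ _)

  π-𝟎 : ∀ {n} p → π {n} p 𝟎 ≋ 𝟎
  π-𝟎 p S with ∣ S ∣ ≡ᵇ p
  ... | true   = refl
  ... | false  = refl

  π-inv : ∀ {n} p (x : A n) → π p (inv x) ≋ inv (π p x)
  π-inv p x S = trans (lemma (∣ S ∣ ≡ᵇ p) (inv-coeff x S)) (sym (inv-coeff (π p x) S))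
    where
    lemma : ∀ b {x y z} → x ≈ y * z → (if b then x else 0#) ≈ y * (if b then z else 0#)
    lemma true   p = p
    lemma false  p = sym (zeroʳ _)

  π-Hom : ∀ {n} p {x : A n} → Hom p x → π p x ≋ x
  π-Hom p {x} h S with ∣ S ∣ ℕ.≟ p
  ... | yes eq rewrite ≡ᵇ-true eq = refl
  ... | no neq rewrite ≡ᵇ-false neq = sym (h S neq)

  π-Hom-≢ : ∀ {n} p q {x : A n} → Hom q x → q ≢ p → π p x ≋ 𝟎
  π-Hom-≢ p q {x} h q≢p S with ∣ S ∣ ℕ.≟ p
  ... | yes eq rewrite ≡ᵇ-true eq = h S (λ eq′ → q≢p (≡.trans (≡.sym eq′) eq))
  ... | no neq rewrite ≡ᵇ-false neq = refl

  Hom-π : ∀ {n} p (x : A n) → Hom p (π p x)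
  Hom-π p x S neq rewrite ≡ᵇ-false neq = refl

  Hom-e : ∀ {n} (S : Subset n) → Hom ∣ S ∣ (e S)
  Hom-e S T neq = e-off S T (λ { ≡.refl → neq ≡.refl })

  π-zero-lin : ∀ {n} (a : Fin n → Carrier) (x : A n) → π 0 (lin a · x) ≋ 𝟎
  π-zero-lin a x []             = zeroˡ _
  π-zero-lin a x (inside  ∷ S)  = refl
  π-zero-lin a x (outside ∷ S)  = π-zero-lin (a ∘ suc) (tl x) S

  π-suc-lin : ∀ {n} p (a : Fin n → Carrier) (x : A n) → π (suc p) (lin a · x) ≋ lin a · π p x
  π-suc-lin p a x []             = sym (zeroˡ _)
  π-suc-lin p a x (inside  ∷ S)  = begin
    π p ((a zero ⊙ 𝟏) · tl x ⊕ inv L · hd x) S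
      ≈⟨ π-⊕ p ((a zero ⊙ 𝟏) · tl x) (inv L · hd x) S ⟩
    π p ((a zero ⊙ 𝟏) · tl x) S + π p (inv L · hd x) S
      ≈⟨ +-cong (trans (π-cong p (λ S → trans (⊙-·ˡ (a zero) 𝟏 (tl x) S) (*-congˡ (·-identityˡ (tl x) S))) S) (π-⊙ p (a zero) (tl x) S))
                (trans (π-cong p (·-congʳ inv-L) S) (trans (lemma p) (·-congʳ (≋-sym inv-L) S))) ⟩
    a zero * π p (tl x) S + (inv L · hd (π p x)) S
      ≈⟨ +-congʳ (trans (⊙-·ˡ (a zero) 𝟏 (π p (tl x)) S) (*-congˡ (·-identityˡ _ S))) ⟨
    ((a zero ⊙ 𝟏) · π p (tl x)) S + (inv L · hd (π p x)) S ∎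
    where
    L L⁻ : A _
    L = lin (a ∘ suc)
    L⁻ = lin (λ i → - a (suc i))
    inv-L : inv L ≋ L⁻
    inv-L = ≋-trans (inv-lin (a ∘ suc)) (≋-sym (lin-neg (a ∘ suc)))
    lemma : ∀ p → π p (L⁻ · hd x) S ≈ (L⁻ · hd (π p x)) S
    lemma zero     = trans (π-zero-lin _ (hd x) S) (sym (·-zeroʳ L⁻ S))
    lemma (suc p)  = π-suc-lin p _ (hd x) S
  π-suc-lin p a x (outside ∷ S)  = π-suc-lin p (a ∘ suc) (tl x) S

  ∣S∣≡0⇒S≡∅ : ∀ {n} (S : Subset n) → ∣ S ∣ ≡ 0 → S ≡ ∅
  ∣S∣≡0⇒S≡∅ []             p = ≡.refl
  ∣S∣≡0⇒S≡∅ (outside ∷ S)  p = ≡.cong (outside ∷_) (∣S∣≡0⇒S≡∅ S p)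

  Hom₁⇒lin : ∀ {n} {v : A n} → Hom 1 v → v ≋ lin (λ i → v ⁅ i ⁆)
  Hom₁⇒lin h []             = h [] (λ ())
  Hom₁⇒lin {suc n} h (inside  ∷ S) with S ≟S ∅
  ... | yes ≡.refl = sym (trans (*-congˡ (𝟏-∅ n)) (*-identityʳ _))
  ... | no S≢∅ = trans (h (inside ∷ S) (λ eq → S≢∅ (∣S∣≡0⇒S≡∅ S (ℕₚ.suc-injective eq))))
                   (sym (trans (*-congˡ (𝟏-off S S≢∅)) (zeroʳ _)))
  Hom₁⇒lin h (outside ∷ S)  = Hom₁⇒lin (h ∘ (outside ∷_)) S

  Hom-lin : ∀ {n} (a : Fin n → Carrier) → Hom 1 (lin a)
  Hom-lin a []             p = refl
  Hom-lin {suc n} a (inside  ∷ S)  p = trans (*-congˡ (𝟏-off S (λ { ≡.refl → p (≡.cong suc (Sub.∣⊥∣≡0 n)) }))) (zeroʳ _)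
  Hom-lin a (outside ∷ S)  p = Hom-lin (a ∘ suc) S p

  ·-∅ : ∀ {n} (x y : A n) → (x · y) ∅ ≈ x ∅ * y ∅
  ·-∅ {zero}   x y = refl
  ·-∅ {suc n}  x y = ·-∅ (tl x) (tl y)

  pair : ∀ {n} → A n → A n → A (suc n)
  pair x y (inside  ∷ S)  = x S
  pair x y (outside ∷ S)  = y S

  -- The cofactor is the monomial of the complement of `U` in `V` up to sign; later only its
  -- existence is used.
  factor : ∀ {n} (U V : Subset n) → U ⊆ V → ∃ λ z → e U · z ≋ e V
  factor [] [] U⊆V = 𝟏 , λ { [] → *-identityˡ _ }
  factor (inside ∷ U) (outside ∷ V) U⊆V with U⊆V here
  ... | ()
  factor (inside ∷ U) (inside ∷ V) U⊆V with factor U V (Sub.drop-∷-⊆ U⊆V)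
  ... | z , p = pair 𝟎 z , λ
    { (inside  ∷ S) → trans (+-cong (p S) (·-zeroʳ (inv 𝟎) S)) (+-identityʳ _)
    ; (outside ∷ S) → ·-zeroˡ z S }
  factor (outside ∷ U) (inside ∷ V) U⊆V with factor U V (Sub.drop-∷-⊆ U⊆V)
  -- The new generator of the cofactor has to cross `e U`; the sign compensates for this.
  ... | z , p = pair (sgn ∣ U ∣ ⊙ z) 𝟎 , λ
    { (inside  ∷ S) → begin
        (𝟎 · 𝟎) S + (inv (e U) · (sgn ∣ U ∣ ⊙ z)) S
          ≈⟨ +-cong (·-zeroˡ 𝟎 S) (trans (⊙-·ʳ (sgn ∣ U ∣) (inv (e U)) z S)
               (*-congˡ (trans (·-congʳ (inv-e U) S) (⊙-·ˡ (sgn ∣ U ∣) (e U) z S)))) ⟩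
        0# + sgn ∣ U ∣ * (sgn ∣ U ∣ * (e U · z) S)
          ≈⟨ solve 2 (λ s x → :0 :+ s :* (s :* x) := (s :* s) :* x) refl _ _ ⟩
        (sgn ∣ U ∣ * sgn ∣ U ∣) * (e U · z) S
          ≈⟨ *-cong (sgn² ∣ U ∣) (p S) ⟩
        1# * e V S
          ≈⟨ *-identityˡ _ ⟩
        e V S ∎
    ; (outside ∷ S) → ·-zeroʳ (e U) S }
  factor (outside ∷ U) (outside ∷ V) U⊆V with factor U V (Sub.drop-∷-⊆ U⊆V)
  ... | z , p = pair 𝟎 z , λ
    { (inside  ∷ S) → trans (+-cong (·-zeroˡ z S) (·-zeroʳ (inv (e U)) S)) (+-identityʳ _)
    ; (outside ∷ S) → p S }

  -- Induction over the monomial terms of an element, phrased for predicates closed under sums so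
  -- that no sum over all subsets has to be written down.
  expand : ∀ {n a} (P : A n → Set a) → (∀ {x y} → x ≋ y → P x → P y) → (∀ {x y} → P x → P y → P (x ⊕ y)) →
           ∀ x → (∀ S → P (x S ⊙ e S)) → P x
  expand {zero}  P resp add x h = resp (λ { [] → *-identityʳ _ }) (h [])
  expand {suc n} P resp add x h = resp (λ { (inside ∷ S) → +-identityʳ _ ; (outside ∷ S) → +-identityˡ _ })
    (add (expand (λ y → P (pair y 𝟎)) (λ p → resp (λ { (inside ∷ S) → p S ; (outside ∷ S) → refl }))
           (λ p q → resp (λ { (inside ∷ S) → refl ; (outside ∷ S) → +-identityˡ _ }) (add p q)) (hd x)
           (λ S → resp (λ { (inside ∷ T) → refl ; (outside ∷ T) → zeroʳ _ }) (h (inside ∷ S))))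
         (expand (λ y → P (pair 𝟎 y)) (λ p → resp (λ { (inside ∷ S) → refl ; (outside ∷ S) → p S }))
           (λ p q → resp (λ { (inside ∷ S) → +-identityˡ _ ; (outside ∷ S) → refl }) (add p q)) (tl x)
           (λ S → resp (λ { (inside ∷ T) → zeroʳ _ ; (outside ∷ T) → refl }) (h (outside ∷ S)))))

  δ : ∀ {n} → Fin n → Fin n → Carrier
  δ zero     zero     = 1#
  δ zero     (suc i)  = 0#
  δ (suc t)  zero     = 0#
  δ (suc t)  (suc i)  = δ t i

  sum-zero : ∀ {n} {f : Fin n → Carrier} → (∀ i → f i ≈ 0#) → sum f ≈ 0#
  sum-zero {zero}  p = refl
  sum-zero {suc n} p = trans (+-cong (p zero) (sum-zero (p ∘ suc))) (+-identityˡ _)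

  sum-δ : ∀ {n} (t : Fin n) (d : Fin n → Carrier) → sum (λ i → δ t i * d i) ≈ d t
  sum-δ zero d = trans (+-cong (*-identityˡ _) (sum-zero {f = λ i → 0# * d (suc i)} (λ i → zeroˡ _))) (+-identityʳ _)
  sum-δ (suc t) d = trans (+-cong (zeroˡ _) (sum-δ t (d ∘ suc))) (+-identityˡ _)

  δ-diag : ∀ {n} (t : Fin n) → δ t t ≈ 1#
  δ-diag zero     = refl
  δ-diag (suc t)  = δ-diag t

  δ-off : ∀ {n} (t i : Fin n) → t ≢ i → δ t i ≈ 0#
  δ-off zero     zero     p = contradiction ≡.refl p
  δ-off zero     (suc i)  p = refl
  δ-off (suc t)  zero     p = refl
  δ-off (suc t)  (suc i)  p = δ-off t i (p ∘ ≡.cong suc)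

  lin-δ-e : ∀ {n} (t : Fin n) (S : Subset n) → t ∈ S → lin (δ t) · e S ≋ 𝟎
  lin-δ-e zero (inside ∷ S) here (inside ∷ T) = trans
    (+-cong (·-zeroʳ (1# ⊙ 𝟏) T) (trans (·-congʳ (≋-trans (inv-cong lin-0) inv-𝟎) T) (·-zeroˡ (e S) T))) (+-identityˡ _)
  lin-δ-e zero (inside ∷ S) here (outside ∷ T) = ·-zeroʳ (lin (λ _ → 0#)) T
  lin-δ-e (suc t) (b ∷ S) (there t∈S) (inside ∷ T) = trans
    (+-cong (trans (⊙-·ˡ 0# 𝟏 (tl (e (b ∷ S))) T) (zeroˡ _))
            (trans (trans (·-congʳ (inv-lin (δ t)) T) (neg-·ˡ (lin (δ t)) (hd (e (b ∷ S))) T)) (trans (-‿cong (lemma b)) ε⁻¹≈ε))) (+-identityˡ _)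
    where
    lemma : ∀ b → (lin (δ t) · hd (e (b ∷ S))) T ≈ 0#
    lemma true   = lin-δ-e t S t∈S T
    lemma false  = ·-zeroʳ (lin (δ t)) T
  lin-δ-e (suc t) (inside ∷ S) (there t∈S) (outside ∷ T) = ·-zeroʳ (lin (δ t)) T
  lin-δ-e (suc t) (outside ∷ S) (there t∈S) (outside ∷ T) = lin-δ-e t S t∈S T

  ι-lin-· : ∀ {n} (d a : Fin n → Carrier) (x : A n) →
            ι d (lin a · x) ≋ sum (λ i → a i * d i) ⊙ x ⊕ neg (lin a · ι d x)
  ι-lin-· d a x S = trans (ι-· d (lin a) x S) (+-cong
    (trans (·-congʳ (ι-lin d a) S) (trans (⊙-·ˡ _ 𝟏 x S) (*-congˡ (·-identityˡ x S))))
    (trans (·-congʳ (inv-lin a) S) (neg-·ˡ (lin a) (ι d x) S)))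

  -- Because e_t ∧ e_S = e_t′ ∧ e_S = 0.
  e-difference : ∀ {n} (S : Subset n) {t t′} → t ∈ S → t′ ∈ S → t ≢ t′ →
                 e S ≋ lin (λ i → δ t i + - δ t′ i) · ι (δ t) (e S)
  e-difference S {t} {t′} t∈S t′∈S t≢t′ T = begin
    e S T
      ≈⟨ solve 3 (λ x y z → x := y :+ :- z :+ (:1 :* x :+ :- y) :+ :- (:0 :* x :+ :- z)) refl _ y z ⟩
    y + - z + (1# * e S T + - y) + - (0# * e S T + - z)
      ≈⟨ +-cong (+-congˡ (+-congʳ (*-congʳ (trans (sum-δ t (δ t)) (δ-diag t)))))
                (-‿cong (+-congʳ (*-congʳ (trans (sum-δ t′ (δ t)) (δ-off t t′ t≢t′))))) ⟨
    y + - z + (sum (λ i → δ t i * δ t i) * e S T + - y) + - (sum (λ i → δ t′ i * δ t i) * e S T + - z)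
      ≈⟨ +-cong (+-congˡ (vanish t t∈S)) (-‿cong (vanish t′ t′∈S)) ⟩
    y + - z + 0# + - 0#
      ≈⟨ solve 2 (λ y z → y :+ :- z :+ :0 :+ :- :0 := y :+ :- z) refl _ _ ⟩
    y + - z
      ≈⟨ +-congˡ (trans (·-congʳ (lin-neg (δ t′)) T) (neg-·ˡ (lin (δ t′)) x T)) ⟨
    y + (lin (λ i → - δ t′ i) · x) T
      ≈⟨ trans (·-congʳ (lin-+ (δ t) _) T) (·-distribʳ x (lin (δ t)) _ T) ⟨
    (lin (λ i → δ t i + - δ t′ i) · x) T ∎
    where
    x : A _
    x = ι (δ t) (e S)
    y z : Carrier
    y = (lin (δ t) · x) T
    z = (lin (δ t′) · x) T
    vanish : ∀ s → s ∈ S → sum (λ i → δ s i * δ t i) * e S T + - (lin (δ s) · x) T ≈ 0#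
    vanish s s∈S = trans (sym (ι-lin-· (δ t) (δ s) (e S) T))
                         (trans (ι-congʳ (lin-δ-e s S s∈S) T) (ι-𝟎 (δ t) T))
    lin-+ : ∀ {n} (a b : Fin n → Carrier) → lin (λ i → a i + b i) ≋ lin a ⊕ lin b
    lin-+ a b []             = sym (+-identityˡ _)
    lin-+ a b (inside  ∷ S)  = distribʳ _ _ _
    lin-+ a b (outside ∷ S)  = lin-+ (a ∘ suc) (b ∘ suc) S

  -- The number of elements of the subset that precede the given index; its parity is the sign with
  -- which that generator is brought to the front of `e S`.
  above₀ : ∀ {n} → Subset n → Fin n → ℕ
  above₀ (b ∷ S) zero     = 0
  above₀ (b ∷ S) (suc i)  = (if b then 1 else 0) ℕ.+ above₀ S i

  coef : ∀ {n} → Subset n → Fin n → Carrier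
  coef S i = if lookup S i then sgn (above₀ S i) else 0#

  coef² : ∀ {n} (S : Subset n) i → i ∈ S → coef S i * coef S i ≈ 1#
  coef² S i i∈S rewrite Vecₚ.[]=⇒lookup i∈S = sgn² (above₀ S i)

  coef-∉ : ∀ {n} (S : Subset n) i → i ∉ S → coef S i ≈ 0#
  coef-∉ S i i∉S with lookup S i in eq
  ... | true   = contradiction (Vecₚ.lookup⇒[]= i S eq) i∉S
  ... | false  = refl

  ι-e : ∀ {n} (d : Fin n → Carrier) (S : Subset n) →
        ι d (e S) ≋ λ T → sum (λ i → (coef S i * d i) * e (S ∖ i) T)
  ι-e d [] [] = refl
  ι-e d (inside ∷ S) (inside ∷ T) = begin
    - ι (d ∘ suc) (e S) T
      ≈⟨ -‿cong (ι-e (d ∘ suc) S T) ⟩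
    - sum (λ i → (coef S i * d (suc i)) * e (S ∖ i) T)
      ≈⟨ trans (solve 1 (λ s → :- s := (:- :1) :* s) refl _) (*-distribˡ-sum (- 1#) (λ i → (coef S i * d (suc i)) * e (S ∖ i) T)) ⟩
    sum (λ i → - 1# * ((coef S i * d (suc i)) * e (S ∖ i) T))
      ≈⟨ sum-cong-≋ (λ i → trans (solve 3 (λ c d x → (:- :1) :* ((c :* d) :* x) := ((:- c) :* d) :* x) refl (coef S i) (d (suc i)) (e (S ∖ i) T))
            (*-congʳ (*-congʳ (neg-coef (lookup S i) (above₀ S i))))) ⟩
    sum (λ i → (coef (inside ∷ S) (suc i) * d (suc i)) * e (S ∖ i) T)
      ≈⟨ trans (+-congʳ (zeroʳ _)) (+-identityˡ _) ⟨
    _ ∎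
    where
    neg-coef : ∀ b m → - (if b then sgn m else 0#) ≈ (if b then sgn (suc m) else 0#)
    neg-coef true   m = refl
    neg-coef false  m = ε⁻¹≈ε
  ι-e d (inside ∷ S) (outside ∷ T) = +-cong
    (*-cong (sym (*-identityˡ _)) (reflexive (≡.cong (λ S → e S T) (≡.sym (Sub.p─⊥≡p S)))))
    (trans (ι-𝟎 (d ∘ suc) T) (sym (sum-zero {f = λ i → (coef (inside ∷ S) (suc i) * d (suc i)) * 0#} (λ i → zeroʳ _))))
  ι-e d (outside ∷ S) (inside ∷ T) = trans (trans (-‿cong (ι-𝟎 (d ∘ suc) T)) ε⁻¹≈ε)
    (sym (trans (+-congˡ (sum-zero {f = λ i → (coef (outside ∷ S) (suc i) * d (suc i)) * 0#} (λ i → zeroʳ _)))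
      (trans (+-identityʳ _) (zeroʳ _))))
  ι-e d (outside ∷ S) (outside ∷ T) = +-cong
    (trans (zeroʳ _) (sym (trans (*-congʳ (zeroˡ _)) (zeroˡ _)))) (ι-e (d ∘ suc) S T)

  -- Agreement with the sums over subsets that define `_∧E_` and `∂e`.

  module Comparison where
    open Data.Nat.ListAction using () renaming (sum to ℕ-sum)
    open Data.Nat.Solver.+-*-Solver using () renaming (solve to ℕ-solve; _:=_ to _:=ₙ_; _:+_ to _:+ₙ_)

    ∑ₗ : ∀ {a} {X : Set a} → (X → Carrier) → List X → Carrier
    ∑ₗ f xs = List.foldr _+_ 0# (List.map f xs)

    ∑ₗ-cong : ∀ {a} {X : Set a} {f g : X → Carrier} xs → (∀ x → f x ≈ g x) → ∑ₗ f xs ≈ ∑ₗ g xs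
    ∑ₗ-cong []        p = refl
    ∑ₗ-cong (x ∷ xs)  p = +-cong (p x) (∑ₗ-cong xs p)

    ∑ₗ-zero : ∀ {a} {X : Set a} {f : X → Carrier} xs → (∀ x → f x ≈ 0#) → ∑ₗ f xs ≈ 0#
    ∑ₗ-zero []        p = refl
    ∑ₗ-zero (x ∷ xs)  p = trans (+-cong (p x) (∑ₗ-zero xs p)) (+-identityˡ _)

    ∑ₗ-++ : ∀ {a} {X : Set a} (f : X → Carrier) xs ys → ∑ₗ f (xs ++ ys) ≈ ∑ₗ f xs + ∑ₗ f ys
    ∑ₗ-++ f []        ys = sym (+-identityˡ _)
    ∑ₗ-++ f (x ∷ xs)  ys = trans (+-congˡ (∑ₗ-++ f xs ys)) (sym (+-assoc _ _ _))

    ∑ₗ-map : ∀ {a b} {X : Set a} {Y : Set b} (f : X → Carrier) (g : Y → X) ys → ∑ₗ f (List.map g ys) ≡ ∑ₗ (f ∘ g) ys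
    ∑ₗ-map f g ys = ≡.cong (List.foldr _+_ 0#) (≡.sym (Listₚ.map-∘ ys))

    ∑ₗ-tabulate : ∀ {n} (f : Fin n → Carrier) → List.foldr _+_ 0# (List.tabulate f) ≡ sum f
    ∑ₗ-tabulate {zero}  f = ≡.refl
    ∑ₗ-tabulate {suc n} f = ≡.cong (f zero +_) (∑ₗ-tabulate (f ∘ suc))

    ∑ₗ-allFin : ∀ {n} (f : Fin n → Carrier) → ∑ₗ f (allFin n) ≡ sum f
    ∑ₗ-allFin f = ≡.trans (≡.cong (List.foldr _+_ 0#) (Listₚ.map-tabulate id f)) (∑ₗ-tabulate f)

    ∑ₗ-subsets : ∀ {n} (f : Subset (suc n) → Carrier) →
                 ∑ₗ f (allSubsets (suc n)) ≈ ∑ₗ (f ∘ (inside ∷_)) (allSubsets n) + ∑ₗ (f ∘ (outside ∷_)) (allSubsets n)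
    ∑ₗ-subsets {n} f = trans (∑ₗ-++ f (List.map (inside ∷_) (allSubsets n)) _)
      (+-cong (reflexive (∑ₗ-map f (inside ∷_) (allSubsets n))) (reflexive (∑ₗ-map f (outside ∷_) (allSubsets n))))

    private
      below-summand : ∀ {n} → Subset n → Fin n → Fin n → ℕ
      below-summand T i j = if lookup T j ∧ (toℕ j <ᵇ toℕ i) then 1 else 0

      inversion-summand : ∀ {n} → Subset n → Subset n → Fin n → ℕ
      inversion-summand S T s = if lookup S s then countBelow T s else 0

      countBelow-step : ∀ {n} b (T : Subset n) i →
                        countBelow (b ∷ T) (suc i) ≡ (if b then 1 else 0) ℕ.+ countBelow T i
      countBelow-step {n} b T i = ≡.cong₂ ℕ._+_ (≡.cong (if_then 1 else 0) (Boolₚ.∧-identityʳ b))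
        (≡.cong ℕ-sum (≡.trans (Listₚ.map-tabulate Fin.suc (below-summand (b ∷ T) (suc i))) (≡.sym (Listₚ.map-tabulate id (below-summand T i)))))

      countBelow-zero : ∀ {n} (T : Subset (suc n)) → countBelow T zero ≡ 0
      countBelow-zero {n} T = go (allFin (suc n))
        where
        go : ∀ xs → ℕ-sum (List.map (λ j → if lookup T j ∧ (toℕ j <ᵇ 0) then 1 else 0) xs) ≡ 0
        go []        = ≡.refl
        go (x ∷ xs)  rewrite Boolₚ.∧-zeroʳ (lookup T x) = go xs

      countBelow≡above₀ : ∀ {n} (S : Subset n) i → countBelow S i ≡ above₀ S i
      countBelow≡above₀ (b ∷ S) zero     = countBelow-zero (b ∷ S)
      countBelow≡above₀ (b ∷ S) (suc i)  = ≡.trans (countBelow-step b S i)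
        (≡.cong ((if b then 1 else 0) ℕ.+_) (countBelow≡above₀ S i))

      sum-if : ∀ {k} (S : Subset k) m (g h : Fin k → ℕ) → (∀ i → h i ≡ m ℕ.+ g i) →
               ℕ-sum (List.tabulate (λ s → if lookup S s then h s else 0)) ≡
               ∣ S ∣ ℕ.* m ℕ.+ ℕ-sum (List.tabulate (λ s → if lookup S s then g s else 0))
      sum-if []             m g h p = ≡.refl
      sum-if (inside  ∷ S)  m g h p rewrite p zero | sum-if S m (g ∘ suc) (h ∘ suc) (p ∘ suc) =
        ℕ-solve 4 (λ m g x y → (m :+ₙ g) :+ₙ (x :+ₙ y) :=ₙ (m :+ₙ x) :+ₙ (g :+ₙ y)) ≡.refl m (g zero) (∣ S ∣ ℕ.* m) (ℕ-sum (List.tabulate (λ s → if lookup S s then g (suc s) else 0)))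
      sum-if (outside ∷ S)  m g h p = sum-if S m (g ∘ suc) (h ∘ suc) (p ∘ suc)

      -- The element 0 of the right factor lies below every element of the left factor.
      inversions-step : ∀ {n} b b′ (S T : Subset n) →
                        inversions (b ∷ S) (b′ ∷ T) ≡ ∣ S ∣ ℕ.* (if b′ then 1 else 0) ℕ.+ inversions S T
      inversions-step {n} b b′ S T = ≡.trans
        (≡.cong₂ ℕ._+_ (first b) (≡.cong ℕ-sum (Listₚ.map-tabulate Fin.suc (inversion-summand (b ∷ S) (b′ ∷ T)))))
        (≡.trans (sum-if S (if b′ then 1 else 0) (countBelow T) (λ i → countBelow (b′ ∷ T) (suc i)) (countBelow-step b′ T))
                 (≡.cong (λ x → ∣ S ∣ ℕ.* (if b′ then 1 else 0) ℕ.+ ℕ-sum x) (≡.sym (Listₚ.map-tabulate id (inversion-summand S T)))))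
        where
        first : ∀ b → (if b then countBelow (b′ ∷ T) zero else 0) ≡ 0
        first true   = countBelow-zero (b′ ∷ T)
        first false  = ≡.refl

    module _ {n : ℕ} where
      private
        module Ex  = Exterior K n
        module Ex⁺ = Exterior K (suc n)

        sgn≡ : ∀ m → Ex.sgn m ≡ sgn m
        sgn≡ zero     = ≡.refl
        sgn≡ (suc m)  = ≡.cong -_ (sgn≡ m)

        sgn⁺≡ : ∀ m → Ex⁺.sgn m ≡ sgn m
        sgn⁺≡ zero     = ≡.refl
        sgn⁺≡ (suc m)  = ≡.cong -_ (sgn⁺≡ m)

      wedge-in-out : ∀ S T U → Ex⁺.wedgeCoeff (inside ∷ S) (outside ∷ T) (inside ∷ U) ≈ Ex.wedgeCoeff S T U
      wedge-in-out S T U with (∣ S ∩ T ∣ ≡ᵇ 0)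
      ... | false = refl
      ... | true with (S ∪ T) ≟S U
      ...   | no _ = refl
      ...   | yes _ = reflexive (≡.trans (sgn⁺≡ (inversions (inside ∷ S) (outside ∷ T))) (≡.trans (≡.cong sgn (≡.trans (inversions-step true false S T)
                        (≡.cong (ℕ._+ inversions S T) (ℕₚ.*-zeroʳ ∣ S ∣)))) (≡.sym (sgn≡ (inversions S T)))))

      -- The new first generator of the right factor has to cross all of `S`; this is where the
      -- involution in `_·_` comes from.
      wedge-out-in : ∀ S T U → Ex⁺.wedgeCoeff (outside ∷ S) (inside ∷ T) (inside ∷ U) ≈ sgn ∣ S ∣ * Ex.wedgeCoeff S T U
      wedge-out-in S T U with (∣ S ∩ T ∣ ≡ᵇ 0)
      ... | false = sym (zeroʳ _)
      ... | true with (S ∪ T) ≟S U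
      ...   | no _ = sym (zeroʳ _)
      ...   | yes _ = trans (reflexive (≡.trans (sgn⁺≡ (inversions (outside ∷ S) (inside ∷ T))) (≡.cong sgn (≡.trans (inversions-step false true S T)
                        (≡.cong (ℕ._+ inversions S T) (ℕₚ.*-identityʳ ∣ S ∣))))))
                        (trans (sgn-+ ∣ S ∣ (inversions S T)) (*-congˡ (reflexive (≡.sym (sgn≡ (inversions S T))))))

      wedge-out-out : ∀ S T U → Ex⁺.wedgeCoeff (outside ∷ S) (outside ∷ T) (outside ∷ U) ≈ Ex.wedgeCoeff S T U
      wedge-out-out S T U with (∣ S ∩ T ∣ ≡ᵇ 0)
      ... | false = refl
      ... | true with (S ∪ T) ≟S U
      ...   | no _ = refl
      ...   | yes _ = reflexive (≡.trans (sgn⁺≡ (inversions (outside ∷ S) (outside ∷ T))) (≡.trans (≡.cong sgn (≡.trans (inversions-step false false S T)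
                        (≡.cong (ℕ._+ inversions S T) (ℕₚ.*-zeroʳ ∣ S ∣)))) (≡.sym (sgn≡ (inversions S T)))))

      wedge-clash : ∀ b b′ S T U → (b ∨ b′) ≢ inside → Ex⁺.wedgeCoeff (b ∷ S) (b′ ∷ T) (inside ∷ U) ≈ 0#
      wedge-clash true   b′     S T U p = contradiction ≡.refl p
      wedge-clash false  true   S T U p = contradiction ≡.refl p
      wedge-clash false  false  S T U p with (∣ S ∩ T ∣ ≡ᵇ 0)
      ... | true   = refl
      ... | false  = refl

      wedge-clash′ : ∀ b b′ S T U → (b ∨ b′) ≢ outside → Ex⁺.wedgeCoeff (b ∷ S) (b′ ∷ T) (outside ∷ U) ≈ 0#
      wedge-clash′ true   true   S T U p = refl
      wedge-clash′ true   false  S T U p with (∣ S ∩ T ∣ ≡ᵇ 0)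
      ... | true   = refl
      ... | false  = refl
      wedge-clash′ false  true   S T U p with (∣ S ∩ T ∣ ≡ᵇ 0)
      ... | true   = refl
      ... | false  = refl
      wedge-clash′ false  false  S T U p = contradiction ≡.refl p

    private
      W : ∀ n → A n → A n → (Subset n → Subset n → Carrier) → Carrier
      W n f g w = ∑ₗ (λ S → ∑ₗ (λ T → (f S * g T) * w S T) (allSubsets n)) (allSubsets n)

      W-split : ∀ {n} (f g : A (suc n)) w → W (suc n) f g w ≈
        (W n (hd f) (hd g) (λ S T → w (inside ∷ S) (inside ∷ T)) + W n (hd f) (tl g) (λ S T → w (inside ∷ S) (outside ∷ T))) +
        (W n (tl f) (hd g) (λ S T → w (outside ∷ S) (inside ∷ T)) + W n (tl f) (tl g) (λ S T → w (outside ∷ S) (outside ∷ T)))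
      W-split {n} f g w = trans (∑ₗ-subsets (λ S → ∑ₗ (λ T → (f S * g T) * w S T) (allSubsets (suc n)))) (+-cong (half inside) (half outside))
        where
        half : ∀ b → ∑ₗ (λ S → ∑ₗ (λ T → (f (b ∷ S) * g T) * w (b ∷ S) T) (allSubsets (suc n))) (allSubsets n) ≈
               W n (λ S → f (b ∷ S)) (hd g) (λ S T → w (b ∷ S) (inside ∷ T)) + W n (λ S → f (b ∷ S)) (tl g) (λ S T → w (b ∷ S) (outside ∷ T))
        half b = trans (∑ₗ-cong (allSubsets n) (λ S → ∑ₗ-subsets (λ T → (f (b ∷ S) * g T) * w (b ∷ S) T))) (∑ₗ-⊕ (allSubsets n))
          where
          ∑ₗ-⊕ : ∀ {a} {X : Set a} {f g : X → Carrier} xs → ∑ₗ (λ x → f x + g x) xs ≈ ∑ₗ f xs + ∑ₗ g xs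
          ∑ₗ-⊕ []        = sym (+-identityˡ _)
          ∑ₗ-⊕ (x ∷ xs)  = trans (+-congˡ (∑ₗ-⊕ xs)) (solve 4 (λ a b c d → (a :+ b) :+ (c :+ d) := (a :+ c) :+ (b :+ d)) refl _ _ _ _)

      W-cong : ∀ {n} {f f′ g : A n} {w w′} → (∀ S T → f S * w S T ≈ f′ S * w′ S T) → W n f g w ≈ W n f′ g w′
      W-cong {n} p = ∑ₗ-cong (allSubsets n) (λ S → ∑ₗ-cong (allSubsets n) (λ T → trans (swap _ _ _) (trans (*-congʳ (p S T)) (sym (swap _ _ _)))))
        where
        swap : ∀ a b c → (a * b) * c ≈ (a * c) * b
        swap = solve 3 (λ a b c → (a :* b) :* c := (a :* c) :* b) refl

      W-zero : ∀ {n} {f g : A n} {w} → (∀ S T → w S T ≈ 0#) → W n f g w ≈ 0#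
      W-zero {n} p = ∑ₗ-zero (allSubsets n) (λ S → ∑ₗ-zero (allSubsets n) (λ T → trans (*-congˡ (p S T)) (zeroʳ _)))

    ∧E≋· : ∀ {n} (x y : A n) → Exterior._∧E_ K n x y ≋ x · y
    ∧E≋· {zero} x y [] = solve 2 (λ x y → (x :* y) :* :1 :+ :0 :+ :0 := x :* y) refl _ _
    ∧E≋· {suc n} x y (inside ∷ U) = begin
      W (suc n) x y (λ S T → Exterior.wedgeCoeff K (suc n) S T (inside ∷ U))
        ≈⟨ W-split x y _ ⟩
      _ ≈⟨ +-cong (+-cong (W-zero {f = hd x} {hd y} (λ S T → refl)) (W-cong {f = hd x} (λ S T → *-congˡ (wedge-in-out S T U))))
                  (+-cong (W-cong {f = tl x} {f′ = inv (tl x)} (λ S T → trans (*-congˡ (wedge-out-in S T U))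
                              (trans (solve 3 (λ a b c → a :* (b :* c) := (b :* a) :* c) refl _ _ _) (*-congʳ (sym (inv-coeff (tl x) S))))))
                          (W-zero {f = tl x} {tl y} (λ S T → wedge-clash false false S T U (λ ())))) ⟩
      (0# + Exterior._∧E_ K n (hd x) (tl y) U) + (Exterior._∧E_ K n (inv (tl x)) (hd y) U + 0#)
        ≈⟨ +-cong (trans (+-identityˡ _) (∧E≋· (hd x) (tl y) U)) (trans (+-identityʳ _) (∧E≋· (inv (tl x)) (hd y) U)) ⟩
      (hd x · tl y) U + (inv (tl x) · hd y) U ∎
    ∧E≋· {suc n} x y (outside ∷ U) = begin
      W (suc n) x y (λ S T → Exterior.wedgeCoeff K (suc n) S T (outside ∷ U))
        ≈⟨ W-split x y _ ⟩
      _ ≈⟨ +-cong (+-cong (W-zero {f = hd x} {hd y} (λ S T → refl)) (W-zero {f = hd x} {tl y} (λ S T → wedge-clash′ true false S T U (λ ()))))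
                  (+-cong (W-zero {f = tl x} {hd y} (λ S T → wedge-clash′ false true S T U (λ ())))
                          (W-cong {f = tl x} (λ S T → *-congˡ (wedge-out-out S T U)))) ⟩
      (0# + 0#) + (0# + Exterior._∧E_ K n (tl x) (tl y) U)
        ≈⟨ trans (+-cong (+-identityˡ _) (+-identityˡ _)) (+-identityˡ _) ⟩
      Exterior._∧E_ K n (tl x) (tl y) U
        ≈⟨ ∧E≋· (tl x) (tl y) U ⟩
      (tl x · tl y) U ∎

    ∂e≋ι : ∀ {n} (S : Subset n) → Exterior.∂e K n S ≋ ι (λ _ → 1#) (e S)
    ∂e≋ι {n} S T = trans (reflexive (∑ₗ-allFin (λ i → if lookup S i ∧ ⌊ T ≟S (S ∖ i) ⌋ then Exterior.sgn K n (countBelow S i) else 0#))) (trans (sum-cong-≋ (λ i → lemma i (lookup S i))) (sym (ι-e (λ _ → 1#) S T)))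
      where
      sgn≡′ : ∀ m → Exterior.sgn K n m ≡ sgn m
      sgn≡′ zero     = ≡.refl
      sgn≡′ (suc m)  = ≡.cong -_ (sgn≡′ m)
      lemma : ∀ i b → (if b ∧ ⌊ T ≟S (S ∖ i) ⌋ then Exterior.sgn K n (countBelow S i) else 0#) ≈
              ((if b then sgn (above₀ S i) else 0#) * 1#) * e (S ∖ i) T
      lemma i false = sym (trans (*-congʳ (zeroˡ _)) (zeroˡ _))
      lemma i true with T ≟S (S ∖ i)
      ... | no  T≢  = sym (trans (*-congˡ (e-off (S ∖ i) T (T≢ ∘ ≡.sym))) (zeroʳ _))
      ... | yes eq  = trans (reflexive (≡.trans (sgn≡′ (countBelow S i)) (≡.cong sgn (countBelow≡above₀ S i))))
                        (sym (trans (*-cong (*-identityʳ _) (trans (reflexive (≡.cong (e (S ∖ i)) eq)) (e-diag (S ∖ i)))) (*-identityʳ _)))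

-- Insertion and deletion of elements in subsets.

infixl 6 _▹_
_▹_ : ∀ {n} → Subset n → Fin n → Subset n
A ▹ x = A ∪ ⁅ x ⁆

module _ {n : ℕ} where

  ⊆▹ : ∀ {A : Subset n} {x} → A ⊆ A ▹ x
  ⊆▹ {A} {x} = Sub.p⊆p∪q ⁅ x ⁆

  ∈▹ : ∀ (A : Subset n) x → x ∈ A ▹ x
  ∈▹ A x = Sub.q⊆p∪q A ⁅ x ⁆ (Sub.x∈⁅x⁆ x)

  ∈▹⁻ : ∀ (A : Subset n) x {y} → y ∈ A ▹ x → y ∈ A ⊎ y ≡ x
  ∈▹⁻ A x y∈ with Sub.x∈p∪q⁻ A ⁅ x ⁆ y∈
  ... | inj₁ y∈A = inj₁ y∈A
  ... | inj₂ y∈x = inj₂ (Sub.x∈⁅y⁆⇒x≡y x y∈x)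

  ▹⊆ : ∀ {A B : Subset n} {x} → A ⊆ B → x ∈ B → A ▹ x ⊆ B
  ▹⊆ {A} {x = x} A⊆B x∈B y∈ with ∈▹⁻ A x y∈
  ... | inj₁ y∈A = A⊆B y∈A
  ... | inj₂ ≡.refl = x∈B

  ▹-mono : ∀ {A B : Subset n} {x} → A ⊆ B → A ▹ x ⊆ B ▹ x
  ▹-mono {B = B} {x} A⊆B = ▹⊆ (⊆▹ ∘ A⊆B) (∈▹ B x)

  ▹-absorb : ∀ {A : Subset n} {x} → x ∈ A → A ▹ x ≡ A
  ▹-absorb x∈A = Sub.⊆-antisym (▹⊆ id x∈A) ⊆▹

  ▹-comm : ∀ (A : Subset n) x y → A ▹ x ▹ y ≡ A ▹ y ▹ x
  ▹-comm A x y = Sub.⊆-antisym (half x y) (half y x)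
    where
    half : ∀ x y → A ▹ x ▹ y ⊆ A ▹ y ▹ x
    half x y = ▹⊆ (▹-mono ⊆▹) (⊆▹ (∈▹ A y))

  ∖⊆ : ∀ (A : Subset n) x → A ∖ x ⊆ A
  ∖⊆ A x = Sub.p─q⊆p A ⁅ x ⁆

  ∈∖⁻ : ∀ (A : Subset n) x {y} → y ∈ A ∖ x → y ≢ x
  ∈∖⁻ A x y∈ ≡.refl = x∉∖ A x y∈
    where
    x∉∖ : ∀ {n} (A : Subset n) x → x ∉ A ∖ x
    x∉∖ (b ∷ A) zero     ()
    x∉∖ (b ∷ A) (suc x)  (there p) = x∉∖ A x p

  ∉⇒⊆∖ : ∀ {A B : Subset n} {x} → A ⊆ B → x ∉ A → A ⊆ B ∖ x
  ∉⇒⊆∖ A⊆B x∉A y∈A = Sub.x∈p∧x≢y⇒x∈p-y (A⊆B y∈A) (λ { ≡.refl → x∉A y∈A })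

  ⊆∖▹ : ∀ (A : Subset n) x → A ⊆ (A ∖ x) ▹ x
  ⊆∖▹ A x {y} y∈A with y Fin.≟ x
  ... | yes ≡.refl = ∈▹ (A ∖ x) x
  ... | no  y≢x    = ⊆▹ (Sub.x∈p∧x≢y⇒x∈p-y y∈A y≢x)

  ∖▹ : ∀ {A : Subset n} {x} → x ∈ A → (A ∖ x) ▹ x ≡ A
  ∖▹ {A} {x} x∈A = Sub.⊆-antisym (▹⊆ (∖⊆ A x) x∈A) (⊆∖▹ A x)

  ▹∖ : ∀ {A : Subset n} {x} → x ∉ A → (A ▹ x) ∖ x ≡ A
  ▹∖ {A} {x} x∉A = Sub.⊆-antisym
    (λ y∈ → [ id , (λ y≡x → contradiction y≡x (∈∖⁻ (A ▹ x) x y∈)) ]′ (∈▹⁻ A x (∖⊆ (A ▹ x) x y∈)))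
    (∉⇒⊆∖ ⊆▹ x∉A)

  ⊆∧∣∣≤⇒≡ : ∀ {A B : Subset n} → A ⊆ B → ∣ B ∣ ℕ.≤ ∣ A ∣ → A ≡ B
  ⊆∧∣∣≤⇒≡ {A} {B} A⊆B ∣B∣≤∣A∣ = Sub.⊆-antisym A⊆B (λ {x} x∈B → decidable-stable (x Sub.∈? A)
    (λ x∉A → ℕₚ.<⇒≱ (Sub.p⊂q⇒∣p∣<∣q∣ (A⊆B , x , x∈B , x∉A)) ∣B∣≤∣A∣))

∣▹∣ : ∀ {n} (A : Subset n) x → x ∉ A → ∣ A ▹ x ∣ ≡ suc ∣ A ∣
∣▹∣ (inside  ∷ A) zero     x∉A = contradiction here x∉A
∣▹∣ (outside ∷ A) zero     x∉A = ≡.cong (suc ∘ ∣_∣) (Sub.∪-identityʳ A)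
∣▹∣ (inside  ∷ A) (suc x)  x∉A = ≡.cong suc (∣▹∣ A x (x∉A ∘ there))
∣▹∣ (outside ∷ A) (suc x)  x∉A = ∣▹∣ A x (x∉A ∘ there)

∣∖∣ : ∀ {n} {A : Subset n} {x} → x ∈ A → suc ∣ A ∖ x ∣ ≡ ∣ A ∣
∣∖∣ {A = A} {x} x∈A = ≡.trans (≡.sym (∣▹∣ (A ∖ x) x (λ p → ∈∖⁻ A x p ≡.refl))) (≡.cong ∣_∣ (∖▹ x∈A))

-- Rank, closure and circuits.

module MatroidTheory {n : ℕ} (M : Matroid n) where
  open Matroid M using (indep; empty-indep; hereditary; exchange)

  Ind : Subset n → Set
  Ind = Independent M

  Ind? : ∀ S → Dec (Ind S)
  Ind? S = indep S Bool.≟ true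

  ¬Ind⇒Dependent : ∀ {S} → ¬ Ind S → Dependent M S
  ¬Ind⇒Dependent = Boolₚ.¬-not

  Dependent⇒¬Ind : ∀ {S} → Dependent M S → ¬ Ind S
  Dependent⇒¬Ind p q with ≡.trans (≡.sym p) q
  ... | ()

  BasisOf : Subset n → Subset n → Set
  BasisOf X J = J ⊆ X × Ind J × (∀ x → x ∈ X → x ∉ J → ¬ Ind (J ▹ x))

  abstract
    extend : ∀ X {I} → I ⊆ X → Ind I → ∃ λ J → I ⊆ J × BasisOf X J
    extend X {I} = go n I (ℕₚ.m≤n+m n ∣ I ∣)
      where
      go : ∀ m I → n ℕ.≤ ∣ I ∣ ℕ.+ m → I ⊆ X → Ind I → ∃ λ J → I ⊆ J × BasisOf X J
      go m I n≤ I⊆X indI with Finₚ.any? (λ x → (x Sub.∈? X) ×-dec ((¬? (x Sub.∈? I)) ×-dec Ind? (I ▹ x)))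
      ... | no none = I , id , I⊆X , indI , λ x x∈X x∉I ind → none (x , x∈X , x∉I , ind)
      go zero I n≤ I⊆X indI | yes (x , x∈X , x∉I , ind) = contradiction
        (≡.subst (x ∈_) (≡.sym (Sub.∣p∣≡n⇒p≡⊤ (ℕₚ.≤-antisym (Sub.∣p∣≤n I) (≡.subst (n ℕ.≤_) (ℕₚ.+-identityʳ _) n≤)))) Sub.∈⊤) x∉I
      go (suc m) I n≤ I⊆X indI | yes (x , x∈X , x∉I , ind)
        with go m (I ▹ x) (≡.subst (n ℕ.≤_) (≡.trans (ℕₚ.+-suc _ m) (≡.cong (ℕ._+ m) (≡.sym (∣▹∣ I x x∉I)))) n≤) (▹⊆ I⊆X x∈X) ind
      ... | J , ⊆J , basis = J , ⊆J ∘ ⊆▹ , basis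

    basis : ∀ X → ∃ (BasisOf X)
    basis X = proj₁ J , proj₂ (proj₂ J)
      where
      J : ∃ λ J → ∅ ⊆ J × BasisOf X J
      J = extend X (λ p → contradiction p Sub.∉⊥) empty-indep

  Ind⇒∣∣≤∣basis∣ : ∀ {X I J} → BasisOf X J → Ind I → I ⊆ X → ∣ I ∣ ℕ.≤ ∣ J ∣
  Ind⇒∣∣≤∣basis∣ {X} {I} {J} (J⊆X , indJ , maxJ) indI I⊆X = ℕₚ.≮⇒≥ λ lt →
    case exchange J I indJ indI lt of λ { (x , x∈I , x∉J , ind) → maxJ x (I⊆X x∈I) x∉J ind }

  r : Subset n → ℕ
  r X = ∣ proj₁ (basis X) ∣

  Ind⇒∣∣≤r : ∀ {X I} → Ind I → I ⊆ X → ∣ I ∣ ℕ.≤ r X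
  Ind⇒∣∣≤r {X} = Ind⇒∣∣≤∣basis∣ (proj₂ (basis X))

  ∣basis∣≡r : ∀ {X J} → BasisOf X J → ∣ J ∣ ≡ r X
  ∣basis∣≡r {X} b@(J⊆X , indJ , _) = ℕₚ.≤-antisym (Ind⇒∣∣≤r indJ J⊆X)
    (Ind⇒∣∣≤∣basis∣ b (proj₁ (proj₂ (proj₂ (basis X)))) (proj₁ (proj₂ (basis X))))

  r-mono : ∀ {X Y} → X ⊆ Y → r X ℕ.≤ r Y
  r-mono {X} X⊆Y = let (J , J⊆X , indJ , _) = basis X in Ind⇒∣∣≤r indJ (X⊆Y ∘ J⊆X)

  r-▹≤ : ∀ X x → r (X ▹ x) ℕ.≤ suc (r X)
  r-▹≤ X x = let (J , J⊆ , indJ , _) = basis (X ▹ x) in ℕₚ.≤-trans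
    (ℕₚ.≤-trans (Sub.p⊆q⇒∣p∣≤∣q∣ (⊆∖▹ J x)) (ℕₚ.≤-reflexive (∣▹∣ (J ∖ x) x (λ p → ∈∖⁻ J x p ≡.refl))))
    (s≤s (Ind⇒∣∣≤r (hereditary (∖⊆ J x) indJ)
      (λ {y} y∈ → [ id , (λ y≡x → contradiction y≡x (∈∖⁻ J x y∈)) ]′ (∈▹⁻ X x (J⊆ (∖⊆ J x y∈))))))

  r≤∣∣ : ∀ X → r X ℕ.≤ ∣ X ∣
  r≤∣∣ X = Sub.p⊆q⇒∣p∣≤∣q∣ (proj₁ (proj₂ (basis X)))

  Ind⇒r≡∣∣ : ∀ {X} → Ind X → r X ≡ ∣ X ∣
  Ind⇒r≡∣∣ indX = ℕₚ.≤-antisym (r≤∣∣ _) (Ind⇒∣∣≤r indX id)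

  ∣∣≤r⇒Ind : ∀ {X} → ∣ X ∣ ℕ.≤ r X → Ind X
  ∣∣≤r⇒Ind {X} le = let (J , J⊆X , indJ , _) = basis X in ≡.subst Ind (⊆∧∣∣≤⇒≡ J⊆X le) indJ

  -- Membership in the closure, stated through the rank: it is then decidable, and exchange becomes
  -- an inequality of ranks.
  Cl : Subset n → Fin n → Set
  Cl X x = r (X ▹ x) ≡ r X

  Cl? : ∀ X x → Dec (Cl X x)
  Cl? X x = r (X ▹ x) ℕ.≟ r X

  ¬Cl⇒r▹ : ∀ {X x} → ¬ Cl X x → r (X ▹ x) ≡ suc (r X)
  ¬Cl⇒r▹ {X} {x} ¬cl = ℕₚ.≤-antisym (r-▹≤ X x) (ℕₚ.≤∧≢⇒< (r-mono ⊆▹) (¬cl ∘ ≡.sym))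

  ∈⇒Cl : ∀ {X x} → x ∈ X → Cl X x
  ∈⇒Cl x∈X = ≡.cong r (▹-absorb x∈X)

  ¬Cl⇒Ind▹ : ∀ {X J x} → BasisOf X J → ¬ Cl X x → x ∉ J × Ind (J ▹ x)
  ¬Cl⇒Ind▹ {X} {J} {x} b@(J⊆X , indJ , maxJ) ¬cl = (λ x∈J → ¬cl (∈⇒Cl (J⊆X x∈J))) ,
    decidable-stable (Ind? (J ▹ x)) λ ¬ind → ¬cl (≡.trans
      (≡.sym (∣basis∣≡r (⊆▹ ∘ J⊆X , indJ ,
        λ y y∈ y∉J → [ (λ y∈X → maxJ y y∈X y∉J) , (λ { ≡.refl → ¬ind }) ]′ (∈▹⁻ X x y∈))))
      (∣basis∣≡r b))

  Ind▹⇒¬Cl : ∀ {X J x} → BasisOf X J → x ∉ J → Ind (J ▹ x) → ¬ Cl X x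
  Ind▹⇒¬Cl {X} {J} {x} b@(J⊆X , _) x∉J ind cl = ℕₚ.<-irrefl ≡.refl (begin-strict
    r X          ≡⟨ ∣basis∣≡r b ⟨
    ∣ J ∣        <⟨ ℕₚ.≤-reflexive (≡.sym (∣▹∣ J x x∉J)) ⟩
    ∣ J ▹ x ∣    ≤⟨ Ind⇒∣∣≤r ind (▹-mono J⊆X) ⟩
    r (X ▹ x)    ≡⟨ cl ⟩
    r X          ∎)
    where open ℕₚ.≤-Reasoning

  -- A basis of `X` extends to a basis of `Y`, and an element independent of the larger basis is
  -- independent of the smaller one.
  Cl-mono : ∀ {X Y x} → X ⊆ Y → Cl X x → Cl Y x
  Cl-mono {X} {Y} {x} X⊆Y cl = decidable-stable (Cl? Y x) λ ¬cl →
    let (J , b@(J⊆X , indJ , _)) = basis X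
        (J′ , J⊆J′ , b′) = extend Y (X⊆Y ∘ J⊆X) indJ
        (x∉J′ , ind) = ¬Cl⇒Ind▹ b′ ¬cl
    in Ind▹⇒¬Cl b (x∉J′ ∘ J⊆J′) (hereditary (▹-mono J⊆J′) ind) cl

  -- If `Y` lies in the closure of `X`, a basis of `X` is also a basis of `X ∪ Y`, so an element
  -- independent of it cannot be in the closure of `Y`.
  Cl-trans : ∀ {X Y x} → (∀ {y} → y ∈ Y → Cl X y) → Cl Y x → Cl X x
  Cl-trans {X} {Y} {x} Y⊆ cl = decidable-stable (Cl? X x) λ ¬cl →
    let (J , b@(J⊆X , indJ , maxJ)) = basis X
        (x∉J , ind) = ¬Cl⇒Ind▹ b ¬cl
    in Ind▹⇒¬Cl {X ∪ Y} (Sub.p⊆p∪q Y ∘ J⊆X , indJ , λ y y∈ y∉J → [ (λ y∈X → maxJ y y∈X y∉J)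
        , (λ y∈Y indy → Ind▹⇒¬Cl b y∉J indy (Y⊆ y∈Y)) ]′ (Sub.x∈p∪q⁻ X Y y∈))
        x∉J ind (Cl-mono (Sub.q⊆p∪q X Y) cl)

  Cl-exchange : ∀ {X x y} → Cl (X ▹ y) x → ¬ Cl X x → Cl (X ▹ x) y
  Cl-exchange {X} {x} {y} cl ¬cl = ℕₚ.≤-antisym (begin
    r (X ▹ x ▹ y)  ≡⟨ ≡.cong r (▹-comm X x y) ⟩
    r (X ▹ y ▹ x)  ≡⟨ cl ⟩
    r (X ▹ y)      ≤⟨ r-▹≤ X y ⟩
    suc (r X)      ≡⟨ ¬Cl⇒r▹ ¬cl ⟨
    r (X ▹ x)      ∎) (r-mono ⊆▹)
    where open ℕₚ.≤-Reasoning

  basis-self : ∀ {X} → Ind X → BasisOf X X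
  basis-self ind = id , ind , λ x x∈X x∉X _ → x∉X x∈X

  Ind-▹ : ∀ {X x} → Ind X → ¬ Cl X x → Ind (X ▹ x)
  Ind-▹ ind ¬cl = proj₂ (¬Cl⇒Ind▹ (basis-self ind) ¬cl)

  Ind⇒¬Cl : ∀ {X x} → Ind (X ▹ x) → x ∉ X → ¬ Cl X x
  Ind⇒¬Cl ind x∉X = Ind▹⇒¬Cl (basis-self (hereditary ⊆▹ ind)) x∉X ind

  abstract
    circuit-in : ∀ S → ¬ Ind S → ∃ λ C → Circuit M C × C ⊆ S
    circuit-in S = go S (<-wellFounded ∣ S ∣)
      where
      go : ∀ S → Acc ℕ._<_ ∣ S ∣ → ¬ Ind S → ∃ λ C → Circuit M C × C ⊆ S
      go S (acc rec) dep with Finₚ.any? (λ x → (x Sub.∈? S) ×-dec ¬? (Ind? (S ∖ x)))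
      ... | yes (x , x∈S , dep′) with go (S ∖ x) (rec (Sub.x∈p⇒∣p-x∣<∣p∣ x∈S)) dep′
      ...   | C , circ , C⊆ = C , circ , ∖⊆ S x ∘ C⊆
      go S (acc rec) dep | no none = S , (¬Ind⇒Dependent dep , λ { D (D⊆S , x , x∈S , x∉D) →
        hereditary (∉⇒⊆∖ D⊆S x∉D) (decidable-stable (Ind? (S ∖ x)) (λ dep′ → none (x , x∈S , dep′))) }) , id

  circuit-Cl : ∀ {C t} → Circuit M C → t ∈ C → Cl (C ∖ t) t
  circuit-Cl {C} {t} (dep , min) t∈C = decidable-stable (Cl? (C ∖ t) t) λ ¬cl →
    Dependent⇒¬Ind dep (≡.subst Ind (∖▹ t∈C) (Ind-▹ (min (C ∖ t) (Sub.x∈p⇒p-x⊂p t∈C)) ¬cl))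

  ∅-Cl⇒Loop : ∀ {t} → Cl ∅ t → Loop M t
  ∅-Cl⇒Loop {t} cl = ¬Ind⇒Dependent λ ind → Ind⇒¬Cl (≡.subst Ind (≡.sym (Sub.∪-identityˡ ⁅ t ⁆)) ind) Sub.∉⊥ cl

  -- Sets without broken circuits and their flags of closures.

  module Ordered (pos : Fin n → ℕ) (pos-injective : ∀ {x y} → pos x ≡ pos y → x ≡ y)
                 (pos≢0 : ∀ x → pos x ≢ 0) (N : ℕ) (pos≤N : ∀ x → pos x ℕ.≤ N) where

    abstract
      above : ℕ → Subset n → Subset n
      above q S = tabulate (λ x → lookup S x ∧ (q <ᵇ pos x))

      ∈above⁺ : ∀ {q S x} → x ∈ S → q ℕ.< pos x → x ∈ above q S
      ∈above⁺ {q} {S} {x} x∈S q<x = Vecₚ.lookup⇒[]= x _ (≡.trans (Vecₚ.lookup∘tabulate _ x)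
        (≡.cong₂ _∧_ (Vecₚ.[]=⇒lookup x∈S) (T⇒≡true (ℕₚ.<⇒<ᵇ q<x))))
        where
        T⇒≡true : ∀ {b} → Bool.T b → b ≡ true
        T⇒≡true {true} _ = ≡.refl

      ∈above⁻ : ∀ {q S x} → x ∈ above q S → x ∈ S × q ℕ.< pos x
      ∈above⁻ {q} {S} {x} x∈ = split (lookup S x) (q <ᵇ pos x) ≡.refl ≡.refl
          (≡.trans (≡.sym (Vecₚ.lookup∘tabulate _ x)) (Vecₚ.[]=⇒lookup x∈))
        where
        split : ∀ a b → lookup S x ≡ a → (q <ᵇ pos x) ≡ b → a ∧ b ≡ true → x ∈ S × q ℕ.< pos x
        split true true eq eq′ _ = Vecₚ.lookup⇒[]= x S eq , ℕₚ.<ᵇ⇒< q (pos x) (≡.subst Bool.T (≡.sym eq′) tt)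

    above-antitone : ∀ {p q S} → p ℕ.≤ q → above q S ⊆ above p S
    above-antitone p≤q x∈ = let (x∈S , q<x) = ∈above⁻ x∈ in ∈above⁺ x∈S (ℕₚ.≤-<-trans p≤q q<x)

    above⊆ : ∀ {q S} → above q S ⊆ S
    above⊆ = proj₁ ∘ ∈above⁻

    -- S contains no broken circuit: no i is the smallest element of a circuit
    -- whose other elements lie in S.
    NBC : Subset n → Set
    NBC S = ∀ i → Ind (above (pos i) S ▹ i)

    NBC⇒¬Cl : ∀ {S} → NBC S → ∀ i → ¬ Cl (above (pos i) S) i
    NBC⇒¬Cl nbc i = Ind⇒¬Cl (nbc i) (λ i∈ → ℕₚ.<-irrefl ≡.refl (proj₂ (∈above⁻ i∈)))

    module Levels (loopless : Loopless M) (S : Subset n) where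

      -- The closures of `above p S` shrink as `p` grows. The search returns one more than the
      -- largest `p` below its start for which `t` is in the closure, or 0 if there is none. The
      -- level 0 thus marks the elements outside the closure of `S` and must not be a position.
      search : ℕ → Fin n → ℕ
      search zero     t = 0
      search (suc p)  t with Cl? (above p S) t
      ... | yes _ = suc p
      ... | no  _ = search p t

      level : Fin n → ℕ
      level = search N

      private
        search-¬Cl : ∀ m t → ∀ p → search m t ℕ.≤ p → p ℕ.< m → ¬ Cl (above p S) t
        search-¬Cl (suc m) t p le lt cl with Cl? (above m S) t
        ... | yes _ = ℕₚ.<⇒≱ lt le
        ... | no ¬cl with ℕₚ.m≤n⇒m<n∨m≡n (ℕₚ.≤-pred lt)
        ...   | inj₁ p<m     = search-¬Cl m t p le p<m cl
        ...   | inj₂ ≡.refl  = ¬cl cl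

        search-Cl : ∀ m t p → search m t ≡ suc p → Cl (above p S) t
        search-Cl (suc m) t p eq with Cl? (above m S) t
        ... | yes cl = ≡.subst (λ q → Cl (above q S) t) (ℕₚ.suc-injective eq) cl
        ... | no  _  = search-Cl m t p eq

      level-¬Cl : ∀ {t p} → level t ℕ.≤ p → ¬ Cl (above p S) t
      level-¬Cl {t} {p} le cl with p ℕ.<? N
      ... | yes p<N = search-¬Cl N t p le p<N cl
      -- From `N` on the set `above p S` is empty, and only a loop lies in its closure.
      ... | no  p≮N = loopless t (∅-Cl⇒Loop (≡.subst (λ X → Cl X t) above≡∅ cl))
        where
        above≡∅ : above p S ≡ ∅
        above≡∅ = Sub.Empty-unique λ (x , x∈) → p≮N (ℕₚ.<-≤-trans (proj₂ (∈above⁻ x∈)) (pos≤N x))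

      level-Cl : ∀ {t p} → p ℕ.< level t → Cl (above p S) t
      level-Cl {t} {p} p<l with level t in eq
      ... | suc q = Cl-mono (above-antitone (ℕₚ.≤-pred p<l)) (search-Cl N t q eq)

      level-unique : ∀ {t p} → Cl (above p S) t → ¬ Cl (above (suc p) S) t → level t ≡ suc p
      level-unique {t} {p} cl ¬cl = ℕₚ.≤-antisym
        (ℕₚ.≮⇒≥ (λ lt → ¬cl (level-Cl lt))) (ℕₚ.≰⇒> (λ le → level-¬Cl le cl))

      -- In a circuit choose `t` of least level. If all other elements had a greater level, they
      -- would lie in the closure of `above (level t) S`, and so would `t`, contrary to the choice
      -- of the level.
      dependent⇒equal-levels : ∀ {T} → ¬ Ind T → ∃ λ t → ∃ λ t′ → t ∈ T × t′ ∈ T × t ≢ t′ × level t ≡ level t′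
      dependent⇒equal-levels {T} dep = t , t′ , C⊆T t∈C , C⊆T t′∈C , t≢t′ , eq
        where
        C = proj₁ (circuit-in T dep)
        circ = proj₁ (proj₂ (circuit-in T dep))
        C⊆T : C ⊆ T
        C⊆T = proj₂ (proj₂ (circuit-in T dep))
        start : ∃ λ x → x ∈ C
        start = decidable-stable (Sub.nonempty? C) λ empty →
          Dependent⇒¬Ind (proj₁ circ) (≡.subst Ind (≡.sym (Sub.Empty-unique empty)) empty-indep)
        minimal : ∀ x → x ∈ C → Acc ℕ._<_ (level x) → ∃ λ t → t ∈ C × (∀ y → y ∈ C → level t ℕ.≤ level y)
        minimal x x∈C (acc rec) with Finₚ.any? (λ y → (y Sub.∈? C) ×-dec (level y ℕ.<? level x))
        ... | yes (y , y∈C , lt)  = minimal y y∈C (rec lt)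
        ... | no  none            = x , x∈C , λ y y∈C → ℕₚ.≮⇒≥ (λ lt → none (y , y∈C , lt))
        least = minimal (proj₁ start) (proj₂ start) (<-wellFounded _)
        t = proj₁ least
        t∈C = proj₁ (proj₂ least)
        other : ∃ λ t′ → t′ ∈ C × t ≢ t′ × level t ≡ level t′
        other = decidable-stable (Finₚ.any? (λ y → (y Sub.∈? C) ×-dec (¬? (t Fin.≟ y) ×-dec (level t ℕ.≟ level y)))) λ none →
          level-¬Cl {t} ℕₚ.≤-refl (Cl-trans (λ {y} y∈ → level-Cl (ℕₚ.≤∧≢⇒< (proj₂ (proj₂ least) y (∖⊆ C t y∈))
            (λ eq → none (y , ∖⊆ C t y∈ , ∈∖⁻ C t y∈ ∘ ≡.sym , eq)))) (circuit-Cl circ t∈C))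
        t′ = proj₁ other
        t′∈C = proj₁ (proj₂ other)
        t≢t′ = proj₁ (proj₂ (proj₂ other))
        eq = proj₂ (proj₂ (proj₂ other))

      level-∈ : NBC S → ∀ {s} → s ∈ S → level s ≡ pos s
      level-∈ nbc {s} s∈S with pos s in eq
      ... | zero = contradiction eq (pos≢0 s)
      ... | suc p = level-unique (∈⇒Cl (∈above⁺ s∈S (ℕₚ.≤-reflexive (≡.sym eq))))
                      (≡.subst (λ q → ¬ Cl (above q S) s) eq (NBC⇒¬Cl nbc s))

      -- An element `t` of this level enters the closure only together with `s`. By exchange `s` is
      -- then in the closure of `t` and the elements of `S` beyond `s`. All of these are elements of
      -- `T` beyond `s`, so `T` would contain a broken circuit.
      level-missed : NBC S → ∀ {T} → NBC T → ∀ {s} → s ∉ T → (∀ x → x ∈ S → pos s ℕ.< pos x → x ∈ T) →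
                     ∀ {t} → t ∈ T → level t ≢ pos s
      level-missed nbcS {T} nbcT {s} s∉T above⊆T {t} t∈T eq with pos s in eq-s
      ... | zero = pos≢0 s eq-s
      ... | suc p = NBC⇒¬Cl nbcT s (Cl-mono ⊆T (Cl-exchange
                      (Cl-mono ⊆▹s cl) (level-¬Cl (ℕₚ.≤-reflexive eq))))
        where
        cl : Cl (above p S) t
        cl = level-Cl (ℕₚ.≤-reflexive (≡.sym eq))
        s<t : pos s ℕ.< pos t
        s<t = ℕₚ.≰⇒> λ t≤s → case ℕₚ.m≤n⇒m<n∨m≡n t≤s of λ
          { (inj₁ t<s) → NBC⇒¬Cl nbcS t (Cl-mono (above-antitone (ℕₚ.≤-pred (≡.subst (pos t ℕ.<_) eq-s t<s))) cl)
          ; (inj₂ t≡s) → s∉T (≡.subst (_∈ T) (pos-injective t≡s) t∈T) }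
        ⊆▹s : above p S ⊆ above (suc p) S ▹ s
        ⊆▹s {x} x∈ with ∈above⁻ x∈
        ... | x∈S , p<x with ℕₚ.m≤n⇒m<n∨m≡n p<x
        ...   | inj₁ sp<x = ⊆▹ (∈above⁺ x∈S sp<x)
        ...   | inj₂ sp≡x = ≡.subst (_∈ above (suc p) S ▹ s) (pos-injective (≡.trans eq-s sp≡x)) (∈▹ (above (suc p) S) s)
        ⊆T : above (suc p) S ▹ t ⊆ above (pos s) T
        ⊆T = ▹⊆ (λ {x} x∈ → let (x∈S , q<x) = ∈above⁻ x∈ in
                  ∈above⁺ (above⊆T x x∈S q<x) (≡.subst (ℕ._< pos x) (≡.sym eq-s) q<x))
                (∈above⁺ t∈T s<t)

    -- Supplies the hypothesis of `level-missed` on the elements beyond `s`.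
    greatest-missing : ∀ {S T s} → s ∈ S → s ∉ T →
                       ∃ λ s → s ∈ S × s ∉ T × (∀ x → x ∈ S → pos s ℕ.< pos x → x ∈ T)
    greatest-missing {S} {T} {s} = go s (<-wellFounded _)
      where
      go : ∀ s → Acc ℕ._<_ (N ℕ.∸ pos s) → s ∈ S → s ∉ T → ∃ λ s → s ∈ S × s ∉ T × (∀ x → x ∈ S → pos s ℕ.< pos x → x ∈ T)
      go s (acc rec) s∈S s∉T with Finₚ.any? (λ x → (x Sub.∈? S) ×-dec (¬? (x Sub.∈? T) ×-dec (pos s ℕ.<? pos x)))
      ... | yes (x , x∈S , x∉T , lt) = go x (rec (ℕₚ.∸-monoʳ-< lt (pos≤N x))) x∈S x∉T
      ... | no none = s , s∈S , s∉T , λ x x∈S lt → decidable-stable (x Sub.∈? T) (λ x∉T → none (x , x∈S , x∉T , lt))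

-- Expansions in x = 1 + t and the signs of their lowest coefficients.

module Taylor where

  -- The coefficient of x ^ m in (x − 1) ^ p.
  w : ℕ → ℕ → ℤ
  w zero     zero     = 1ℤ
  w zero     (suc m)  = 0ℤ
  w (suc p)  zero     = ℤ.- w p zero
  w (suc p)  (suc m)  = w p m ℤ.- w p (suc m)

  taylor : ∀ {n} → List (Subset n) → ℕ → ℤ
  taylor []       m = 0ℤ
  taylor (T ∷ L)  m = w ∣ T ∣ m ℤ.+ taylor L m

  taylor-++ : ∀ {n} (L L′ : List (Subset n)) m → taylor (L ++ L′) m ≡ taylor L m ℤ.+ taylor L′ m
  taylor-++ []       L′ m = ≡.sym (ℤₚ.+-identityˡ _)
  taylor-++ (T ∷ L)  L′ m = ≡.trans (≡.cong (λ x → w ∣ T ∣ m ℤ.+ x) (taylor-++ L L′ m)) (≡.sym (ℤₚ.+-assoc (w ∣ T ∣ m) _ _))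

  shift : (ℕ → ℤ) → ℕ → ℤ
  shift g zero     = 0ℤ
  shift g (suc m)  = g m

  -- Because (x - 1) ^ p + (x - 1) ^ (p + 1) = x (x - 1) ^ p: a coloop multiplies the polynomial by
  -- x.
  taylor-coloop : ∀ {n} (i : Fin n) L → All (i ∉_) L → ∀ m →
                  taylor L m ℤ.+ taylor (List.map (_▹ i) L) m ≡ shift (taylor L) m
  taylor-coloop i []       []       zero     = ≡.refl
  taylor-coloop i []       []       (suc m)  = ≡.refl
  taylor-coloop i (T ∷ L)  (p ∷ ps) m rewrite ∣▹∣ T i p = step m (taylor-coloop i L ps m)
    where
    open Data.Integer.Solver.+-*-Solver
    step : ∀ m → taylor L m ℤ.+ taylor (List.map (_▹ i) L) m ≡ shift (taylor L) m →
           (w ∣ T ∣ m ℤ.+ taylor L m) ℤ.+ (w (suc ∣ T ∣) m ℤ.+ taylor (List.map (_▹ i) L) m) ≡ shift (taylor (T ∷ L)) m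
    step zero eq = ≡.trans
      (solve 3 (λ a b c → (a :+ b) :+ (:- a :+ c) := b :+ c) ≡.refl (w ∣ T ∣ 0) (taylor L 0) _) eq
    step (suc m) eq = ≡.trans
      (solve 4 (λ a b c d → (a :+ b) :+ ((d :- a) :+ c) := d :+ (b :+ c)) ≡.refl (w ∣ T ∣ (suc m)) (taylor L (suc m)) _ (w ∣ T ∣ m))
      (≡.cong (λ x → w ∣ T ∣ m ℤ.+ x) eq)

  sg : ℕ → ℤ → ℤ
  sg zero     z = z
  sg (suc k)  z = ℤ.- sg k z

  sg-+ : ∀ k a b → sg k (a ℤ.+ b) ≡ sg k a ℤ.+ sg k b
  sg-+ zero     a b = ≡.refl
  sg-+ (suc k)  a b = ≡.trans (≡.cong ℤ.-_ (sg-+ k a b)) (ℤₚ.neg-distrib-+ (sg k a) (sg k b))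

  sg-0 : ∀ k → sg k 0ℤ ≡ 0ℤ
  sg-0 zero     = ≡.refl
  sg-0 (suc k)  = ≡.cong ℤ.-_ (sg-0 k)

  sg-neg : ∀ k a → sg k (ℤ.- a) ≡ ℤ.- sg k a
  sg-neg zero     a = ≡.refl
  sg-neg (suc k)  a = ≡.cong ℤ.-_ (sg-neg k a)

  sg-w : ∀ p → sg p (w p 0) ≡ 1ℤ
  sg-w zero     = ≡.refl
  sg-w (suc p)  = ≡.trans (≡.cong ℤ.-_ (sg-neg p (w p 0))) (≡.trans (ℤₚ.neg-involutive _) (sg-w p))

  -- The lowest non-zero coefficient stands at x ^ j and has the sign (-1) ^ (r + j), where `r` will
  -- be a rank. The sign originates from the leaves, whose polynomial (x - 1) ^ r has the constant
  -- term (-1) ^ r; multiplication by x raises `r` and `j` together.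
  record Lowest (r : ℕ) (g : ℕ → ℤ) (j : ℕ) : Set where
    constructor _,_
    field
      below  : ∀ i → i ℕ.< j → g i ≡ 0ℤ
      sign   : 0ℤ ℤ.< sg (r ℕ.+ j) (g j)

  Signed : ℕ → (ℕ → ℤ) → Set
  Signed r g = (∀ i → g i ≡ 0ℤ) ⊎ ∃ (Lowest r g)

  Lowest-cong : ∀ {r g h j} → (∀ i → g i ≡ h i) → Lowest r g j → Lowest r h j
  Lowest-cong {r} {j = j} eq (z , p) = (λ i lt → ≡.trans (≡.sym (eq i)) (z i lt)) ,
    ≡.subst (λ x → 0ℤ ℤ.< sg (r ℕ.+ j) x) (eq j) p

  Signed-cong : ∀ {r g h} → (∀ i → g i ≡ h i) → Signed r g → Signed r h
  Signed-cong eq (inj₁ z)        = inj₁ (λ i → ≡.trans (≡.sym (eq i)) (z i))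
  Signed-cong eq (inj₂ (j , p))  = inj₂ (j , Lowest-cong eq p)

  -- Lowest terms at the same exponent have the same sign and cannot cancel, so adding `h` never
  -- raises the order of vanishing.
  Lowest-+ : ∀ {r g h j} → Lowest r g j → Signed r h → ∃ λ j′ → j′ ℕ.≤ j × Lowest r (λ i → g i ℤ.+ h i) j′
  Lowest-+ {g = g} {j = j} p (inj₁ z) = j , ℕₚ.≤-refl ,
    Lowest-cong (λ i → ≡.sym (≡.trans (≡.cong (λ x → g i ℤ.+ x) (z i)) (ℤₚ.+-identityʳ (g i)))) p
  Lowest-+ {r} {g} {h} {j} (z , p) (inj₂ (j′ , z′ , p′)) with ℕₚ.<-cmp j j′
  ... | tri< lt _ _ = j , ℕₚ.≤-refl ,
        (λ i i< → ≡.cong₂ ℤ._+_ (z i i<) (z′ i (ℕₚ.<-trans i< lt))) ,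
        ≡.subst (λ x → 0ℤ ℤ.< sg (r ℕ.+ j) x) (≡.sym (≡.trans (≡.cong (λ x → g j ℤ.+ x) (z′ j lt)) (ℤₚ.+-identityʳ _))) p
  ... | tri> _ _ gt = j′ , ℕₚ.<⇒≤ gt ,
        (λ i i< → ≡.cong₂ ℤ._+_ (z i (ℕₚ.<-trans i< gt)) (z′ i i<)) ,
        ≡.subst (λ x → 0ℤ ℤ.< sg (r ℕ.+ j′) x) (≡.sym (≡.trans (≡.cong (ℤ._+ h j′) (z j′ gt)) (ℤₚ.+-identityˡ _))) p′
  ... | tri≈ _ ≡.refl _ = j , ℕₚ.≤-refl ,
        (λ i i< → ≡.cong₂ ℤ._+_ (z i i<) (z′ i i<)) ,
        ≡.subst (0ℤ ℤ.<_) (≡.sym (sg-+ (r ℕ.+ j) (g j) (h j))) (ℤₚ.+-mono-< p p′)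

  Signed-+ : ∀ {r g h} → Signed r g → Signed r h → Signed r (λ i → g i ℤ.+ h i)
  Signed-+ {h = h} (inj₁ z) q = Signed-cong (λ i → ≡.sym (≡.trans (≡.cong (ℤ._+ h i) (z i)) (ℤₚ.+-identityˡ _))) q
  Signed-+ (inj₂ (j , p)) q = let (j′ , _ , p′) = Lowest-+ p q in inj₂ (j′ , p′)

  Lowest-shift : ∀ {r g j} → Lowest r g j → Lowest (suc r) (shift g) (suc j)
  Lowest-shift {r} {g} {j} (z , p) = z′ , ≡.subst (0ℤ ℤ.<_) (≡.sym eq) p
    where
    z′ : ∀ i → i ℕ.< suc j → shift g i ≡ 0ℤ
    z′ zero     lt        = ≡.refl
    z′ (suc i)  (s≤s lt)  = z i lt
    eq : sg (suc r ℕ.+ suc j) (g j) ≡ sg (r ℕ.+ j) (g j)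
    eq = ≡.trans (≡.cong (λ k → sg (suc k) (g j)) (ℕₚ.+-suc r j)) (ℤₚ.neg-involutive _)

  Signed-shift : ∀ {r g} → Signed r g → Signed (suc r) (shift g)
  Signed-shift (inj₁ z)        = inj₁ λ { zero → ≡.refl ; (suc i) → z i }
  Signed-shift (inj₂ (j , p))  = inj₂ (suc j , Lowest-shift p)

-- The deletion-contraction tree.

module DecisionTree {n : ℕ} (M : Matroid n) where
  open Matroid M using (indep; hereditary)
  open MatroidTheory M
  open Taylor

  -- `C` holds the accepted elements; the first branch deletes `i` and the second contracts it. If
  -- `C` is independent but `C ▹ i` is not, then `i` is a loop of the current minor. When the list
  -- runs from large to small, `i` completes a broken circuit inside `C`, and both branches are
  -- discarded.
  tree : Subset n → List (Fin n) → List (Subset n)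
  tree C []       = [ C ]
  tree C (i ∷ l)  = if indep (C ▹ i) then tree C l ++ tree (C ▹ i) l else []

  tree-yes : ∀ {C i} l → Ind (C ▹ i) → tree C (i ∷ l) ≡ tree C l ++ tree (C ▹ i) l
  tree-yes l ind rewrite ind = ≡.refl

  tree-no : ∀ {C i} l → ¬ Ind (C ▹ i) → tree C (i ∷ l) ≡ []
  tree-no l dep rewrite ¬Ind⇒Dependent dep = ≡.refl

  -- The accepted and the undecided elements. The rank of this set is that of the current minor plus
  -- that of `C`, which makes the ranks of the two branches comparable.
  ground : Subset n → List (Fin n) → Subset n
  ground C []       = C
  ground C (i ∷ l)  = ground C l ▹ i

  ground-▹ : ∀ C i l → ground (C ▹ i) l ≡ ground C l ▹ i
  ground-▹ C i []       = ≡.refl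
  ground-▹ C i (j ∷ l)  = ≡.trans (≡.cong (_▹ j) (ground-▹ C i l)) (▹-comm (ground C l) i j)

  ground-⊇ : ∀ C l → C ⊆ ground C l
  ground-⊇ C []       = id
  ground-⊇ C (i ∷ l)  = ⊆▹ ∘ ground-⊇ C l

  ∈ₗ⇒∈ground : ∀ C {l x} → x ∈ₗ l → x ∈ ground C l
  ∈ₗ⇒∈ground C {i ∷ l} (here ≡.refl)  = ∈▹ (ground C l) i
  ∈ₗ⇒∈ground C {i ∷ l} (there x∈)     = ⊆▹ (∈ₗ⇒∈ground C x∈)

  ∈ground⁻ : ∀ C l {x} → x ∈ ground C l → x ∈ C ⊎ x ∈ₗ l
  ∈ground⁻ C []       x∈ = inj₁ x∈
  ∈ground⁻ C (i ∷ l)  x∈ with ∈▹⁻ (ground C l) i x∈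
  ... | inj₂ x≡i = inj₂ (here x≡i)
  ... | inj₁ x∈′ with ∈ground⁻ C l x∈′
  ...   | inj₁ x∈C  = inj₁ x∈C
  ...   | inj₂ x∈l  = inj₂ (there x∈l)

  Fresh : Subset n → List (Fin n) → Set
  Fresh C l = Unique l × (∀ {x} → x ∈ₗ l → x ∉ C)

  Fresh-tail : ∀ {C i l} → Fresh C (i ∷ l) → Fresh C l
  Fresh-tail (_ ∷ u , f) = u , f ∘ there

  Fresh-head : ∀ {C i l} → Fresh C (i ∷ l) → i ∉ ground C l
  Fresh-head {C} {i} {l} (i∉l ∷ u , f) i∈ with ∈ground⁻ C l i∈
  ... | inj₁ i∈C  = f (here ≡.refl) i∈C
  ... | inj₂ i∈l  = All.lookup i∉l i∈l ≡.refl

  Fresh-▹ : ∀ {C i l} → Fresh C (i ∷ l) → Fresh (C ▹ i) l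
  Fresh-▹ {C} {i} {l} fr@(i∉l ∷ u , f) = u , λ x∈l x∈ → case ∈▹⁻ C i x∈ of λ
    { (inj₁ x∈C) → f (there x∈l) x∈C ; (inj₂ ≡.refl) → All.lookup i∉l x∈l ≡.refl }

  tree-bounds : ∀ {C} l {T} → T ∈ₗ tree C l → C ⊆ T × T ⊆ ground C l
  tree-bounds []       (here ≡.refl) = id , id
  tree-bounds {C} (i ∷ l) T∈ with indep (C ▹ i)
  ... | true with ∈ₗₚ.∈-++⁻ (tree C l) T∈
  ...   | inj₁ T∈′ = let (C⊆T , T⊆) = tree-bounds l T∈′ in C⊆T , ⊆▹ ∘ T⊆
  ...   | inj₂ T∈′ = let (C⊆T , T⊆) = tree-bounds l T∈′ in C⊆T ∘ ⊆▹ , ≡.subst (_ ∈_) (ground-▹ C i l) ∘ T⊆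

  -- A coloop never affects an independence test further down, so contracting it gives the tree of
  -- the deletion with `i` added to every leaf.
  tree-coloop : ∀ {C i} l → ¬ Cl (ground C l) i → tree (C ▹ i) l ≡ List.map (_▹ i) (tree C l)
  tree-coloop []       ¬cl = ≡.refl
  tree-coloop {C} {i} (j ∷ l) ¬cl with Ind? (C ▹ j)
  ... | no dep = ≡.trans (tree-no l (dep ∘ hereditary (▹-mono ⊆▹))) (≡.sym (≡.cong (List.map (_▹ i)) (tree-no l dep)))
  ... | yes ind = begin
      tree (C ▹ i) (j ∷ l)
        ≡⟨ tree-yes l (≡.subst Ind (▹-comm C j i) (Ind-▹ ind (¬cl ∘ Cl-mono (▹-mono (ground-⊇ C l))))) ⟩
      tree (C ▹ i) l ++ tree (C ▹ i ▹ j) l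
        ≡⟨ ≡.cong (λ X → tree (C ▹ i) l ++ tree X l) (▹-comm C i j) ⟩
      tree (C ▹ i) l ++ tree (C ▹ j ▹ i) l
        ≡⟨ ≡.cong₂ _++_ (tree-coloop l (¬cl ∘ Cl-mono ⊆▹))
             (tree-coloop l (¬cl ∘ ≡.subst (λ X → Cl X i) (ground-▹ C j l))) ⟩
      List.map (_▹ i) (tree C l) ++ List.map (_▹ i) (tree (C ▹ j) l)
        ≡⟨ Listₚ.map-++ (_▹ i) (tree C l) _ ⟨
      List.map (_▹ i) (tree C l ++ tree (C ▹ j) l)
        ≡⟨ ≡.cong (List.map (_▹ i)) (tree-yes l ind) ⟨
      List.map (_▹ i) (tree C (j ∷ l)) ∎
    where open ≡.≡-Reasoning

  taylor-yes : ∀ {C i} l → Ind (C ▹ i) → ∀ m → taylor (tree C l) m ℤ.+ taylor (tree (C ▹ i) l) m ≡ taylor (tree C (i ∷ l)) m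
  taylor-yes {C} l ind m rewrite ind = ≡.sym (taylor-++ (tree C l) _ m)

  taylor-tree-coloop : ∀ {C i} l → Ind (C ▹ i) → ¬ Cl (ground C l) i → ∀ m →
                       shift (taylor (tree C l)) m ≡ taylor (tree C (i ∷ l)) m
  taylor-tree-coloop {C} {i} l ind ¬cl m = ≡.trans (≡.sym (taylor-coloop i (tree C l)
      (All.tabulate λ T∈ i∈T → ¬cl (∈⇒Cl (proj₂ (tree-bounds l T∈) i∈T))) m))
    (≡.trans (≡.cong (λ L → taylor (tree C l) m ℤ.+ taylor L m) (≡.sym (tree-coloop l ¬cl))) (taylor-yes l ind m))

  Lowest-leaf : ∀ {C} → Ind C → Lowest (r C) (taylor [ C ]) 0
  Lowest-leaf {C} ind = (λ i ()) , ≡.subst (ℤ.0ℤ ℤ.<_) (≡.sym eq) (ℤ.+<+ (s≤s z≤n))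
    where
    eq : sg (r C ℕ.+ 0) (taylor [ C ] 0) ≡ 1ℤ
    eq = ≡.trans (≡.cong₂ sg (≡.trans (ℕₚ.+-identityʳ _) (Ind⇒r≡∣∣ ind)) (ℤₚ.+-identityʳ (w ∣ C ∣ 0))) (sg-w ∣ C ∣)

  -- A loop gives the zero polynomial. If `i` is neither a loop nor a coloop, both branches have the
  -- same rank and hence compatible signs; a coloop gives a factor x and raises the rank by one.
  tree-Signed : ∀ {C} l → Ind C → Fresh C l → Signed (r (ground C l)) (taylor (tree C l))
  tree-Signed []       ind fr = inj₂ (0 , Lowest-leaf ind)
  tree-Signed {C} (i ∷ l) ind fr with Ind? (C ▹ i)
  ... | no dep = inj₁ λ m → ≡.cong (λ L → taylor L m) (tree-no l dep)
  ... | yes ind′ with Cl? (ground C l) i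
  ...   | yes cl = Signed-cong (taylor-yes l ind′)
            (Signed-+ (≡.subst (λ k → Signed k (taylor (tree C l))) (≡.sym cl) (tree-Signed l ind (Fresh-tail fr)))
                      (≡.subst (λ X → Signed (r X) (taylor (tree (C ▹ i) l))) (ground-▹ C i l) (tree-Signed l ind′ (Fresh-▹ fr))))
  ...   | no ¬cl = Signed-cong (taylor-tree-coloop l ind′ ¬cl)
            (≡.subst (λ k → Signed k (shift (taylor (tree C l)))) (≡.sym (¬Cl⇒r▹ ¬cl)) (Signed-shift (tree-Signed l ind (Fresh-tail fr))))

  tree-unique : ∀ {C} l → Fresh C l → Unique (tree C l)
  tree-unique []       fr = [] ∷ []
  tree-unique {C} (i ∷ l) fr with indep (C ▹ i)
  ... | false  = []
  ... | true   = Uniqueₚ.++⁺ (tree-unique l (Fresh-tail fr)) (tree-unique l (Fresh-▹ fr))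
    λ (T∈ , T∈′) → Fresh-head fr (proj₂ (tree-bounds l T∈) (proj₁ (tree-bounds l T∈′) (∈▹ C i)))

unique-lookup-injective : ∀ {a} {X : Set a} {xs : List X} → Unique xs → ∀ i j → List.lookup xs i ≡ List.lookup xs j → i ≡ j
unique-lookup-injective (x∉ ∷ u) zero     zero     eq = ≡.refl
unique-lookup-injective (x∉ ∷ u) zero     (suc j)  eq = contradiction eq (All.lookup x∉ (∈ₗₚ.∈-lookup j))
unique-lookup-injective (x∉ ∷ u) (suc i)  zero     eq = contradiction (≡.sym eq) (All.lookup x∉ (∈ₗₚ.∈-lookup i))
unique-lookup-injective (x∉ ∷ u) (suc i)  (suc j)  eq = ≡.cong suc (unique-lookup-injective u i j eq)

-- The leaves of the tree are the sets without broken circuits.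

module BrokenCircuitTree {n : ℕ} (M : Matroid n) (pos : Fin n → ℕ) (pos-injective : ∀ {x y} → pos x ≡ pos y → x ≡ y)
                         (pos≢0 : ∀ x → pos x ≢ 0) (N : ℕ) (pos≤N : ∀ x → pos x ℕ.≤ N) where
  open MatroidTheory M
  open Ordered pos pos-injective pos≢0 N pos≤N
  open DecisionTree M

  -- The head has the greatest position, so elements are decided from the largest down and
  -- `above (length l) S` is the part of `S` already decided.
  Ranked : List (Fin n) → Set
  Ranked []       = Unit
  Ranked (i ∷ l)  = pos i ≡ suc (length l) × Ranked l

  private
    above-∈ : ∀ {S i m} → pos i ≡ suc m → i ∈ S → above m S ≡ above (suc m) S ▹ i
    above-∈ {S} {i} {m} eq i∈S = Sub.⊆-antisym
      (λ {x} x∈ → let (x∈S , lt) = ∈above⁻ x∈ in case ℕₚ.m≤n⇒m<n∨m≡n lt of λ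
        { (inj₁ lt′) → ⊆▹ (∈above⁺ x∈S lt′)
        ; (inj₂ eq′) → ≡.subst (_∈ above (suc m) S ▹ i) (pos-injective (≡.trans eq eq′)) (∈▹ (above (suc m) S) i) })
      (▹⊆ (above-antitone (ℕₚ.n≤1+n m)) (∈above⁺ i∈S (ℕₚ.≤-reflexive (≡.sym eq))))

    above-∉ : ∀ {S i m} → pos i ≡ suc m → i ∉ S → above m S ≡ above (suc m) S
    above-∉ {S} {i} {m} eq i∉S = Sub.⊆-antisym
      (λ {x} x∈ → let (x∈S , lt) = ∈above⁻ x∈ in case ℕₚ.m≤n⇒m<n∨m≡n lt of λ
        { (inj₁ lt′) → ∈above⁺ x∈S lt′
        ; (inj₂ eq′) → contradiction (≡.subst (_∈ S) (pos-injective (≡.sym (≡.trans eq eq′))) x∈S) i∉S })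
      (above-antitone (ℕₚ.n≤1+n m))

    above-0 : ∀ S → above 0 S ≡ S
    above-0 S = Sub.⊆-antisym above⊆ (λ {x} x∈S → ∈above⁺ x∈S (ℕₚ.n≢0⇒n>0 (pos≢0 x)))

  -- The invariant is that `C` is the decided part of `S`; the test at `i` is then exactly the
  -- condition of `NBC` at `i`.
  NBC⇒∈tree : ∀ {S} → NBC S → ∀ {C} l → Ranked l → above (length l) S ≡ C → S ∈ₗ tree C l
  NBC⇒∈tree {S} nbc [] rk eq = here (≡.trans (≡.sym (above-0 S)) eq)
  NBC⇒∈tree {S} nbc {C} (i ∷ l) (eq-i , rk) eq =
    ≡.subst (S ∈ₗ_) (≡.sym (tree-yes l (≡.subst (λ X → Ind (X ▹ i)) (≡.trans (≡.cong (λ p → above p S) eq-i) eq) (nbc i))))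
      (case i Sub.∈? S of λ
        { (yes i∈S) → ∈ₗₚ.∈-++⁺ʳ (tree C l) (NBC⇒∈tree nbc l rk (≡.trans (above-∈ eq-i i∈S) (≡.cong (_▹ i) eq)))
        ; (no i∉S) → ∈ₗₚ.∈-++⁺ˡ (NBC⇒∈tree nbc l rk (≡.trans (above-∉ eq-i i∉S) eq)) })

  ∈tree⇒NBC : ∀ {S C} l → Ranked l → (∀ {x} → x ∈ C → length l ℕ.< pos x) → S ∈ₗ tree C l →
              above (length l) S ≡ C × (∀ {x} → x ∈ₗ l → Ind (above (pos x) S ▹ x))
  ∈tree⇒NBC [] rk C> (here ≡.refl) = above-0 _ , λ ()
  ∈tree⇒NBC {S} {C} (i ∷ l) (eq-i , rk) C> S∈ with Ind? (C ▹ i)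
  ... | no dep = contradiction (≡.subst (S ∈ₗ_) (tree-no l dep) S∈) λ ()
  ... | yes ind = eq , nbc
    where
    branch : above (suc (length l)) S ≡ C × (∀ {x} → x ∈ₗ l → Ind (above (pos x) S ▹ x))
    branch with ∈ₗₚ.∈-++⁻ (tree C l) (≡.subst (S ∈ₗ_) (tree-yes l ind) S∈)
    ... | inj₁ S∈′ = let (eq , nbc) = ∈tree⇒NBC l rk (λ x∈C → ℕₚ.<-trans ℕₚ.≤-refl (C> x∈C)) S∈′ in
          Sub.⊆-antisym
            (≡.subst (_ ∈_) eq ∘ above-antitone (ℕₚ.n≤1+n _))
            (λ {x} x∈C → ∈above⁺ (above⊆ (≡.subst (x ∈_) (≡.sym eq) x∈C)) (C> x∈C)) , nbc
    ... | inj₂ S∈′ = let (eq , nbc) = ∈tree⇒NBC l rk C▹i> S∈′ in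
          Sub.⊆-antisym
            (λ {x} x∈ → case ∈▹⁻ C i (≡.subst (x ∈_) eq (above-antitone (ℕₚ.n≤1+n _) x∈)) of λ
              { (inj₁ x∈C) → x∈C
              ; (inj₂ ≡.refl) → contradiction (proj₂ (∈above⁻ x∈)) (ℕₚ.<-irrefl (≡.sym eq-i)) })
            (λ {x} x∈C → ∈above⁺ (above⊆ (≡.subst (x ∈_) (≡.sym eq) (⊆▹ x∈C))) (C> x∈C)) , nbc
      where
      C▹i> : ∀ {x} → x ∈ C ▹ i → length l ℕ.< pos x
      C▹i> x∈ with ∈▹⁻ C i x∈
      ... | inj₁ x∈C = ℕₚ.<-trans ℕₚ.≤-refl (C> x∈C)
      ... | inj₂ ≡.refl = ℕₚ.≤-reflexive (≡.sym eq-i)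
    eq = proj₁ branch
    nbc : ∀ {x} → x ∈ₗ (i ∷ l) → Ind (above (pos x) S ▹ x)
    nbc (here ≡.refl) = ≡.subst (λ X → Ind (X ▹ i)) (≡.sym (≡.trans (≡.cong (λ p → above p S) eq-i) eq)) ind
    nbc (there x∈l)   = proj₂ branch x∈l

-- An order adapted to a basis, and the order of vanishing at t = -1.

module Growth {n : ℕ} (M : Matroid n) (loopless : Loopless M) {k : ℕ} (components : HasComponents M k) where
  open Matroid M using (hereditary)
  open MatroidTheory M
  open DecisionTree M
  open Taylor

  component : Fin n → Fin k
  component = proj₁ components

  circuit⇒component : ∀ {C x y} → Circuit M C → x ∈ C → y ∈ C → component x ≡ component y
  circuit⇒component {x = x} {y} circ x∈C y∈C = proj₂ (proj₂ (proj₂ components) x y) (inj₂ (_ , circ , x∈C , y∈C))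

  B : Subset n
  B = proj₁ (basis ⊤)

  B-basis : BasisOf ⊤ B
  B-basis = proj₂ (basis ⊤)

  B-ind : Ind B
  B-ind = proj₁ (proj₂ B-basis)

  ∣B∣≥r : ∀ {X} → r X ℕ.≤ ∣ B ∣
  ∣B∣≥r = ℕₚ.≤-trans (r-mono {Y = ⊤} (λ _ → Sub.∈⊤)) (ℕₚ.≤-reflexive (≡.sym (∣basis∣≡r B-basis)))

  -- An element outside `B` is not a loop, so its fundamental circuit contains an element of `B`,
  -- which lies in the same component.
  root-exists : ∀ c → ∃ λ ρ → ρ ∈ B × component ρ ≡ c
  root-exists c with proj₁ (proj₂ components) c
  ... | x , fx≡c with x Sub.∈? B
  ...   | yes x∈B = x , x∈B , fx≡c
  ...   | no  x∉B = proj₁ other , proj₁ (proj₂ other) , ≡.trans (circuit⇒component circ (proj₂ (proj₂ other)) x∈C) fx≡c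
    where
    fundamental = circuit-in (B ▹ x) (proj₂ (proj₂ B-basis) x Sub.∈⊤ x∉B)
    C = proj₁ fundamental
    circ = proj₁ (proj₂ fundamental)
    C⊆ : C ⊆ B ▹ x
    C⊆ = proj₂ (proj₂ fundamental)
    C-dep = Dependent⇒¬Ind (proj₁ circ)
    x∈C : x ∈ C
    x∈C = decidable-stable (x Sub.∈? C) λ x∉C → C-dep (hereditary
      (λ {y} y∈C → [ id , (λ { ≡.refl → contradiction y∈C x∉C }) ]′ (∈▹⁻ B x (C⊆ y∈C))) B-ind)
    other : ∃ λ y → y ∈ B × y ∈ C
    other = decidable-stable (Finₚ.any? (λ y → (y Sub.∈? B) ×-dec (y Sub.∈? C))) λ none →
      loopless x (¬Ind⇒Dependent λ ind → C-dep (hereditary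
        (λ {y} y∈C → [ (λ y∈B → contradiction (y , y∈B , y∈C) none) , (λ { ≡.refl → Sub.x∈⁅x⁆ x }) ]′ (∈▹⁻ B x (C⊆ y∈C))) ind))

  root : Fin k → Fin n
  root c = proj₁ (root-exists c)

  component-root : ∀ c → component (root c) ≡ c
  component-root c = proj₂ (proj₂ (root-exists c))

  roots : List (Fin n)
  roots = List.map root (allFin k)

  roots-unique : Unique roots
  roots-unique = Uniqueₚ.map⁺ (λ {c} {c′} eq → ≡.trans (≡.sym (component-root c))
    (≡.trans (≡.cong component eq) (component-root c′))) (Uniqueₚ.allFin⁺ k)

  roots⊆B : ∀ {x} → x ∈ₗ roots → x ∈ B
  roots⊆B x∈ = let (c , _ , eq) = ∈ₗₚ.∈-map⁻ root x∈ in ≡.subst (_∈ B) (≡.sym eq) (proj₁ (proj₂ (root-exists c)))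

  -- i is adjacent to an element of l in the fundamental graph of the basis B.
  Linked : Fin n → List (Fin n) → Set
  Linked i l = (i ∈ B × (∃ λ e → e ∈ₗ l × e ∉ B × Ind ((B ∖ i) ▹ e))) ⊎
               (i ∉ B × (∃ λ b → b ∈ₗ l × b ∈ B × Ind ((B ∖ b) ▹ i)))

  open import Data.List.Membership.DecPropositional (Fin._≟_ {n}) using () renaming (_∈?_ to _∈ₗ?_)

  Linked? : ∀ i l → Dec (Linked i l)
  Linked? i l =
    ((i Sub.∈? B) ×-dec Finₚ.any? (λ e → (e ∈ₗ? l) ×-dec (¬? (e Sub.∈? B) ×-dec Ind? ((B ∖ i) ▹ e)))) ⊎-dec
    (¬? (i Sub.∈? B) ×-dec Finₚ.any? (λ b → (b ∈ₗ? l) ×-dec ((b Sub.∈? B) ×-dec Ind? ((B ∖ b) ▹ i))))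

  -- Lists grow at the head, where the greatest position is, so the roots are the smallest elements
  -- and every link points to a smaller one.
  data Grown : List (Fin n) → Set where
    base : Grown roots
    step : ∀ {i l} → i ∉ₗ l → Linked i l → Grown l → Grown (i ∷ l)

  private
    -- Extending `(B ∩ X) ▹ e` to a basis of `B ▹ e` leaves out exactly one element `b` of `B`, and
    -- `b` is outside `X`. So an element not spanned by `B ∩ X` has a neighbour outside `X` in the
    -- fundamental graph.
    exchangeable : ∀ X e → e ∉ B → ¬ Cl (B ∩ X) e → ∃ λ b → b ∈ B × b ∉ X × Ind ((B ∖ b) ▹ e)
    exchangeable X e e∉B ¬cl = b , b∈B , b∉X , hereditary B∖b▹e⊆J J-ind
      where
      ext = extend (B ▹ e) (▹-mono (Sub.p∩q⊆p B X)) (Ind-▹ (hereditary (Sub.p∩q⊆p B X) B-ind) ¬cl)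
      J = proj₁ ext
      J-basis : BasisOf (B ▹ e) J
      J-basis = proj₂ (proj₂ ext)
      J-ind = proj₁ (proj₂ J-basis)
      ⊆J : (B ∩ X) ▹ e ⊆ J
      ⊆J = proj₁ (proj₂ ext)
      missing : ∃ λ b → b ∈ B × b ∉ J
      missing = decidable-stable (Finₚ.any? (λ b → (b Sub.∈? B) ×-dec ¬? (b Sub.∈? J))) λ none →
        ℕₚ.<⇒≱ (ℕₚ.≤-reflexive (≡.sym (∣▹∣ B e e∉B)))
          (ℕₚ.≤-trans (Sub.p⊆q⇒∣p∣≤∣q∣ {p = B ▹ e} {J} (▹⊆ (λ {b} b∈B → decidable-stable (b Sub.∈? J) (λ b∉J → none (b , b∈B , b∉J)))
                                                    (⊆J (∈▹ (B ∩ X) e))))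
            (ℕₚ.≤-trans (Ind⇒∣∣≤r J-ind id) ∣B∣≥r))
      b = proj₁ missing
      b∈B = proj₁ (proj₂ missing)
      b∉J = proj₂ (proj₂ missing)
      b∉X : b ∉ X
      b∉X b∈X = b∉J (⊆J (⊆▹ (Sub.x∈p∩q⁺ (b∈B , b∈X))))
      J⊆ : J ⊆ (B ∖ b) ▹ e
      J⊆ {x} x∈J = case ∈▹⁻ B e (proj₁ J-basis x∈J) of λ
        { (inj₂ x≡e) → ≡.subst (_∈ (B ∖ b) ▹ e) (≡.sym x≡e) (∈▹ (B ∖ b) e)
        ; (inj₁ x∈B) → ⊆▹ (Sub.x∈p∧x≢y⇒x∈p-y x∈B (λ x≡b → b∉J (≡.subst (_∈ J) x≡b x∈J))) }
      B∖b▹e⊆J : (B ∖ b) ▹ e ⊆ J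
      B∖b▹e⊆J = Sub.⊆-reflexive (≡.sym (⊆∧∣∣≤⇒≡ J⊆ (begin
        ∣ (B ∖ b) ▹ e ∣   ≡⟨ ∣▹∣ (B ∖ b) e (e∉B ∘ ∖⊆ B b) ⟩
        suc ∣ B ∖ b ∣     ≡⟨ ∣∖∣ b∈B ⟩
        ∣ B ∣             ≡⟨ Ind⇒r≡∣∣ B-ind ⟨
        r B               ≤⟨ r-mono {Y = B ▹ e} ⊆▹ ⟩
        r (B ▹ e)         ≡⟨ ∣basis∣≡r J-basis ⟨
        ∣ J ∣             ∎)))
        where open ℕₚ.≤-Reasoning

    ∣∪∣≤ : ∀ {m} (P Q : Subset m) → ∣ P ∪ Q ∣ ℕ.≤ ∣ P ∣ ℕ.+ ∣ Q ∣
    ∣∪∣≤ []             []             = z≤n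
    ∣∪∣≤ (inside  ∷ P)  (inside  ∷ Q)  = s≤s (ℕₚ.≤-trans (∣∪∣≤ P Q) (ℕₚ.+-monoʳ-≤ ∣ P ∣ (ℕₚ.n≤1+n _)))
    ∣∪∣≤ (inside  ∷ P)  (outside ∷ Q)  = s≤s (∣∪∣≤ P Q)
    ∣∪∣≤ (outside ∷ P)  (inside  ∷ Q)  = ℕₚ.≤-trans (s≤s (∣∪∣≤ P Q)) (ℕₚ.≤-reflexive (≡.sym (ℕₚ.+-suc ∣ P ∣ ∣ Q ∣)))
    ∣∪∣≤ (outside ∷ P)  (outside ∷ Q)  = ∣∪∣≤ P Q

    ∣∩∣+∣∩∁∣ : ∀ {m} (P Q : Subset m) → ∣ P ∩ Q ∣ ℕ.+ ∣ P ∩ ∁ Q ∣ ≡ ∣ P ∣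
    ∣∩∣+∣∩∁∣ []             []             = ≡.refl
    ∣∩∣+∣∩∁∣ (inside  ∷ P)  (inside  ∷ Q)  = ≡.cong suc (∣∩∣+∣∩∁∣ P Q)
    ∣∩∣+∣∩∁∣ (inside  ∷ P)  (outside ∷ Q)  = ≡.trans (ℕₚ.+-suc _ _) (≡.cong suc (∣∩∣+∣∩∁∣ P Q))
    ∣∩∣+∣∩∁∣ (outside ∷ P)  (b ∷ Q)        = ∣∩∣+∣∩∁∣ P Q

    Cl-∩⇒basis : ∀ X → (∀ {e} → e ∈ X → Cl (B ∩ X) e) → BasisOf X (B ∩ X)
    Cl-∩⇒basis X cl = Sub.p∩q⊆q B X , hereditary (Sub.p∩q⊆p B X) B-ind ,
      λ e e∈X e∉ ind → Ind⇒¬Cl ind e∉ (cl e∈X)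

    module Separated (X : Subset n) (clX : ∀ {e} → e ∈ X → Cl (B ∩ X) e)
                     (cl∁X : ∀ {e} → e ∈ ∁ X → Cl (B ∩ ∁ X) e) where
      Y : Subset n
      Y = ∁ X

      -- The parts of a crossing circuit in `X` and in `Y` are proper, hence independent, and extend
      -- to bases of `X` and `Y`. The union of these spans and has at most `∣ B ∣` elements, so it
      -- is independent although it contains the circuit.
      not-crossing : ∀ {C x y} → Circuit M C → x ∈ C → y ∈ C → x ∈ X → y ∈ Y → ⊥
      not-crossing {C} {x} {y} (dep , min) x∈C y∈C x∈X y∈Y = Dependent⇒¬Ind dep (hereditary C⊆ (∣∣≤r⇒Ind (begin
        ∣ J ∪ J′ ∣                    ≤⟨ ∣∪∣≤ J J′ ⟩
        ∣ J ∣ ℕ.+ ∣ J′ ∣              ≡⟨ ≡.cong₂ ℕ._+_ (≡.trans (∣basis∣≡r J-basis) (≡.sym (∣basis∣≡r (Cl-∩⇒basis X clX))))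
                                                       (≡.trans (∣basis∣≡r J′-basis) (≡.sym (∣basis∣≡r (Cl-∩⇒basis Y cl∁X)))) ⟩
        ∣ B ∩ X ∣ ℕ.+ ∣ B ∩ Y ∣       ≡⟨ ∣∩∣+∣∩∁∣ B X ⟩
        ∣ B ∣                         ≡⟨ ∣basis∣≡r B-basis ⟩
        r ⊤                           ≡⟨ ∣basis∣≡r {⊤} {proj₁ big} spanning ⟨
        ∣ proj₁ big ∣                 ≡⟨ ∣basis∣≡r (proj₂ big) ⟩
        r (J ∪ J′)                    ∎)))
        where
        open ℕₚ.≤-Reasoning
        part : ∀ P z → z ∈ C → z ∉ P → ∃ λ J → C ∩ P ⊆ J × BasisOf P J
        part P z z∈C z∉P = extend P (Sub.p∩q⊆q C P) (min (C ∩ P) (Sub.p∩q⊆p C P , z , z∈C , z∉P ∘ Sub.p∩q⊆q C P))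
        extJ = part X y y∈C (Sub.x∈∁p⇒x∉p y∈Y)
        extJ′ = part Y x x∈C (Sub.x∈p⇒x∉∁p x∈X)
        J = proj₁ extJ
        J′ = proj₁ extJ′
        J-basis : BasisOf X J
        J-basis = proj₂ (proj₂ extJ)
        J′-basis : BasisOf Y J′
        J′-basis = proj₂ (proj₂ extJ′)
        C⊆ : C ⊆ J ∪ J′
        C⊆ {z} z∈C with z Sub.∈? X
        ... | yes z∈X = Sub.p⊆p∪q J′ (proj₁ (proj₂ extJ) (Sub.x∈p∩q⁺ (z∈C , z∈X)))
        ... | no  z∉X = Sub.q⊆p∪q J J′ (proj₁ (proj₂ extJ′) (Sub.x∈p∩q⁺ (z∈C , Sub.x∉p⇒x∈∁p z∉X)))
        Cl-basis : ∀ {P I z} → BasisOf P I → z ∈ P → Cl I z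
        Cl-basis {P} {I} {z} (I⊆P , I-ind , I-max) z∈P with z Sub.∈? I
        ... | yes z∈I = ∈⇒Cl z∈I
        ... | no  z∉I = decidable-stable (Cl? I z) (λ ¬cl → I-max z z∈P z∉I (Ind-▹ I-ind ¬cl))
        all-Cl : ∀ z → Cl (J ∪ J′) z
        all-Cl z with z Sub.∈? X
        ... | yes z∈X = Cl-mono (Sub.p⊆p∪q J′) (Cl-basis J-basis z∈X)
        ... | no  z∉X = Cl-mono (Sub.q⊆p∪q J J′) (Cl-basis J′-basis (Sub.x∉p⇒x∈∁p z∉X))
        big = basis (J ∪ J′)
        spanning : BasisOf ⊤ (proj₁ big)
        spanning = (λ _ → Sub.∈⊤) , proj₁ (proj₂ (proj₂ big)) , λ z _ z∉ ind → Ind▹⇒¬Cl (proj₂ big) z∉ ind (all-Cl z)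

  -- If nothing outside `l` were linked to `l`, then `B ∩ X` and `B ∩ ∁ X` would span `X` and its
  -- complement, and no circuit could join `x` to `ρ`.
  linked-exists : ∀ l {x ρ} → ρ ∈ₗ l → x ∉ₗ l → component x ≡ component ρ → ∃ λ i → i ∉ₗ l × Linked i l
  linked-exists l {x} {ρ} ρ∈l x∉l same = decidable-stable (Finₚ.any? (λ i → ¬? (i ∈ₗ? l) ×-dec Linked? i l)) λ none →
    let clX : ∀ {e} → e ∈ X → Cl (B ∩ X) e
        clX {e} e∈X = decidable-stable (Cl? (B ∩ X) e) λ ¬cl →
          let e∉B = λ e∈B → ¬cl (∈⇒Cl (Sub.x∈p∩q⁺ (e∈B , e∈X)))
              (b , b∈B , b∉X , ind) = exchangeable X e e∉B ¬cl
          in none (b , b∉X ∘ ∈ₗ⇒∈ground ∅ , inj₁ (b∈B , e , X⊆l e∈X , e∉B , ind))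
        cl∁X : ∀ {e} → e ∈ ∁ X → Cl (B ∩ ∁ X) e
        cl∁X {e} e∈Y = decidable-stable (Cl? _ e) λ ¬cl →
          let e∉B = λ e∈B → ¬cl (∈⇒Cl (Sub.x∈p∩q⁺ (e∈B , e∈Y)))
              (b , b∈B , b∉Y , ind) = exchangeable (∁ X) e e∉B ¬cl
          in none (e , Sub.x∈∁p⇒x∉p e∈Y ∘ ∈ₗ⇒∈ground ∅ , inj₂ (e∉B , b , X⊆l (Sub.x∉∁p⇒x∈p b∉Y) , b∈B , ind))
    in case proj₁ (proj₂ (proj₂ components) x ρ) same of λ
      { (inj₁ ≡.refl) → x∉l ρ∈l
      ; (inj₂ (C , circ , x∈C , ρ∈C)) → Separated.not-crossing X clX cl∁X circ ρ∈C x∈C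
          (∈ₗ⇒∈ground ∅ ρ∈l) (Sub.x∉p⇒x∈∁p (x∉l ∘ X⊆l)) }
    where
    X : Subset n
    X = ground ∅ l
    X⊆l : ∀ {e} → e ∈ X → e ∈ₗ l
    X⊆l e∈ = [ (λ e∈∅ → contradiction e∈∅ Sub.∉⊥) , id ]′ (∈ground⁻ ∅ l e∈)

  Grown-unique : ∀ {l} → Grown l → Unique l
  Grown-unique base = roots-unique
  Grown-unique (step i∉l _ g) = Allₚ.¬Any⇒All¬ _ i∉l ∷ Grown-unique g

  Grown-root : ∀ {l} → Grown l → ∀ c → root c ∈ₗ l
  Grown-root base c = ∈ₗₚ.∈-map⁺ root (∈ₗₚ.∈-allFin c)
  Grown-root (step _ _ g) c = there (Grown-root g c)

  unique⇒length≤ : ∀ {m} {l : List (Fin m)} → Unique l → length l ℕ.≤ m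
  unique⇒length≤ {l = l} u = Finₚ.injective⇒≤ {f = List.lookup l} (λ {i} {j} → unique-lookup-injective u i j)

  grow : ∃ λ l → Grown l × (∀ x → x ∈ₗ l)
  grow = go n roots base (ℕₚ.m≤n+m n _)
    where
    go : ∀ m l → Grown l → n ℕ.≤ length l ℕ.+ m → ∃ λ l → Grown l × (∀ x → x ∈ₗ l)
    go m l g n≤ with Finₚ.any? (λ x → ¬? (x ∈ₗ? l))
    ... | no none = l , g , λ x → decidable-stable (x ∈ₗ? l) (λ x∉l → none (x , x∉l))
    ... | yes (x , x∉l) with linked-exists l (Grown-root g (component x)) x∉l (≡.sym (component-root (component x)))
    go zero l g n≤ | yes _ | i , i∉l , lk = contradiction (unique⇒length≤ (Grown-unique (step i∉l lk g)))
      (ℕₚ.<⇒≱ (s≤s (≡.subst (n ℕ.≤_) (ℕₚ.+-identityʳ _) n≤)))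
    go (suc m) l g n≤ | yes _ | i , i∉l , lk = go m (i ∷ l) (step i∉l lk g) (≡.subst (n ℕ.≤_) (ℕₚ.+-suc _ m) n≤)

  -- While l is processed along B every element other than a root is neither a loop nor a coloop,
  -- because of its smaller neighbour; so only the k roots can raise the order of vanishing.
  Lowest-Grown : ∀ {l} → Grown l → ∀ {C} → C ⊆ B → (∀ {x} → x ∈ B → x ∈ C ⊎ x ∈ₗ l) → (∀ {x} → x ∈ₗ l → x ∉ C) →
                 ∃ λ j → j ℕ.≤ k × Lowest (r (ground C l)) (taylor (tree C l)) j
  -- The roots and `C₀` lie in `B`, so every root is a coloop of what remains and contributes a
  -- factor x.
  Lowest-Grown base {C₀} C₀⊆B _ disj = length roots ,
      ℕₚ.≤-reflexive (≡.trans (Listₚ.length-map root (allFin k)) (Listₚ.length-tabulate id)) ,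
      go roots (roots-unique , disj) C₀⊆B roots⊆B
    where
    go : ∀ {C} l → Fresh C l → C ⊆ B → (∀ {x} → x ∈ₗ l → x ∈ B) → Lowest (r (ground C l)) (taylor (tree C l)) (length l)
    go [] fr C⊆B l⊆B = Lowest-leaf (hereditary C⊆B B-ind)
    go {C} (i ∷ l) fr C⊆B l⊆B = Lowest-cong (taylor-tree-coloop l (hereditary (▹⊆ C⊆B (l⊆B (here ≡.refl))) B-ind) ¬cl)
        (≡.subst (λ m → Lowest m (shift (taylor (tree C l))) (suc (length l))) (≡.sym (¬Cl⇒r▹ ¬cl))
          (Lowest-shift (go l (Fresh-tail fr) C⊆B (l⊆B ∘ there))))
      where
      ¬cl : ¬ Cl (ground C l) i
      ¬cl = Ind⇒¬Cl (hereditary (λ {x} x∈ → [ C⊆B , l⊆B ]′ (∈ground⁻ C (i ∷ l) x∈)) B-ind) (Fresh-head fr)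
  Lowest-Grown {i ∷ l} (step i∉l (inj₁ (i∈B , e , e∈l , e∉B , ind)) g) {C} C⊆B B⊆ disj =
    let (j , j≤k , low) = Lowest-Grown g (▹⊆ C⊆B i∈B) B⊆′ (proj₂ (Fresh-▹ fresh))
        (j′ , j′≤j , low′) = Lowest-+ (≡.subst (λ X → Lowest (r X) (taylor (tree (C ▹ i) l)) j) (ground-▹ C i l) low)
          (≡.subst (λ m → Signed m (taylor (tree C l))) (≡.sym cl) (tree-Signed l (hereditary C⊆B B-ind) (Fresh-tail fresh)))
    in j′ , ℕₚ.≤-trans j′≤j j≤k , Lowest-cong (λ m → ≡.trans (ℤₚ.+-comm (taylor (tree (C ▹ i) l) m) _)
         (taylor-yes l (hereditary (▹⊆ C⊆B i∈B) B-ind) m)) low′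
    where
    fresh : Fresh C (i ∷ l)
    fresh = Grown-unique (step i∉l (inj₁ (i∈B , e , e∈l , e∉B , ind)) g) , disj
    B⊆′ : ∀ {x} → x ∈ B → x ∈ C ▹ i ⊎ x ∈ₗ l
    B⊆′ x∈B with B⊆ x∈B
    ... | inj₁ x∈C = inj₁ (⊆▹ x∈C)
    ... | inj₂ (here ≡.refl) = inj₁ (∈▹ C i)
    ... | inj₂ (there x∈l) = inj₂ x∈l
    ⊆ground : (B ∖ i) ▹ e ⊆ ground C l
    ⊆ground = ▹⊆ (λ {x} x∈ → case B⊆ (∖⊆ B i x∈) of λ
      { (inj₁ x∈C) → ground-⊇ C l x∈C
      ; (inj₂ (here x≡i)) → contradiction x≡i (∈∖⁻ B i x∈)
      ; (inj₂ (there x∈l)) → ∈ₗ⇒∈ground C x∈l }) (∈ₗ⇒∈ground C e∈l)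
    -- Replacing `i` by its neighbour `e` gives a basis that avoids `i`, so `i` is not a coloop.
    cl : Cl (ground C l) i
    cl = ℕₚ.≤-antisym (begin
      r (ground C l ▹ i)    ≤⟨ ∣B∣≥r ⟩
      ∣ B ∣                 ≡⟨ ∣∖∣ i∈B ⟨
      suc ∣ B ∖ i ∣         ≡⟨ ∣▹∣ (B ∖ i) e (e∉B ∘ ∖⊆ B i) ⟨
      ∣ (B ∖ i) ▹ e ∣       ≤⟨ Ind⇒∣∣≤r ind ⊆ground ⟩
      r (ground C l)        ∎) (r-mono ⊆▹)
      where open ℕₚ.≤-Reasoning
  Lowest-Grown {i ∷ l} (step i∉l (inj₂ (i∉B , b , b∈l , b∈B , ind)) g) {C} C⊆B B⊆ disj =
    let (j , j≤k , low) = Lowest-Grown g C⊆B B⊆′ (disj ∘ there)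
        (j′ , j′≤j , low′) = Lowest-+ (≡.subst (λ m → Lowest m (taylor (tree C l)) j) (≡.sym cl) low)
          (≡.subst (λ X → Signed (r X) (taylor (tree (C ▹ i) l))) (ground-▹ C i l) (tree-Signed l C▹i-ind (Fresh-▹ fresh)))
    in j′ , ℕₚ.≤-trans j′≤j j≤k , Lowest-cong (taylor-yes l C▹i-ind) low′
    where
    fresh : Fresh C (i ∷ l)
    fresh = Grown-unique (step i∉l (inj₂ (i∉B , b , b∈l , b∈B , ind)) g) , disj
    -- The neighbour `b` is still undecided, so `C ▹ i` lies in the independent set `(B ∖ b) ▹ i`
    -- and `i` is not a loop.
    C▹i-ind : Ind (C ▹ i)
    C▹i-ind = hereditary (▹-mono (∉⇒⊆∖ C⊆B (disj (there b∈l)))) ind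
    B⊆′ : ∀ {x} → x ∈ B → x ∈ C ⊎ x ∈ₗ l
    B⊆′ x∈B with B⊆ x∈B
    ... | inj₁ x∈C = inj₁ x∈C
    ... | inj₂ (here ≡.refl) = contradiction x∈B i∉B
    ... | inj₂ (there x∈l) = inj₂ x∈l
    cl : Cl (ground C l) i
    cl = ℕₚ.≤-antisym (begin
      r (ground C l ▹ i)    ≤⟨ ∣B∣≥r ⟩
      ∣ B ∣                 ≤⟨ Ind⇒∣∣≤r B-ind (λ x∈B → [ ground-⊇ C l , ∈ₗ⇒∈ground C ]′ (B⊆′ x∈B)) ⟩
      r (ground C l)        ∎) (r-mono ⊆▹)
      where open ℕₚ.≤-Reasoning

-- Linear algebra up to double negation.

module DoubleNegation where

  infixl 1 _>>=_
  _>>=_ : ∀ {a b} {P : Set a} {Q : Set b} → ¬ ¬ P → (P → ¬ ¬ Q) → ¬ ¬ Q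
  (p >>= f) ¬q = p λ x → f x ¬q

  return : ∀ {a} {P : Set a} → P → ¬ ¬ P
  return x ¬p = ¬p x

  excluded-middle : ∀ {a} (P : Set a) → ¬ ¬ Dec P
  excluded-middle P ¬dec = ¬dec (no (λ p → ¬dec (yes p)))

  ¬¬-∀ : ∀ {a n} {P : Fin n → Set a} → (∀ i → ¬ ¬ P i) → ¬ ¬ (∀ i → P i)
  ¬¬-∀ {n = zero}   p = return λ ()
  ¬¬-∀ {n = suc n}  p = p zero >>= λ x → ¬¬-∀ (p ∘ suc) >>= λ xs → return λ { zero → x ; (suc i) → xs i }

-- Equality in K is undecidable, so ranks and bases exist only up to double negation.
module LinearAlgebra {c ℓ} (K : Field c ℓ) where
  open Field K hiding (zero)
  open RingSolver commutativeRing
  open ExteriorAlgebra K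
  open DoubleNegation
  open Algebra.Properties.Semiring.Sum semiring using (sum; sum-cong-≋; ∑-distrib-+; ∑-comm; *-distribˡ-sum; *-distribʳ-sum; sum-remove)
  open Relation.Binary.Reasoning.Setoid setoid

  Kernel : ∀ {l m} → (Fin l → Fin m → Carrier) → Set (c ⊔ ℓ)
  Kernel {l} {m} P = Σ (Fin m → Carrier) λ β → (∃ λ q → ¬ (β q ≈ 0#)) × (∀ j → sum (λ q → P j q * β q) ≈ 0#)

  private
    sum-neg : ∀ {m} a (f g : Fin m → Carrier) → sum (λ q → f q + - (a * g q)) ≈ sum f + - (a * sum g)
    sum-neg a f g = begin
      sum (λ q → f q + - (a * g q))
        ≈⟨ sum-cong-≋ (λ q → +-congˡ (solve 2 (λ a g → :- (a :* g) := (:- a) :* g) refl a (g q))) ⟩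
      sum (λ q → f q + - a * g q)
        ≈⟨ ∑-distrib-+ f (λ q → - a * g q) ⟩
      sum f + sum (λ q → - a * g q)
        ≈⟨ +-congˡ (*-distribˡ-sum (- a) g) ⟨
      sum f + - a * sum g
        ≈⟨ +-congˡ (solve 2 (λ a g → (:- a) :* g := :- (a :* g)) refl a (sum g)) ⟩
      sum f + - (a * sum g) ∎

  -- Gaussian elimination; only the search for a pivot in the first row calls for excluded middle.
  kernel : ∀ {l m} → l ℕ.< m → (P : Fin l → Fin m → Carrier) → ¬ ¬ Kernel P
  kernel {zero}  {suc m} lt P = return ((λ _ → 1#) , (zero , λ 1≈0 → 0≉1 (sym 1≈0)) , λ ())
  kernel {suc l} {suc m} (s≤s lt) P = excluded-middle (∃ λ q → ¬ (P zero q ≈ 0#)) >>= λ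
    { (no none) → ¬¬-∀ (λ q → λ nz → none (q , nz)) >>= λ row₀ →
        kernel (ℕₚ.m<n⇒m<1+n lt) (P ∘ suc) >>= λ { (β , nz , eqs) → return (β , nz , λ
          { zero → sum-zero (λ q → trans (*-congʳ (row₀ q)) (zeroˡ (β q))) ; (suc j) → eqs j }) }
    ; (yes (q₀ , nz₀)) → let (a , pa≈1) = inverse (P zero q₀) nz₀ in eliminate q₀ a pa≈1 }
    where
    eliminate : ∀ q₀ a → P zero q₀ * a ≈ 1# → ¬ ¬ Kernel P
    -- The matrix passed on is the Schur complement of the pivot, whose inverse is `a`.
    eliminate q₀ a pa≈1 = kernel lt (λ j q → row j q + - ((P (suc j) q₀ * a) * row₀ q)) >>= λ { (β , (q , nz) , eqs) → return (extended β q nz eqs) }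
      where
      row₀ : Fin m → Carrier
      row₀ q = P zero (punchIn q₀ q)
      row : Fin l → Fin m → Carrier
      row j q = P (suc j) (punchIn q₀ q)
      extended : ∀ β q → ¬ (β q ≈ 0#) → (∀ j → sum (λ q → (row j q + - ((P (suc j) q₀ * a) * row₀ q)) * β q) ≈ 0#) → Kernel P
      extended β q nz eqs = γ , (punchIn q₀ q , nz ∘ trans (sym (γ-punchIn q))) , λ
          { zero → begin
              sum (λ q → P zero q * γ q)
                ≈⟨ split zero ⟩
              P zero q₀ * - (a * s) + s
                ≈⟨ solve 3 (λ p a s → p :* (:- (a :* s)) :+ s := s :+ :- ((p :* a) :* s)) refl _ _ _ ⟩
              s + - ((P zero q₀ * a) * s)
                ≈⟨ +-congˡ (-‿cong (*-congʳ pa≈1)) ⟩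
              s + - (1# * s)
                ≈⟨ solve 1 (λ s → s :+ :- (:1 :* s) := :0) refl _ ⟩
              0# ∎
          ; (suc j) → begin
              sum (λ q → P (suc j) q * γ q)
                ≈⟨ split (suc j) ⟩
              P (suc j) q₀ * - (a * s) + sum (λ q → row j q * β q)
                ≈⟨ solve 4 (λ p a s t → p :* (:- (a :* s)) :+ t := t :+ :- ((p :* a) :* s)) refl _ _ _ _ ⟩
              sum (λ q → row j q * β q) + - ((P (suc j) q₀ * a) * s)
                ≈⟨ sum-neg (P (suc j) q₀ * a) (λ q → row j q * β q) (λ q → row₀ q * β q) ⟨
              sum (λ q → row j q * β q + - ((P (suc j) q₀ * a) * (row₀ q * β q)))
                ≈⟨ sum-cong-≋ (λ q → solve 4 (λ x b y z → x :* b :+ :- (y :* (z :* b)) := (x :+ :- (y :* z)) :* b) refl (row j q) (β q) (P (suc j) q₀ * a) (row₀ q)) ⟩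
              sum (λ q → (row j q + - ((P (suc j) q₀ * a) * row₀ q)) * β q)
                ≈⟨ eqs j ⟩
              0# ∎ }
        where
        s : Carrier
        s = sum (λ q → row₀ q * β q)
        -- The first equation determines the coordinate at the pivot.
        γ : Fin (suc m) → Carrier
        γ = VF.insertAt β q₀ (- (a * s))
        γ-punchIn : ∀ q → γ (punchIn q₀ q) ≈ β q
        γ-punchIn q = reflexive (VFₚ.insertAt-punchIn β q₀ (- (a * s)) q)
        split : ∀ j → sum (λ q → P j q * γ q) ≈ P j q₀ * - (a * s) + sum (λ q → P j (punchIn q₀ q) * β q)
        split j = trans (sum-remove {i = q₀} (λ q → P j q * γ q)) (+-cong
          (*-congˡ (reflexive (VFₚ.insertAt-lookup β q₀ (- (a * s))))) (sum-cong-≋ (λ q → *-congˡ (γ-punchIn q))))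

  comb : ∀ {n m} → (Fin m → Carrier) → (Fin m → A n) → A n
  comb β y S = sum (λ q → β q * y q S)

  record Subspace {n} (I : A n → Set (c ⊔ ℓ)) : Set (c ⊔ ℓ) where
    field
      I-≋ : ∀ {x y} → x ≋ y → I x → I y
      I-𝟎 : I 𝟎
      I-⊕ : ∀ {x y} → I x → I y → I (x ⊕ y)
      I-⊙ : ∀ a {x} → I x → I (a ⊙ x)

    I-neg : ∀ {x} → I x → I (neg x)
    I-neg {x} p = I-≋ (≋-sym (neg≋⊙ x)) (I-⊙ _ p)

    I-sum : ∀ {m} (f : Fin m → A n) → (∀ q → I (f q)) → I (λ S → sum (λ q → f q S))
    I-sum {zero}  f p = I-𝟎
    I-sum {suc m} f p = I-⊕ (p zero) (I-sum (f ∘ suc) (p ∘ suc))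

  module Bases {n} {I : A n → Set (c ⊔ ℓ)} (subspace : Subspace I) where
    open Subspace subspace

    -- Coefficients vanish only up to double negation, since `basis-exists` derives this from the
    -- negation of `Spanned`; for comparing the sizes of bases it is enough.
    Independent′ : ∀ {m} → (Fin m → A n) → Set (c ⊔ ℓ)
    Independent′ y = ∀ β → I (comb β y) → ∀ q → ¬ ¬ (β q ≈ 0#)

    Spanned : ∀ {m} → (Fin m → A n) → A n → Set (c ⊔ ℓ)
    Spanned y x = ∃ λ β → I (x ⊕ neg (comb β y))

    -- A basis of the degree p part of E / I.
    record Basis (p m : ℕ) : Set (c ⊔ ℓ) where
      field
        element      : Fin m → A n
        homogeneous  : ∀ q → Hom p (element q)
        independent  : Independent′ element
        spanning     : ∀ x → Hom p x → Spanned element x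

    Spanned-≋ : ∀ {m} {y : Fin m → A n} {x x′} → x ≋ x′ → Spanned y x → Spanned y x′
    Spanned-≋ p (β , i) = β , I-≋ (λ S → +-congʳ (p S)) i

    Spanned-⊕ : ∀ {m} {y : Fin m → A n} {x x′} → Spanned y x → Spanned y x′ → Spanned y (x ⊕ x′)
    Spanned-⊕ {y = y} {x} {x′} (β , i) (γ , j) = (λ q → β q + γ q) , I-≋ (λ S → begin
        (x S + - comb β y S) + (x′ S + - comb γ y S)
          ≈⟨ solve 4 (λ a b c d → (a :+ :- b) :+ (c :+ :- d) := (a :+ c) :+ :- (b :+ d)) refl _ _ _ _ ⟩
        (x S + x′ S) + - (comb β y S + comb γ y S)
          ≈⟨ +-congˡ (-‿cong (trans (sum-cong-≋ (λ q → distribʳ (y q S) (β q) (γ q))) (∑-distrib-+ (λ q → β q * y q S) (λ q → γ q * y q S)))) ⟨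
        (x S + x′ S) + - comb (λ q → β q + γ q) y S ∎) (I-⊕ i j)

    Spanned-⊙ : ∀ {m} {y : Fin m → A n} a {x} → Spanned y x → Spanned y (a ⊙ x)
    Spanned-⊙ {y = y} a {x} (β , i) = (λ q → a * β q) , I-≋ (λ S → begin
        a * (x S + - comb β y S)
          ≈⟨ solve 3 (λ a x y → a :* (x :+ :- y) := a :* x :+ :- (a :* y)) refl _ _ _ ⟩
        a * x S + - (a * comb β y S)
          ≈⟨ +-congˡ (-‿cong (trans (*-distribˡ-sum a (λ q → β q * y q S)) (sum-cong-≋ (λ q → sym (*-assoc a (β q) (y q S)))))) ⟩
        a * x S + - comb (λ q → a * β q) y S ∎) (I-⊙ a i)

    I⇒Spanned : ∀ {m} {y : Fin m → A n} {x} → I x → Spanned y x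
    I⇒Spanned {y = y} {x} i = (λ _ → 0#) , I-≋ (λ S → sym (trans
      (+-congˡ (-‿cong (sum-zero {f = λ q → 0# * y q S} (λ q → zeroˡ _)))) (solve 1 (λ x → x :+ :- :0 := x) refl _))) i

    Spanned-neg : ∀ {m} {y : Fin m → A n} {x} → Spanned y x → Spanned y (neg x)
    Spanned-neg {x = x} sp = Spanned-≋ (≋-sym (neg≋⊙ x)) (Spanned-⊙ _ sp)

    Spanned-element : ∀ {m} (y : Fin m → A n) q → Spanned y (y q)
    Spanned-element y q = δ q , I-≋ (λ S → sym (trans (+-congˡ (-‿cong (sum-δ q (λ q → y q S)))) (-‿inverseʳ _))) I-𝟎

    Spanned-sum : ∀ {m k} {y : Fin m → A n} (f : Fin k → A n) → (∀ j → Spanned y (f j)) → Spanned y (λ S → sum (λ j → f j S))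
    Spanned-sum {k = zero}   f p = I⇒Spanned I-𝟎
    Spanned-sum {k = suc k}  f p = Spanned-⊕ (p zero) (Spanned-sum (f ∘ suc) (p ∘ suc))

    -- Otherwise a kernel vector of the coordinate matrix is a non-trivial relation. The comparison
    -- of natural numbers absorbs the double negation.
    basis-≤ : ∀ {p m m′} → Basis p m → Basis p m′ → m ℕ.≤ m′
    basis-≤ {p} {m} {m′} b b′ = ℕₚ.≮⇒≥ λ lt → kernel lt (λ j q → P q j) λ { (β , (q , nz) , eqs) →
      Basis.independent b β (I-≋ (relation β eqs) (I-sum _ (λ q → I-⊙ (β q) (proj₂ (Basis.spanning b′ (y q) (Basis.homogeneous b q)))))) q nz }
      where
      y : Fin m → A n
      y = Basis.element b
      y′ : Fin m′ → A n
      y′ = Basis.element b′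
      P : Fin m → Fin m′ → Carrier
      P q = proj₁ (Basis.spanning b′ (y q) (Basis.homogeneous b q))
      relation : ∀ β → (∀ j → sum (λ q → P q j * β q) ≈ 0#) →
                 (λ S → sum (λ q → β q * (y q S + - comb (P q) y′ S))) ≋ comb β y
      relation β eqs S = begin
        sum (λ q → β q * (y q S + - comb (P q) y′ S))
          ≈⟨ sum-cong-≋ (λ q → solve 3 (λ b y s → b :* (y :+ :- s) := b :* y :+ :- (:1 :* (b :* s))) refl (β q) (y q S) (comb (P q) y′ S)) ⟩
        sum (λ q → β q * y q S + - (1# * (β q * comb (P q) y′ S)))
          ≈⟨ sum-neg 1# (λ q → β q * y q S) (λ q → β q * comb (P q) y′ S) ⟩
        comb β y S + - (1# * sum (λ q → β q * comb (P q) y′ S))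
          ≈⟨ +-congˡ (-‿cong (*-congˡ (sum-cong-≋ (λ q → *-distribˡ-sum (β q) (λ j → P q j * y′ j S))))) ⟩
        comb β y S + - (1# * sum (λ q → sum (λ j → β q * (P q j * y′ j S))))
          ≈⟨ +-congˡ (-‿cong (*-congˡ (∑-comm (λ q j → β q * (P q j * y′ j S))))) ⟩
        comb β y S + - (1# * sum (λ j → sum (λ q → β q * (P q j * y′ j S))))
          ≈⟨ +-congˡ (-‿cong (*-congˡ (sum-zero (λ j → trans (sum-cong-≋ (λ q → solve 3 (λ b p y → b :* (p :* y) := (p :* b) :* y) refl (β q) (P q j) (y′ j S)))
               (trans (sym (*-distribʳ-sum (y′ j S) (λ q → P q j * β q))) (trans (*-congʳ (eqs j)) (zeroˡ _))))))) ⟩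
        comb β y S + - (1# * 0#)
          ≈⟨ solve 1 (λ x → x :+ :- (:1 :* :0) := x) refl _ ⟩
        comb β y S ∎

    ∈allSubsets : ∀ {m} (S : Subset m) → S ∈ₗ allSubsets m
    ∈allSubsets []             = here ≡.refl
    ∈allSubsets (inside  ∷ S)  = ∈ₗₚ.∈-++⁺ˡ (∈ₗₚ.∈-map⁺ (inside ∷_) (∈allSubsets S))
    ∈allSubsets (outside ∷ S)  = ∈ₗₚ.∈-++⁺ʳ (List.map (inside ∷_) (allSubsets _)) (∈ₗₚ.∈-map⁺ (outside ∷_) (∈allSubsets S))

    Spanned-from-monomials : ∀ {m} {y : Fin m → A n} p → (∀ S → ∣ S ∣ ≡ p → Spanned y (e S)) → ∀ x → Hom p x → Spanned y x
    Spanned-from-monomials {y = y} p sp x h = expand (Spanned y) Spanned-≋ Spanned-⊕ x λ S → case ∣ S ∣ ℕ.≟ p of λ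
      { (yes eq) → Spanned-⊙ (x S) (sp S eq)
      ; (no neq) → I⇒Spanned (I-≋ (λ T → sym (trans (*-congʳ (h S neq)) (zeroˡ _))) I-𝟎) }

    -- Each of the finitely many monomials costs one undecidable choice: whether it is spanned
    -- already.
    basis-exists : ∀ p → ¬ ¬ ∃ (Basis p)
    basis-exists p = greedy (allSubsets n) >>= λ { (m , y , h , ind , sp) → return (m , record
        { element = y ; homogeneous = h ; independent = ind
        ; spanning = Spanned-from-monomials p (λ S → sp S (∈allSubsets S)) }) }
      where
      greedy : ∀ (L : List (Subset n)) → ¬ ¬ ∃ λ m → Σ (Fin m → A n) λ y → (∀ q → Hom p (y q)) × Independent′ y ×
               (∀ S → S ∈ₗ L → ∣ S ∣ ≡ p → Spanned y (e S))
      greedy [] = return (0 , (λ ()) , (λ ()) , (λ β _ ()) , λ S ())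
      greedy (S ∷ L) = greedy L >>= λ { (m , y , h , ind , sp) → excluded-middle (Spanned y (e S)) >>= λ
        { (yes spS) → return (m , y , h , ind , λ { T (here ≡.refl) _ → spS ; T (there T∈) → sp T T∈ })
        ; (no ¬spS) → case ∣ S ∣ ℕ.≟ p of λ
          { (no neq) → return (m , y , h , ind , λ { T (here ≡.refl) eq → contradiction eq neq ; T (there T∈) → sp T T∈ })
          ; (yes eq) → return (suc m , e S VF.∷ y ,
              (λ { zero → ≡.subst (λ p → Hom p (e S)) eq (Hom-e S) ; (suc q) → h q }) ,
              adjoin m y S ind ¬spS ,
              λ { T (here ≡.refl) _ → Spanned-element (e S VF.∷ y) zero ; T (there T∈) eq → weaken m y S (sp T T∈ eq) }) } } }
        where
        weaken : ∀ m (y : Fin m → A n) S {x} → Spanned {m} y x → Spanned (e S VF.∷ y) x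
        weaken m y S (β , i) = (0# VF.∷ β) , I-≋ (λ T → +-congˡ (-‿cong (sym (trans (+-congʳ (zeroˡ (e S T))) (+-identityˡ _))))) i
        adjoin : ∀ m (y : Fin m → A n) S → Independent′ {m} y → ¬ Spanned y (e S) → Independent′ (e S VF.∷ y)
        adjoin m y S ind ¬spS β i = λ
            { zero → β₀≈0 ; (suc q) → β₀≈0 >>= λ β₀≈0 → ind (β ∘ suc)
                (I-≋ (λ T → trans (+-congʳ (trans (*-congʳ β₀≈0) (zeroˡ _))) (+-identityˡ _)) i) q }
          where
          β₀≈0 : ¬ ¬ (β zero ≈ 0#)
          β₀≈0 nz = let (a , ba≈1) = inverse (β zero) nz in ¬spS ((λ q → - a * β (suc q)) , I-≋ (λ T → begin
            a * (β zero * e S T + comb (β ∘ suc) y T)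
              ≈⟨ solve 4 (λ a b x s → a :* (b :* x :+ s) := (b :* a) :* x :+ :- ((:- a) :* s)) refl _ _ _ _ ⟩
            (β zero * a) * e S T + - (- a * comb (β ∘ suc) y T)
              ≈⟨ +-cong (trans (*-congʳ ba≈1) (*-identityˡ _)) (-‿cong (trans (*-distribˡ-sum (- a) (λ q → β (suc q) * y q T))
                   (sum-cong-≋ (λ q → sym (*-assoc (- a) (β (suc q)) (y q T)))))) ⟩
            e S T + - comb (λ q → - a * β (suc q)) y T ∎) (I-⊙ a i))

    basis-empty : ∀ p → n ℕ.< p → Basis p 0
    basis-empty p n<p = record
      { element = none ; homogeneous = λ () ; independent = λ β _ ()
      ; spanning = λ x h → I⇒Spanned {y = none} (I-≋ (λ S → sym (h S (λ eq → ℕₚ.<⇒≱ n<p (≡.subst (ℕ._≤ n) eq (Sub.∣p∣≤n S))))) I-𝟎) }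
      where
      none : Fin 0 → A n
      none ()

  ·-comb : ∀ {n m} (v : A n) (β : Fin m → Carrier) (y : Fin m → A n) → v · comb β y ≋ comb β (λ q → v · y q)
  ·-comb {m = zero}   v β y = ·-zeroʳ v
  ·-comb {m = suc m}  v β y S = trans (·-distribˡ v (β zero ⊙ y zero) (comb (β ∘ suc) (y ∘ suc)) S)
    (+-cong (⊙-·ʳ (β zero) v (y zero) S) (·-comb v (β ∘ suc) (y ∘ suc) S))

  sum-++ : ∀ m {m′} (f : Fin (m ℕ.+ m′) → Carrier) → sum f ≈ sum (λ i → f (i Fin.↑ˡ m′)) + sum (λ i → f (m Fin.↑ʳ i))
  sum-++ zero     f = sym (+-identityˡ _)
  sum-++ (suc m)  f = trans (+-congˡ (sum-++ m (f ∘ suc))) (sym (+-assoc _ _ _))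

  -- If v = lin a is regular on E / I and b is a homogeneous basis of E / I′,
  -- where I′ = I + (v), then b together with v ∧ b is a basis of E / I.
  module BasisStep {n} {I I′ : A n → Set (c ⊔ ℓ)} (sI : Subspace I) (sI′ : Subspace I′) (a : Fin n → Carrier)
    (I⇒I′ : ∀ {x} → I x → I′ x) (I′-v : ∀ x → I′ (lin a · x)) (I-v : ∀ {x} → I x → I (lin a · x))
    (I′⇒ : ∀ {x} → I′ x → ∃ λ y → I (x ⊕ neg (lin a · y)))
    (regular : ∀ {x} → I (lin a · x) → ∃ λ y → I (x ⊕ neg (lin a · y)))
    (I-π : ∀ p {x} → I x → I (π p x)) where
    open Subspace sI
    private
      module B  = Bases sI
      module B′ = Bases sI′
      module S′ = Subspace sI′
      v : A n
      v = lin a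

      π-comb : ∀ p {m} β (y : Fin m → A n) → (∀ q → Hom p (y q)) → Hom p (comb β y)
      π-comb p β y h S neq = sum-zero (λ q → trans (*-congˡ (h q S neq)) (zeroʳ (β q)))

      -- Passing to the component of degree `p` keeps the error term homogeneous although nothing is
      -- known about the degree of `z`.
      reduce : ∀ p {m} {y : Fin m → A n} → (∀ q → Hom p (y q)) → ∀ {x} → Hom p x → B′.Spanned y x →
               ∃ λ β → ∃ λ z → I ((x ⊕ neg (comb β y)) ⊕ neg (π p (v · z)))
      reduce p {y = y} hy {x} hx (β , i′) = let (z , i) = I′⇒ i′ in β , z , I-≋ (λ S → begin
        π p ((x ⊕ neg (comb β y)) ⊕ neg (v · z)) S
          ≈⟨ π-⊕ p (x ⊕ neg (comb β y)) (neg (v · z)) S ⟩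
        π p (x ⊕ neg (comb β y)) S + π p (neg (v · z)) S
          ≈⟨ +-cong (π-Hom p (λ S neq → trans (+-cong (hx S neq) (-‿cong (π-comb p β y hy S neq))) (-‿inverseʳ 0#)) S)
                    (trans (π-cong p (neg≋⊙ (v · z)) S) (trans (π-⊙ p (- 1#) (v · z) S) (sym (neg≋⊙ (π p (v · z)) S)))) ⟩
        (x S + - comb β y S) + - π p (v · z) S ∎) (I-π p i)

      v·π : ∀ p z → v · π p (v · z) ≋ 𝟎
      v·π zero     z = ≋-trans (·-congˡ (π-zero-lin a z)) (·-zeroʳ v)
      v·π (suc p)  z = ≋-trans (·-congˡ (π-suc-lin p a z)) (≋-trans (≋-sym (·-assoc v v (π p z)))
        (≋-trans (·-congʳ (lin² a)) (·-zeroˡ (π p z))))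

    step-zero : ∀ {m} → B′.Basis 0 m → B.Basis 0 m
    step-zero b = record
      { element = y ; homogeneous = h
      ; independent = λ β i → Basis.independent b β (I⇒I′ i)
      ; spanning = λ x hx → let (β , z , i) = reduce 0 h hx (Basis.spanning b x hx) in β ,
          I-≋ (λ S → trans (+-congˡ (-‿cong (π-zero-lin a z S))) (solve 1 (λ x → x :+ :- :0 := x) refl _)) i }
      where
      open B′
      y = Basis.element b
      h = Basis.homogeneous b

    step-suc : ∀ {p m m′} → B′.Basis (suc p) m → B′.Basis p m′ → B.Basis (suc p) (m ℕ.+ m′)
    step-suc {p} {m} {m′} b b′ = record
      { element = w ; homogeneous = hw ; independent = independent ; spanning = spanning }
      where
      open B′
      y : Fin m → A n
      y = Basis.element b
      y′ vy′ : Fin m′ → A n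
      y′ = Basis.element b′
      vy′ q = v · y′ q
      w : Fin (m ℕ.+ m′) → A n
      w = y VF.++ vy′
      hw : ∀ q → Hom (suc p) (w q)
      hw q with Fin.splitAt m q
      ... | inj₁ j = Basis.homogeneous b j
      ... | inj₂ j = λ S neq → trans (·-congˡ (≋-sym (π-Hom p (Basis.homogeneous b′ j))) S)
                       (trans (sym (π-suc-lin p a (y′ j) S)) (Hom-π (suc p) (v · y′ j) S neq))
      comb-split : ∀ β → comb β w ≋ comb (λ q → β (q Fin.↑ˡ m′)) y ⊕ comb (λ q → β (m Fin.↑ʳ q)) vy′
      comb-split β S = trans (sum-++ m (λ q → β q * w q S)) (+-cong
        (sum-cong-≋ (λ q → *-congˡ (reflexive (≡.cong (λ x → x S) (VFₚ.lookup-++ˡ y vy′ q)))))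
        (sum-cong-≋ (λ q → *-congˡ (reflexive (≡.cong (λ x → x S) (VFₚ.lookup-++ʳ y vy′ q))))))
      first-zero : ∀ β → I (comb β w) → ∀ j → ¬ ¬ (β (j Fin.↑ˡ m′) ≈ 0#)
      first-zero β i = Basis.independent b _ (S′.I-≋
        (λ S → trans (+-congʳ (comb-split β S)) (solve 2 (λ x y → (x :+ y) :+ :- y := x) refl _ _))
        (S′.I-⊕ (I⇒I′ i) (S′.I-neg (S′.I-≋ (·-comb v (λ q → β (m Fin.↑ʳ q)) y′) (I′-v _)))))
      independent : B.Independent′ w
      independent β i q with Fin.splitAt m q in eq
      ... | inj₁ j = ≡.subst (λ q → ¬ ¬ (β q ≈ 0#)) (Finₚ.splitAt⁻¹-↑ˡ eq) (first-zero β i j)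
      ... | inj₂ j = ≡.subst (λ q → ¬ ¬ (β q ≈ 0#)) (Finₚ.splitAt⁻¹-↑ʳ eq)
          -- Modulo `I′` the second block vanishes, so the first coefficients are zero. What is left
          -- is a multiple of `v` in `I`, and regularity puts its cofactor into `I′`.
          (¬¬-∀ (first-zero β i) >>= λ β₁≈0 →
            let (z , i″) = regular (I-≋ (λ S → trans (comb-split β S) (trans
                  (+-cong (sum-zero (λ q → trans (*-congʳ (β₁≈0 q)) (zeroˡ (y q S)))) (sym (·-comb v (λ q → β (m Fin.↑ʳ q)) y′ S)))
                  (+-identityˡ _))) i)
            in Basis.independent b′ _ (S′.I-≋ (λ S → solve 2 (λ x y → (x :+ :- y) :+ y := x) refl _ _) (S′.I-⊕ (I⇒I′ i″) (I′-v z))) j)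
      spanning : ∀ x → Hom (suc p) x → B.Spanned w x
      spanning x hx =
        let (β , z , i) = reduce (suc p) (Basis.homogeneous b) hx (Basis.spanning b x hx)
            z₀ = π p z
            -- The cofactor of `v` is expanded in degree `p`; by `v·π` the error of this second
            -- expansion is killed by `v`.
            (γ , z′ , i′) = reduce p (Basis.homogeneous b′) (Hom-π p z) (Basis.spanning b′ z₀ (Hom-π p z))
            β++γ = β VF.++ γ
        in β++γ , I-≋ (λ S → begin
          ((x S + - comb β y S) + - π (suc p) (v · z) S) + (v · ((z₀ ⊕ neg (comb γ y′)) ⊕ neg (π p (v · z′)))) S
            ≈⟨ +-cong (+-congˡ (-‿cong (π-suc-lin p a z S))) (trans (·-distribˡ v (z₀ ⊕ neg (comb γ y′)) (neg (π p (v · z′))) S)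
                 (+-cong (trans (·-distribˡ v z₀ (neg (comb γ y′)) S) (+-congˡ (trans (neg-·ʳ v (comb γ y′) S) (-‿cong (·-comb v γ y′ S)))))
                         (trans (neg-·ʳ v (π p (v · z′)) S) (-‿cong (v·π p z′ S))))) ⟩
          ((x S + - comb β y S) + - (v · z₀) S) + (((v · z₀) S + - comb γ vy′ S) + - 0#)
            ≈⟨ solve 4 (λ x s t u → ((x :+ :- s) :+ :- t) :+ ((t :+ :- u) :+ :- :0) := x :+ :- (s :+ u)) refl _ _ _ _ ⟩
          x S + - (comb β y S + comb γ vy′ S)
            ≈⟨ +-congˡ (-‿cong (trans (comb-split β++γ S) (+-cong
                 (sum-cong-≋ (λ q → *-congʳ (reflexive (VFₚ.lookup-++ˡ β γ q))))
                 (sum-cong-≋ (λ q → *-congʳ (reflexive (VFₚ.lookup-++ʳ β γ q))))))) ⟨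
          x S + - comb β++γ w S ∎) (I-⊕ i (I-v i′))

-- The Orlik-Solomon ideal and regular linear forms.

module OrlikSolomon {c ℓ} (K : Field c ℓ) {n : ℕ} (M : Matroid n) where
  open Field K hiding (zero)
  open RingSolver commutativeRing
  open ExteriorAlgebra K
  open ExteriorAlgebra.Comparison K using (∧E≋·; ∂e≋ι)
  open LinearAlgebra K
  open MatroidTheory M
  open Exterior K n using (⟨_⟩; gen; zer; add; mulˡ; mulʳ; resp; _∧E_; ∂e; InE₁)
  open Algebra.Properties.Ring ring using (-‿distribˡ-*; -‿distribʳ-*; -‿involutive)
  open Algebra.Properties.AbelianGroup +-abelianGroup using (ε⁻¹≈ε)
  open Algebra.Properties.Semiring.Sum semiring using (sum; sum-cong-≋)
  open Relation.Binary.Reasoning.Setoid setoid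

  Gens : List (A n) → A n → Set c
  Gens = Exterior.Gens K n M

  Ideal : List (A n) → A n → Set (c ⊔ ℓ)
  Ideal vs = ⟨ Gens vs ⟩

  elim : ∀ {g p} {G : A n → Set g} (P : A n → Set p) → (∀ {x} → G x → P x) → P 𝟎 →
         (∀ {x y} → P x → P y → P (x ⊕ y)) → (∀ a {x} → P x → P (a · x)) → (∀ a {x} → P x → P (x · a)) →
         (∀ {x y} → x ≋ y → P x → P y) → ∀ {x} → ⟨ G ⟩ x → P x
  elim P pgen pzer padd pmulˡ pmulʳ presp = go
    where
    go : ∀ {x} → ⟨ _ ⟩ x → P x
    go (gen p)         = pgen p
    go zer             = pzer
    go (add p q)       = padd (go p) (go q)
    go (mulˡ a {x} p)  = presp (≋-sym (∧E≋· a x)) (pmulˡ a (go p))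
    go (mulʳ a {x} p)  = presp (≋-sym (∧E≋· x a)) (pmulʳ a (go p))
    go (resp eq p)     = presp eq (go p)

  module _ {vs : List (A n)} where
    I-·ˡ : ∀ a {x} → Ideal vs x → Ideal vs (a · x)
    I-·ˡ a {x} p = resp (∧E≋· a x) (mulˡ a p)

    I-·ʳ : ∀ a {x} → Ideal vs x → Ideal vs (x · a)
    I-·ʳ a {x} p = resp (∧E≋· x a) (mulʳ a p)

  subspace : ∀ vs → Subspace (Ideal vs)
  subspace vs = record
    { I-≋ = resp ; I-𝟎 = zer ; I-⊕ = add
    ; I-⊙ = λ a {x} p → resp (λ S → trans (⊙-·ˡ a 𝟏 x S) (*-congˡ (·-identityˡ x S))) (I-·ˡ (a ⊙ 𝟏) p) }

  module _ {vs : List (A n)} where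
    open Subspace (subspace vs) public using (I-≋; I-𝟎; I-⊕; I-⊙; I-neg)

  dependent-nonempty : ∀ {S} → ¬ Ind S → ∃ (_∈ S)
  dependent-nonempty {S} dep = decidable-stable (Sub.nonempty? S) λ empty →
    dep (≡.subst Ind (≡.sym (Sub.Empty-unique empty)) (Matroid.empty-indep M))

  ∂∈I : ∀ {vs S} → ¬ Ind S → Ideal vs (ι (λ _ → 1#) (e S))
  ∂∈I {S = S} dep = I-≋ (∂e≋ι S) (gen (inj₁ (S , ¬Ind⇒Dependent dep , ≡.refl)))

  -- e_t ∧ ∂e_S = e_S for t ∈ S, since e_t ∧ e_S = 0.
  e∈I : ∀ {vs S} → ¬ Ind S → Ideal vs (e S)
  e∈I {S = S} dep = I-≋ (λ T → begin
      (lin (δ t) · ι (λ _ → 1#) (e S)) T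
        ≈⟨ solve 3 (λ s x y → y := s :* x :+ :- (s :* x :+ :- y)) refl (sum (λ i → δ t i * 1#)) (e S T) _ ⟩
      sum (λ i → δ t i * 1#) * e S T + - (sum (λ i → δ t i * 1#) * e S T + - (lin (δ t) · ι (λ _ → 1#) (e S)) T)
        ≈⟨ +-cong (trans (*-congʳ (sum-δ t (λ _ → 1#))) (*-identityˡ _)) (-‿cong (trans (sym (ι-lin-· (λ _ → 1#) (δ t) (e S) T))
             (trans (ι-congʳ (lin-δ-e t S t∈S) T) (ι-𝟎 (λ _ → 1#) T)))) ⟩
      e S T + - 0#
        ≈⟨ solve 1 (λ x → x :+ :- :0 := x) refl _ ⟩
      e S T ∎) (I-·ˡ (lin (δ t)) (∂∈I dep))
    where
    t = proj₁ (dependent-nonempty dep)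
    t∈S = proj₂ (dependent-nonempty dep)

  ι-e-cong : ∀ {d d′ : Fin n → Carrier} S → (∀ i → i ∈ S → d i ≈ d′ i) → ι d (e S) ≋ ι d′ (e S)
  ι-e-cong {d} {d′} S p T = trans (ι-e d S T) (trans (sum-cong-≋ (λ i → *-congʳ (lemma i))) (sym (ι-e d′ S T)))
    where
    lemma : ∀ i → coef S i * d i ≈ coef S i * d′ i
    lemma i with i Sub.∈? S
    ... | yes i∈S = *-congˡ (p i i∈S)
    ... | no  i∉S = trans (*-congʳ (coef-∉ S i i∉S)) (trans (zeroˡ _) (sym (trans (*-congʳ (coef-∉ S i i∉S)) (zeroˡ _))))

  ι-scale : ∀ {m} a (x : A m) → ι (λ _ → a) x ≋ a ⊙ ι (λ _ → 1#) x
  ι-scale a x []             = sym (zeroʳ _)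
  ι-scale a x (inside  ∷ S)  = trans (-‿cong (ι-scale a (hd x) S)) (-‿distribʳ-* _ _)
  ι-scale a x (outside ∷ S)  = trans (+-congˡ (ι-scale a (tl x) S))
    (solve 3 (λ a x y → a :* x :+ a :* y := a :* (:1 :* x :+ y)) refl _ _ _)

  -- Write `e V` as `e U` times a cofactor. The weights are constant on `U`, so the antiderivation
  -- acts on `e U` as a multiple of ∂, and both `e U` and its image under ∂ lie in the ideal.
  ι-e∈I : ∀ {vs U V} (d : Fin n → Carrier) a → U ⊆ V → ¬ Ind U → (∀ i → i ∈ U → d i ≈ a) → Ideal vs (ι d (e V))
  ι-e∈I {U = U} {V} d a U⊆V dep const = let (z , eq) = factor U V U⊆V in
    I-≋ (≋-trans (≋-sym (ι-· d (e U) z)) (ι-congʳ eq))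
      (I-⊕ (I-·ʳ z (I-≋ (≋-sym (≋-trans (ι-e-cong U const) (ι-scale a (e U)))) (I-⊙ a (∂∈I dep))))
           (I-·ʳ (ι d z) (I-≋ (≋-sym (inv-e U)) (I-⊙ _ (e∈I dep)))))

  -- Needed for `ι-stable`, because the Leibniz rule for `x · a` involves `inv x`.
  I-inv : ∀ {vs} → All InE₁ vs → ∀ {x} → Ideal vs x → Ideal vs (inv x)
  I-inv {vs} hs = elim (Ideal vs ∘ inv) on-gen (I-≋ (≋-sym inv-𝟎) I-𝟎)
    (λ {x} {y} p q → I-≋ (≋-sym (inv-⊕ x y)) (I-⊕ p q))
    (λ a {x} p → I-≋ (≋-sym (inv-· a x)) (I-·ˡ (inv a) p))
    (λ a {x} p → I-≋ (≋-sym (inv-· x a)) (I-·ʳ (inv a) p))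
    (λ eq → I-≋ (inv-cong eq))
    where
    on-gen : ∀ {x} → Gens vs x → Ideal vs (inv x)
    on-gen (inj₁ (S , dep , ≡.refl)) = I-≋ (λ T → begin
        (- sgn ∣ S ∣) * ι (λ _ → 1#) (e S) T
          ≈⟨ -‿distribˡ-* _ _ ⟨
        - (sgn ∣ S ∣ * ι (λ _ → 1#) (e S) T)
          ≈⟨ -‿cong (trans (ι-congʳ (inv-e S) T) (ι-⊙ (λ _ → 1#) (sgn ∣ S ∣) (e S) T)) ⟨
        - ι (λ _ → 1#) (inv (e S)) T
          ≈⟨ -‿cong (ι-inv (λ _ → 1#) (e S) T) ⟩
        - - inv (ι (λ _ → 1#) (e S)) T
          ≈⟨ -‿involutive _ ⟩
        inv (ι (λ _ → 1#) (e S)) T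
          ≈⟨ inv-cong (∂e≋ι S) T ⟨
        inv (∂e S) T ∎) (I-⊙ _ (∂∈I (Dependent⇒¬Ind dep)))
    on-gen {x} (inj₂ x∈) = let eq = Hom₁⇒lin (All.lookup hs x∈); a = λ i → x ⁅ i ⁆ in
      I-≋ (≋-trans (λ S → -‿cong (eq S)) (≋-trans (≋-sym (inv-lin a)) (inv-cong (≋-sym eq)))) (I-neg {x = x} (gen (inj₂ x∈)))

  ι-stable : ∀ {vs} → All InE₁ vs → (d : Fin n → Carrier) → (∀ {x} → Gens vs x → Ideal vs (ι d x)) →
             ∀ {x} → Ideal vs x → Ideal vs (ι d x)
  ι-stable {vs} hs d on-gen p = proj₂ (elim (λ x → Ideal vs x × Ideal vs (ι d x)) (λ g → gen g , on-gen g)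
    (I-𝟎 , I-≋ (≋-sym (ι-𝟎 d)) I-𝟎)
    (λ {x} {y} (p , p′) (q , q′) → I-⊕ p q , I-≋ (≋-sym (ι-⊕ d x y)) (I-⊕ p′ q′))
    (λ a {x} (p , p′) → I-·ˡ a p , I-≋ (≋-sym (ι-· d a x)) (I-⊕ (I-·ˡ (ι d a) p) (I-·ˡ (inv a) p′)))
    (λ a {x} (p , p′) → I-·ʳ a p , I-≋ (≋-sym (ι-· d x a)) (I-⊕ (I-·ʳ a p′) (I-·ʳ (ι d a) (I-inv hs p))))
    (λ eq (p , p′) → I-≋ eq p , I-≋ (ι-congʳ eq) p′) p)

  Ideal-mono : ∀ {vs ws} → (∀ {v} → v ∈ₗ vs → v ∈ₗ ws) → ∀ {x} → Ideal vs x → Ideal ws x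
  Ideal-mono vs⊆ws = elim (Ideal _) (λ { (inj₁ p) → gen (inj₁ p) ; (inj₂ v∈) → gen (inj₂ (vs⊆ws v∈)) })
    I-𝟎 I-⊕ (λ a → I-·ˡ a) (λ a → I-·ʳ a) I-≋

  ∂-stable : ∀ {x} → Ideal [] x → Ideal [] (ι (λ _ → 1#) x)
  ∂-stable = ι-stable [] (λ _ → 1#) λ { (inj₁ (S , _ , ≡.refl)) →
    I-≋ (≋-sym (≋-trans (ι-congʳ (∂e≋ι S)) (ι²≋𝟎 (λ _ → 1#) (e S)))) I-𝟎 }

  -- If C ⊆ S is a circuit then ι_d e_S ∈ J, whence ι_d ∂e_S = − ∂ ι_d e_S ∈ J.
  ι-∂∈I : (d : Fin n → Carrier) → (∀ {C i j} → Circuit M C → i ∈ C → j ∈ C → d i ≈ d j) →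
          ∀ {vs S} → ¬ Ind S → Ideal vs (ι d (ι (λ _ → 1#) (e S)))
  ι-∂∈I d constant {vs} {S} dep = Ideal-mono (λ ()) (I-≋ (≋-sym (ι-anticomm d (λ _ → 1#) (e S)))
      (I-neg (∂-stable (ι-e∈I d (d t) C⊆S C-dep (λ i i∈C → constant circ i∈C t∈C)))))
    where
    C = proj₁ (circuit-in S dep)
    circ = proj₁ (proj₂ (circuit-in S dep))
    C⊆S : C ⊆ S
    C⊆S = proj₂ (proj₂ (circuit-in S dep))
    C-dep = Dependent⇒¬Ind (proj₁ circ)
    t = proj₁ (dependent-nonempty C-dep)
    t∈C = proj₂ (dependent-nonempty C-dep)

  -- The contracting homotopy x = ι_d (v ∧ x) + v ∧ ι_d x.
  regular : (d : Fin n → Carrier) → (∀ {C i j} → Circuit M C → i ∈ C → j ∈ C → d i ≈ d j) →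
            ∀ {vs} → All InE₁ vs → (∀ {v} → v ∈ₗ vs → sum (λ i → v ⁅ i ⁆ * d i) ≈ 0#) →
            ∀ {v} → InE₁ v → sum (λ i → v ⁅ i ⁆ * d i) ≈ 1# → Exterior.RegularOn K n M (Ideal vs) v
  regular d constant {vs} hs zeros {v} hv one x = forward , backward
    where
    a : Fin n → Carrier
    a i = v ⁅ i ⁆
    v≋ : v ≋ lin a
    v≋ = Hom₁⇒lin hv
    on-gen : ∀ {x} → Gens vs x → Ideal vs (ι d x)
    on-gen (inj₁ (S , dep , ≡.refl)) = I-≋ (ι-congʳ (≋-sym (∂e≋ι S))) (ι-∂∈I d constant (Dependent⇒¬Ind dep))
    on-gen {x} (inj₂ x∈) = I-≋ (λ S → sym (trans (ι-congʳ (Hom₁⇒lin (All.lookup hs x∈)) S)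
      (trans (ι-lin d _ S) (trans (*-congʳ (zeros x∈)) (zeroˡ _))))) I-𝟎
    forward : Ideal vs (v ∧E x) → ∃ λ y → Ideal vs (λ S → x S + - (v ∧E y) S)
    forward p = ι d x , I-≋ (λ S → begin
      ι d (v ∧E x) S
        ≈⟨ ι-congʳ (≋-trans (∧E≋· v x) (·-congʳ v≋)) S ⟩
      ι d (lin a · x) S
        ≈⟨ ι-lin-· d a x S ⟩
      sum (λ i → a i * d i) * x S + - (lin a · ι d x) S
        ≈⟨ +-cong (trans (*-congʳ one) (*-identityˡ _)) (-‿cong (≋-trans (·-congʳ (≋-sym v≋)) (≋-sym (∧E≋· v (ι d x))) S)) ⟩
      x S + - (v ∧E ι d x) S ∎) (ι-stable hs d on-gen p)
    backward : (∃ λ y → Ideal vs (λ S → x S + - (v ∧E y) S)) → Ideal vs (v ∧E x)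
    backward (y , p) = I-≋ (λ S → begin
      (v · (λ S → x S + - (v ∧E y) S)) S
        ≈⟨ trans (·-distribˡ v x _ S) (+-congˡ (neg-·ʳ v (v ∧E y) S)) ⟩
      (v · x) S + - (v · (v ∧E y)) S
        ≈⟨ +-cong (sym (∧E≋· v x S)) (-‿cong (trans (·-congˡ (∧E≋· v y) S) (trans (sym (·-assoc v v y S))
             (trans (·-congʳ (≋-trans (·-cong v≋ v≋) (lin² a)) S) (·-zeroˡ y S))))) ⟩
      (v ∧E x) S + - 0#
        ≈⟨ solve 1 (λ x → x :+ :- :0 := x) refl _ ⟩
      (v ∧E x) S ∎) (I-·ˡ v p)

  -- A linear form commutes with every element up to the grade involution, so modulo the old ideal
  -- the two-sided ideal generated by `v` consists of the one-sided multiples of `v`.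
  adjoin⇒ : ∀ {vs v} → InE₁ v → ∀ {x} → Ideal (vs ++ [ v ]) x → ∃ λ y → Ideal vs (x ⊕ neg (lin (λ i → v ⁅ i ⁆) · y))
  adjoin⇒ {vs} {v} hv = elim P on-gen (𝟎 , I-≋ (λ S → sym (trans (+-identityˡ _) (trans (-‿cong (·-zeroʳ L S)) ε⁻¹≈ε))) I-𝟎)
    (λ {x} {x′} (y , p) (y′ , p′) → y ⊕ y′ , I-≋ (λ S → trans
      (solve 4 (λ a b c d → (a :+ :- b) :+ (c :+ :- d) := (a :+ c) :+ :- (b :+ d)) refl _ _ _ _)
      (+-congˡ (-‿cong (sym (·-distribˡ L y y′ S))))) (I-⊕ p p′))
    (λ a {x} (y , p) → inv a · y , I-≋ (λ S → trans (·-distribˡ a x _ S) (+-congˡ (trans (neg-·ʳ a (L · y) S)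
      (-‿cong (trans (sym (·-assoc a L y S)) (trans (·-congʳ (·-lin a _) S) (·-assoc L (inv a) y S))))))) (I-·ˡ a p))
    (λ a {x} (y , p) → y · a , I-≋ (λ S → trans (·-distribʳ a x _ S) (+-congˡ (trans (neg-·ˡ (L · y) a S)
      (-‿cong (·-assoc L y a S))))) (I-·ʳ a p))
    (λ eq (y , p) → y , I-≋ (λ S → +-congʳ (eq S)) p)
    where
    L : A n
    L = lin (λ i → v ⁅ i ⁆)
    P : A n → Set (c ⊔ ℓ)
    P x = ∃ λ y → Ideal vs (x ⊕ neg (L · y))
    old : ∀ {x} → Gens vs x → P x
    old g = 𝟎 , I-≋ (λ S → sym (trans (+-congˡ (trans (-‿cong (·-zeroʳ L S)) ε⁻¹≈ε)) (+-identityʳ _))) (gen g)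
    on-gen : ∀ {x} → Gens (vs ++ [ v ]) x → P x
    on-gen (inj₁ p) = old (inj₁ p)
    on-gen (inj₂ x∈) with ∈ₗₚ.∈-++⁻ vs x∈
    ... | inj₁ x∈vs = old (inj₂ x∈vs)
    ... | inj₂ (here ≡.refl) = 𝟏 , I-≋ (λ S → sym (trans (+-congˡ (-‿cong (trans (·-identityʳ L S) (sym (Hom₁⇒lin hv S))))) (-‿inverseʳ _))) I-𝟎

  ι-e-Hom : ∀ (d : Fin n → Carrier) S → Hom (ℕ.pred ∣ S ∣) (ι d (e S))
  ι-e-Hom d S T neq = trans (ι-e d S T) (sum-zero lemma)
    where
    lemma : ∀ i → (coef S i * d i) * e (S ∖ i) T ≈ 0#
    lemma i with i Sub.∈? S
    ... | yes i∈S = trans (*-congˡ (e-off (S ∖ i) T (λ { ≡.refl → neq (≡.cong ℕ.pred (∣∖∣ i∈S)) }))) (zeroʳ _)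
    ... | no  i∉S = trans (*-congʳ (trans (*-congʳ (coef-∉ S i i∉S)) (zeroˡ _))) (zeroˡ _)

  -- The generators are homogeneous, and a general multiplier is broken up into linear forms by
  -- `generated`; right factors are moved to the left at the price of `inv`.
  I-π : ∀ {vs} → All InE₁ vs → ∀ p {x} → Ideal vs x → Ideal vs (π p x)
  I-π {vs} hs p q = elim P on-gen (λ p → I-≋ (≋-sym (π-𝟎 p)) I-𝟎)
    (λ {x} {y} p q r → I-≋ (≋-sym (π-⊕ r x y)) (I-⊕ (p r) (q r)))
    (λ a {x} p → left (generated a) x p) (λ a {x} p → right (generated a) x p) P-≋ q p
    where
    P : A n → Set (c ⊔ ℓ)
    P x = ∀ p → Ideal vs (π p x)
    P-≋ : ∀ {x y} → x ≋ y → P x → P y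
    P-≋ eq q p = I-≋ (π-cong p eq) (q p)
    P-⊕ : ∀ {x y} → P x → P y → P (x ⊕ y)
    P-⊕ {x} {y} p q r = I-≋ (≋-sym (π-⊕ r x y)) (I-⊕ (p r) (q r))
    P-⊙ : ∀ a {x} → P x → P (a ⊙ x)
    P-⊙ a {x} p r = I-≋ (≋-sym (π-⊙ r a x)) (I-⊙ a (p r))
    P-lin : ∀ a {x} → P x → P (lin a · x)
    P-lin a {x} p zero     = I-≋ (≋-sym (π-zero-lin a x)) I-𝟎
    P-lin a {x} p (suc r)  = I-≋ (≋-sym (π-suc-lin r a x)) (I-·ˡ (lin a) (p r))
    P-lin′ : ∀ a {x} → P x → P (x · lin a)
    P-lin′ a {x} p = P-≋ (≋-sym (·-lin x a)) (P-lin a (λ r → I-≋ (≋-sym (π-inv r x)) (I-inv hs (p r))))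
    homogeneous : ∀ {q x} → Hom q x → Ideal vs x → P x
    homogeneous {q} h i p with q ℕ.≟ p
    ... | yes ≡.refl = I-≋ (≋-sym (π-Hom p h)) i
    ... | no  q≢p    = I-≋ (≋-sym (π-Hom-≢ p q h q≢p)) I-𝟎
    on-gen : ∀ {x} → Gens vs x → P x
    on-gen (inj₁ (S , dep , ≡.refl)) = P-≋ (≋-sym (∂e≋ι S)) (homogeneous (ι-e-Hom (λ _ → 1#) S) (∂∈I (Dependent⇒¬Ind dep)))
    on-gen (inj₂ x∈) = homogeneous (All.lookup hs x∈) (gen (inj₂ x∈))
    left : ∀ {a} → Generated a → ∀ x → P x → P (a · x)
    left gen-𝟏 x p = P-≋ (≋-sym (·-identityˡ x)) p
    left (gen-⊕ {a} {b} g h) x p = P-≋ (≋-sym (·-distribʳ x a b)) (P-⊕ (left g x p) (left h x p))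
    left (gen-⊙ k {a} g) x p = P-≋ (≋-sym (⊙-·ˡ k a x)) (P-⊙ k (left g x p))
    left (gen-· k {a} g) x p = P-≋ (≋-sym (·-assoc (lin k) a x)) (P-lin k (left g x p))
    left (gen-≋ eq g) x p = P-≋ (·-congʳ eq) (left g x p)
    right : ∀ {a} → Generated a → ∀ x → P x → P (x · a)
    right gen-𝟏 x p = P-≋ (≋-sym (·-identityʳ x)) p
    right (gen-⊕ {a} {b} g h) x p = P-≋ (≋-sym (·-distribˡ x a b)) (P-⊕ (right g x p) (right h x p))
    right (gen-⊙ k {a} g) x p = P-≋ (≋-sym (⊙-·ʳ k x a)) (P-⊙ k (right g x p))
    right (gen-· k {a} g) x p = P-≋ (·-assoc x (lin k) a) (right g (x · lin k) (P-lin′ k p))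
    right (gen-≋ eq g) x p = P-≋ (·-congˡ eq) (right g x p)

  -- All elements of the ideal have constant term 0: for a generator `∂e S` this could fail only if
  -- `S` were a singleton, that is, a loop.
  proper : Loopless M → ∀ {vs} → All InE₁ vs → ¬ (∀ x → Ideal vs x)
  proper loopless {vs} hs all = 0≉1 (sym (trans (sym (𝟏-∅ n)) (constant-term (all 𝟏))))
    where
    on-gen : ∀ {x} → Gens vs x → x ∅ ≈ 0#
    on-gen (inj₁ (S , dep , ≡.refl)) = trans (∂e≋ι S ∅) (trans (ι-e (λ _ → 1#) S ∅) (sum-zero lemma))
      where
      lemma : ∀ i → (coef S i * 1#) * e (S ∖ i) ∅ ≈ 0#
      lemma i with i Sub.∈? S
      ... | no  i∉S = trans (*-congʳ (trans (*-congʳ (coef-∉ S i i∉S)) (zeroˡ _))) (zeroˡ _)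
      ... | yes i∈S = trans (*-congˡ (e-off (S ∖ i) ∅ (λ eq → loopless i (≡.subst (Dependent M)
              (≡.trans (≡.sym (∖▹ i∈S)) (≡.trans (≡.cong (_▹ i) eq) (Sub.∪-identityˡ ⁅ i ⁆))) dep)))) (zeroʳ _)
    on-gen (inj₂ x∈) = All.lookup hs x∈ ∅ (λ eq → case ≡.trans (≡.sym (Sub.∣⊥∣≡0 n)) eq of λ ())
    constant-term : ∀ {x} → Ideal vs x → x ∅ ≈ 0#
    constant-term = elim (λ x → x ∅ ≈ 0#) on-gen refl (λ p q → trans (+-cong p q) (+-identityˡ _))
      (λ a {x} p → trans (·-∅ a x) (trans (*-congˡ p) (zeroʳ _)))
      (λ a {x} p → trans (·-∅ x a) (trans (*-congʳ p) (zeroˡ _)))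
      (λ eq p → trans (sym (eq ∅)) p)

-- The basis of monomials without broken circuits.

module BrokenCircuitBasis {c ℓ} (K : Field c ℓ) {n : ℕ} (M : Matroid n) (loopless : Loopless M)
    (pos : Fin n → ℕ) (pos-injective : ∀ {x y} → pos x ≡ pos y → x ≡ y)
    (pos≢0 : ∀ x → pos x ≢ 0) (N : ℕ) (pos≤N : ∀ x → pos x ℕ.≤ N) where
  open Field K hiding (zero)
  open RingSolver commutativeRing
  open ExteriorAlgebra K
  open ExteriorAlgebra.Comparison K using (∂e≋ι)
  open LinearAlgebra K
  open OrlikSolomon K M
  open MatroidTheory M
  open Ordered pos pos-injective pos≢0 N pos≤N
  open Algebra.Properties.AbelianGroup +-abelianGroup using (ε⁻¹≈ε)
  open Algebra.Properties.Semiring.Sum semiring using (sum; sum-cong-≋; ∑-distrib-+; *-distribˡ-sum)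
  open Relation.Binary.Reasoning.Setoid setoid
  open Bases (subspace [])

  J : A n → Set (c ⊔ ℓ)
  J = Ideal []

  -- Termination measure of the rewriting in `monomial-spanned`, which replaces an element by one of
  -- smaller position.
  weight : ∀ {m} → (Fin m → ℕ) → Subset m → ℕ
  weight p []       = 0
  weight p (b ∷ S)  = (if b then p zero else 0) ℕ.+ weight (p ∘ suc) S

  weight-▹ : ∀ {m} (p : Fin m → ℕ) A x → x ∉ A → weight p (A ▹ x) ≡ p x ℕ.+ weight p A
  weight-▹ p (inside  ∷ A) zero     x∉A = contradiction here x∉A
  weight-▹ p (outside ∷ A) zero     x∉A = ≡.cong (λ A → p zero ℕ.+ weight (p ∘ suc) A) (Sub.∪-identityʳ A)
  weight-▹ p (b ∷ A)       (suc x)  x∉A rewrite Boolₚ.∨-identityʳ b | weight-▹ (p ∘ suc) A x (x∉A ∘ there) =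
    ℕ-solve 3 (λ a b c → a :+ₙ (b :+ₙ c) :=ₙ b :+ₙ (a :+ₙ c)) ≡.refl (if b then p zero else 0) (p (suc x)) (weight (p ∘ suc) A)
    where open Data.Nat.Solver.+-*-Solver using () renaming (solve to ℕ-solve; _:=_ to _:=ₙ_; _:+_ to _:+ₙ_)

  weight-∖ : ∀ A x → x ∈ A → pos x ℕ.+ weight pos (A ∖ x) ≡ weight pos A
  weight-∖ A x x∈A = ≡.trans (≡.sym (weight-▹ pos (A ∖ x) x (λ p → ∈∖⁻ A x p ≡.refl))) (≡.cong (weight pos) (∖▹ x∈A))

  indicator : Subset n → Fin n → Carrier
  indicator U j = if lookup U j then 1# else 0#

  indicator-∈ : ∀ U j → j ∈ U → indicator U j ≈ 1#
  indicator-∈ U j j∈U rewrite Vecₚ.[]=⇒lookup j∈U = refl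

  -- A monomial e_S with U = {i} ∪ above (pos i) S dependent is rewritten by means of
  -- ι_U e_{S ∪ i} ∈ J, which replaces an element of S by the smaller element i.
  module _ {m p : ℕ} (y : Fin m → A n) (covers : ∀ S → NBC S → ∣ S ∣ ≡ p → Spanned y (e S)) where

    monomial-spanned : ∀ S → Acc ℕ._<_ (weight pos S) → ∣ S ∣ ≡ p → Spanned y (e S)
    monomial-spanned S (acc rec) ∣S∣≡p with Finₚ.all? (λ i → Ind? (above (pos i) S ▹ i))
    ... | yes nbc = covers S nbc ∣S∣≡p
    ... | no ¬nbc with Ind? S
    ...   | no dep = I⇒Spanned (e∈I dep)
    ...   | yes ind = Spanned-≋ extract (Spanned-⊙ (coef V i) (Spanned-⊕ (I⇒Spanned total∈J) (Spanned-neg (Spanned-sum rest rest-spanned))))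
      where
      broken : ∃ λ i → ¬ Ind (above (pos i) S ▹ i)
      broken = Finₚ.¬∀⟶∃¬ n _ (λ i → Ind? (above (pos i) S ▹ i)) ¬nbc
      i : Fin n
      i = proj₁ broken
      U V : Subset n
      U = above (pos i) S ▹ i
      V = S ▹ i
      i∉S : i ∉ S
      i∉S i∈S = proj₂ broken (Matroid.hereditary M (▹⊆ above⊆ i∈S) ind)
      i∈V : i ∈ V
      i∈V = ∈▹ S i
      total : A n
      total = ι (indicator U) (e V)
      total∈J : J total
      total∈J = ι-e∈I (indicator U) 1# (▹-mono above⊆) (proj₂ broken) (indicator-∈ U)
      term : Fin n → A n
      term j = (coef V j * indicator U j) ⊙ e (V ∖ j)
      -- The factor `1# + - δ i j` removes the term of `i`, so that the sum can still run over all
      -- indices.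
      rest : Fin n → A n
      rest j = (1# + - δ i j) ⊙ term j
      rest-spanned : ∀ j → Spanned y (rest j)
      rest-spanned j with i Fin.≟ j
      ... | yes ≡.refl = I⇒Spanned (I-≋ (λ T → sym (trans (*-congʳ (trans (+-congˡ (-‿cong (δ-diag i))) (-‿inverseʳ 1#))) (zeroˡ _))) I-𝟎)
      ... | no i≢j with j Sub.∈? U
      ...   | no j∉U = I⇒Spanned (I-≋ (λ T → sym (trans (*-congˡ (trans (*-congʳ (trans (*-congˡ indicator≈0) (zeroʳ _))) (zeroˡ _))) (zeroʳ _))) I-𝟎)
        where
        indicator≈0 : indicator U j ≈ 0#
        indicator≈0 with lookup U j in eq
        ... | true   = contradiction (Vecₚ.lookup⇒[]= j U eq) j∉U
        ... | false  = refl
      ...   | yes j∈U with ∈▹⁻ (above (pos i) S) i j∈U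
      ...     | inj₂ j≡i = contradiction (≡.sym j≡i) i≢j
      ...     | inj₁ j∈above = Spanned-⊙ _ (Spanned-⊙ _ (monomial-spanned (V ∖ j) (rec lighter)
                  (≡.trans (ℕₚ.suc-injective (≡.trans (∣∖∣ j∈V) (∣▹∣ S i i∉S))) ∣S∣≡p)))
        where
        j∈V : j ∈ V
        j∈V = ⊆▹ (above⊆ j∈above)
        lighter : weight pos (V ∖ j) ℕ.< weight pos S
        lighter = ℕₚ.+-cancelˡ-< (pos i) _ _ (ℕₚ.<-≤-trans
          (ℕₚ.+-monoˡ-< (weight pos (V ∖ j)) (proj₂ (∈above⁻ j∈above)))
          (ℕₚ.≤-reflexive (≡.trans (weight-∖ V j j∈V) (weight-▹ pos S i i∉S))))
      -- The term of `i` is `e S` up to a sign, and multiplying by the sign once more removes it.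
      extract : coef V i ⊙ (total ⊕ neg (λ T → sum (λ j → rest j T))) ≋ e S
      extract T = begin
        coef V i * (total T + - sum (λ j → rest j T))
          ≈⟨ *-congˡ (+-congʳ (trans (ι-e (indicator U) V T) (trans
               (sum-cong-≋ (λ j → solve 2 (λ d x → x := d :* x :+ (:1 :+ :- d) :* x) refl (δ i j) (term j T)))
               (trans (∑-distrib-+ (λ j → δ i j * term j T) (λ j → rest j T)) (+-congʳ (sum-δ i (λ j → term j T))))))) ⟩
        coef V i * ((term i T + sum (λ j → rest j T)) + - sum (λ j → rest j T))
          ≈⟨ solve 5 (λ c u x s t → c :* (((c :* u) :* x :+ s) :+ :- s) := (c :* c) :* (u :* x)) refl (coef V i) (indicator U i) (e (V ∖ i) T) (sum (λ j → rest j T)) 0# ⟩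
        (coef V i * coef V i) * (indicator U i * e (V ∖ i) T)
          ≈⟨ *-cong (coef² V i i∈V) (*-cong (indicator-∈ U i (∈▹ (above (pos i) S) i)) (reflexive (≡.cong (λ X → e X T) (▹∖ i∉S)))) ⟩
        1# * (1# * e S T)
          ≈⟨ trans (*-identityˡ _) (*-identityˡ _) ⟩
        e S T ∎

  -- On a product of as many linear forms as there are weights this is, up to sign, the determinant
  -- of their pairings.
  Φ : ∀ {m} → List (Fin m → Carrier) → A m → Carrier
  Φ []        x = x ∅
  Φ (d ∷ ds)  x = Φ ds (ι d x)

  Φ-cong : ∀ {m} ds {x y : A m} → x ≋ y → Φ ds x ≈ Φ ds y
  Φ-cong []        p = p ∅
  Φ-cong (d ∷ ds)  p = Φ-cong ds (ι-congʳ p)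

  Φ-⊕ : ∀ {m} ds (x y : A m) → Φ ds (x ⊕ y) ≈ Φ ds x + Φ ds y
  Φ-⊕ []        x y = refl
  Φ-⊕ (d ∷ ds)  x y = trans (Φ-cong ds (ι-⊕ d x y)) (Φ-⊕ ds (ι d x) (ι d y))

  Φ-⊙ : ∀ {m} ds a (x : A m) → Φ ds (a ⊙ x) ≈ a * Φ ds x
  Φ-⊙ []        a x = refl
  Φ-⊙ (d ∷ ds)  a x = trans (Φ-cong ds (ι-⊙ d a x)) (Φ-⊙ ds a (ι d x))

  Φ-𝟎 : ∀ {m} ds → Φ {m} ds 𝟎 ≈ 0#
  Φ-𝟎 []        = refl
  Φ-𝟎 (d ∷ ds)  = trans (Φ-cong ds (ι-𝟎 d)) (Φ-𝟎 ds)

  Φ-comb : ∀ {m k} ds (β : Fin k → Carrier) (y : Fin k → A m) → Φ ds (comb β y) ≈ sum (λ q → β q * Φ ds (y q))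
  Φ-comb {k = zero}   ds β y = Φ-𝟎 ds
  Φ-comb {k = suc k}  ds β y = trans (Φ-⊕ ds (β zero ⊙ y zero) (comb (β ∘ suc) (y ∘ suc)))
    (+-cong (Φ-⊙ ds (β zero) (y zero)) (Φ-comb ds (β ∘ suc) (y ∘ suc)))

  Φ-killed : ∀ {m} ds {d} {x : A m} → d ∈ₗ ds → ι d x ≋ 𝟎 → Φ ds x ≈ 0#
  Φ-killed (d ∷ ds) (here ≡.refl) p = trans (Φ-cong ds p) (Φ-𝟎 ds)
  Φ-killed (d′ ∷ ds) {d} {x} (there d∈) p = Φ-killed ds d∈ (λ S → trans (ι-anticomm d d′ x S)
    (trans (-‿cong (trans (ι-congʳ p S) (ι-𝟎 d′ S))) ε⁻¹≈ε))

  -- The composites for all sublists of `ds` must have constant term 0. The Leibniz rule distributes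
  -- the antiderivations over both factors of a product, so this stronger condition is stable under
  -- multiplication, unlike the vanishing of the full composite.
  Vanishing : List (Fin n → Carrier) → A n → Set ℓ
  Vanishing []        x = x ∅ ≈ 0#
  Vanishing (d ∷ ds)  x = Vanishing ds x × Vanishing ds (ι d x)

  V-≋ : ∀ ds {x y} → x ≋ y → Vanishing ds x → Vanishing ds y
  V-≋ []        eq p        = trans (sym (eq ∅)) p
  V-≋ (d ∷ ds)  eq (p , q)  = V-≋ ds eq p , V-≋ ds (ι-congʳ eq) q

  V-𝟎 : ∀ ds → Vanishing ds 𝟎
  V-𝟎 []        = refl
  V-𝟎 (d ∷ ds)  = V-𝟎 ds , V-≋ ds (≋-sym (ι-𝟎 d)) (V-𝟎 ds)

  V-⊕ : ∀ ds {x y} → Vanishing ds x → Vanishing ds y → Vanishing ds (x ⊕ y)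
  V-⊕ []        p q = trans (+-cong p q) (+-identityˡ _)
  V-⊕ (d ∷ ds) {x} {y} (p , p′) (q , q′) = V-⊕ ds p q , V-≋ ds (≋-sym (ι-⊕ d x y)) (V-⊕ ds p′ q′)

  V-neg : ∀ ds {x} → Vanishing ds x → Vanishing ds (neg x)
  V-neg []        p = trans (-‿cong p) ε⁻¹≈ε
  V-neg (d ∷ ds) {x} (p , q) = V-neg ds p , V-≋ ds (≋-sym (ι-neg d x)) (V-neg ds q)

  V-inv : ∀ ds {x} → Vanishing ds x → Vanishing ds (inv x)
  V-inv [] {x} p = trans (inv-coeff x ∅) (trans (*-congˡ p) (zeroʳ _))
  V-inv (d ∷ ds) {x} (p , q) = V-inv ds p , V-≋ ds (≋-sym (ι-inv d x)) (V-neg ds (V-inv ds q))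

  V-·ˡ : ∀ ds a {x} → Vanishing ds x → Vanishing ds (a · x)
  V-·ˡ []        a {x} p = trans (·-∅ a x) (trans (*-congˡ p) (zeroʳ _))
  V-·ˡ (d ∷ ds)  a {x} (p , q) = V-·ˡ ds a p , V-≋ ds (≋-sym (ι-· d a x)) (V-⊕ ds (V-·ˡ ds (ι d a) p) (V-·ˡ ds (inv a) q))

  V-·ʳ : ∀ ds a {x} → Vanishing ds x → Vanishing ds (x · a)
  V-·ʳ []        a {x} p = trans (·-∅ x a) (trans (*-congʳ p) (zeroˡ _))
  V-·ʳ (d ∷ ds)  a {x} (p , q) = V-·ʳ ds a p , V-≋ ds (≋-sym (ι-· d x a)) (V-⊕ ds (V-·ʳ ds a q) (V-·ʳ ds (ι d a) (V-inv ds p)))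

  Vanishing⇒Φ : ∀ ds {x} → Vanishing ds x → Φ ds x ≈ 0#
  Vanishing⇒Φ []        p = p
  Vanishing⇒Φ (d ∷ ds)  (_ , q) = Vanishing⇒Φ ds q

  ι-lin-vanishing : ∀ (d a : Fin n → Carrier) x → sum (λ i → a i * d i) ≈ 0# → ι d (lin a · x) ≋ lin a · neg (ι d x)
  ι-lin-vanishing d a x p S = trans (ι-lin-· d a x S) (trans (+-congʳ (trans (*-congʳ p) (zeroˡ _)))
    (trans (+-identityˡ _) (sym (neg-·ʳ (lin a) (ι d x) S))))

  -- Each antiderivation kills the linear form and only passes it with a sign; the form survives to
  -- the end, where its constant term is 0.
  V-lin : ∀ ds a x → All (λ d → sum (λ i → a i * d i) ≈ 0#) ds → Vanishing ds (lin a · x)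
  V-lin []        a x []        = trans (·-∅ (lin a) x) (trans (*-congʳ (Hom-lin a ∅ (λ eq → case ≡.trans (≡.sym (Sub.∣⊥∣≡0 n)) eq of λ ()))) (zeroˡ _))
  V-lin (d ∷ ds)  a x (p ∷ ps)  = V-lin ds a x ps , V-≋ ds (≋-sym (ι-lin-vanishing d a x p)) (V-lin ds a (neg (ι d x)) ps)

  members : ∀ {m} → Subset m → List (Fin m)
  members []             = []
  members (inside  ∷ S)  = zero ∷ List.map suc (members S)
  members (outside ∷ S)  = List.map suc (members S)

  ∈⇒∈members : ∀ {m} {S : Subset m} {x} → x ∈ S → x ∈ₗ members S
  ∈⇒∈members {S = inside  ∷ S} here        = here ≡.refl
  ∈⇒∈members {S = inside  ∷ S} (there x∈)  = there (∈ₗₚ.∈-map⁺ suc (∈⇒∈members x∈))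
  ∈⇒∈members {S = outside ∷ S} (there x∈)  = ∈ₗₚ.∈-map⁺ suc (∈⇒∈members x∈)

  private
    Φ-pair : ∀ {m} ds (x : A m) → Φ ds (pair 𝟎 x) ≈ Φ (List.map (_∘ suc) ds) x
    Φ-pair []        x = refl
    Φ-pair (d ∷ ds)  x = trans (Φ-cong ds (λ
      { (inside  ∷ S) → trans (-‿cong (ι-𝟎 (d ∘ suc) S)) ε⁻¹≈ε
      ; (outside ∷ S) → trans (+-congʳ (zeroʳ _)) (+-identityˡ _) })) (Φ-pair ds (ι (d ∘ suc) x))

    map-members : ∀ {m} (D : Fin (suc m) → Fin (suc m) → Carrier) (l : List (Fin m)) →
                  List.map (_∘ suc) (List.map D (List.map suc l)) ≡ List.map (λ s → D (suc s) ∘ suc) l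
    map-members D []       = ≡.refl
    map-members D (s ∷ l)  = ≡.cong (_ ∷_) (map-members D l)

    Φ-suc : ∀ {m} (S : Subset m) (D : Fin (suc m) → Fin (suc m) → Carrier) →
            Φ (List.map D (List.map suc (members S))) (e (outside ∷ S)) ≈ Φ (List.map (λ s → D (suc s) ∘ suc) (members S)) (e S)
    Φ-suc S D = begin
      Φ ds (e (outside ∷ S))              ≈⟨ Φ-cong ds (λ { (inside ∷ T) → refl ; (outside ∷ T) → refl }) ⟩
      Φ ds (pair 𝟎 (e S))                 ≈⟨ Φ-pair ds (e S) ⟩
      Φ (List.map (_∘ suc) ds) (e S)      ≈⟨ reflexive (≡.cong (λ ds → Φ ds (e S)) (map-members D (members S))) ⟩
      Φ (List.map (λ s → D (suc s) ∘ suc) (members S)) (e S) ∎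
      where ds = List.map D (List.map suc (members S))

  -- The generators of `e S` are removed one after the other, each by its own coordinate functional;
  -- only the weights on `S` are seen by `e S`.
  Φ-diagonal : ∀ {m} (S : Subset m) (D : Fin m → Fin m → Carrier) →
               (∀ s t → s ∈ S → t ∈ S → D s t ≈ δ s t) → Φ (List.map D (members S)) (e S) ≈ 1#
  Φ-diagonal [] D p = refl
  Φ-diagonal (outside ∷ S) D p = trans (Φ-suc S D)
    (Φ-diagonal S (λ s → D (suc s) ∘ suc) (λ s t s∈ t∈ → p (suc s) (suc t) (there s∈) (there t∈)))
  Φ-diagonal (inside ∷ S) D p = trans (Φ-cong (List.map D (List.map suc (members S))) {y = e (outside ∷ S)} (λ
      { (inside  ∷ T) → trans (-‿cong (trans (ι-e (D zero ∘ suc) S T) (sum-zero (λ i → trans (*-congʳ (vanish i)) (zeroˡ _))))) ε⁻¹≈ε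
      ; (outside ∷ T) → trans (+-cong (trans (*-congʳ (p zero zero here here)) (*-identityˡ _)) (ι-𝟎 (D zero ∘ suc) T)) (+-identityʳ _) }))
    (trans (Φ-suc S D) (Φ-diagonal S (λ s → D (suc s) ∘ suc) (λ s t s∈ t∈ → p (suc s) (suc t) (there s∈) (there t∈))))
    where
    vanish : ∀ i → coef S i * D zero (suc i) ≈ 0#
    vanish i with i Sub.∈? S
    ... | yes i∈S = trans (*-congˡ (p zero (suc i) here (there i∈S))) (zeroʳ _)
    ... | no  i∉S = trans (*-congʳ (coef-∉ S i i∉S)) (zeroˡ _)

  -- The functional attached to a set S without broken circuits: it is the residue along
  -- the flag spanned by S, and the functionals so obtained are dual to the monomials e_S modulo J.
  module Residue (S : Subset n) (nbcS : NBC S) where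
    open Levels loopless S

    D : Fin n → Fin n → Carrier
    D s t = if level t ≡ᵇ pos s then 1# else 0#

    D-hit : ∀ {s t} → level t ≡ pos s → D s t ≈ 1#
    D-hit eq rewrite ≡ᵇ-true eq = refl

    D-miss : ∀ {s t} → level t ≢ pos s → D s t ≈ 0#
    D-miss neq rewrite ≡ᵇ-false neq = refl

    φ : A n → Carrier
    φ = Φ (List.map D (members S))

    φ-diagonal : φ (e S) ≈ 1#
    φ-diagonal = Φ-diagonal S D λ s t s∈S t∈S → case s Fin.≟ t of λ
      { (yes ≡.refl) → trans (D-hit (level-∈ nbcS s∈S)) (sym (δ-diag s))
      ; (no s≢t) → trans (D-miss (λ eq → s≢t (pos-injective (≡.trans (≡.sym eq) (level-∈ nbcS t∈S))))) (sym (δ-off s t s≢t)) }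

    -- By `level-missed` the weights `D s` of the largest missing `s` vanish on `T`.
    -- Anticommutativity lets this factor act first, wherever it stands in the composite.
    φ-off : ∀ {T} → NBC T → ∀ {s} → s ∈ S → s ∉ T → φ (e T) ≈ 0#
    φ-off {T} nbcT s∈S s∉T = let (s , s∈S , s∉T , above⊆T) = greatest-missing s∈S s∉T in
      Φ-killed (List.map D (members S)) (∈ₗₚ.∈-map⁺ D (∈⇒∈members s∈S))
        (≋-trans (ι-e-cong T (λ t t∈T → D-miss (level-missed nbcS nbcT s∉T above⊆T t∈T)))
                 (λ U → trans (ι-e (λ _ → 0#) T U) (sum-zero (λ i → trans (*-congʳ (zeroʳ (coef T i))) (zeroˡ _)))))

    -- Two elements t and t′ of equal level in a dependent set make e_t - e_t′ a factor of its
    -- monomial, and this linear form is killed by ∂ and by every `D s`.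
    φ-J : ∀ {x} → J x → φ x ≈ 0#
    φ-J {x} p = Vanishing⇒Φ ds (elim (Vanishing ds) on-gen (V-𝟎 ds) (V-⊕ ds) (V-·ˡ ds) (V-·ʳ ds) (V-≋ ds) p)
      where
      ds : List (Fin n → Carrier)
      ds = List.map D (members S)
      on-gen : ∀ {x} → Gens [] x → Vanishing ds x
      on-gen (inj₁ (S′ , dep , ≡.refl)) =
        let (t , t′ , t∈ , t′∈ , t≢t′ , same) = dependent⇒equal-levels (Dependent⇒¬Ind dep)
            a = λ i → δ t i + - δ t′ i
            balanced : ∀ d → d t ≈ d t′ → sum (λ i → a i * d i) ≈ 0#
            balanced d eq = trans (sum-cong-≋ (λ i → solve 3 (λ x y d → (x :+ :- y) :* d := x :* d :+ (:- :1) :* (y :* d)) refl (δ t i) (δ t′ i) (d i)))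
              (trans (∑-distrib-+ (λ i → δ t i * d i) (λ i → - 1# * (δ t′ i * d i)))
                (trans (+-cong (trans (sum-δ t d) eq) (trans (sym (*-distribˡ-sum (- 1#) (λ i → δ t′ i * d i))) (*-congˡ (sum-δ t′ d))))
                  (solve 1 (λ x → x :+ (:- :1) :* x := :0) refl _)))
            z = ι (δ t) (e S′)
        in V-≋ ds (≋-sym (≋-trans (∂e≋ι S′) (≋-trans (ι-congʳ (e-difference S′ t∈ t′∈ t≢t′))
                    (ι-lin-vanishing (λ _ → 1#) a z (balanced (λ _ → 1#) refl)))))
             (V-lin ds a (neg (ι (λ _ → 1#) z)) (Allₚ.map⁺ (All.tabulate λ {s} _ →
               balanced (D s) (reflexive (≡.cong (λ l → if l ≡ᵇ pos s then 1# else 0#) same)))))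

  module _ (L : List (Subset n)) (L-unique : Unique L) (L-complete : ∀ {S} → NBC S → S ∈ₗ L) (L-sound : ∀ {S} → S ∈ₗ L → NBC S) where

    ofSize : ℕ → List (Subset n)
    ofSize p = List.filter (λ S → ∣ S ∣ ℕ.≟ p) L

    nbc-basis : ∀ p → Basis p (length (ofSize p))
    nbc-basis p = record
      { element      = y
      ; homogeneous  = λ q → ≡.subst (λ p → Hom p (y q)) (size q) (Hom-e (T q))
      ; independent  = λ β i q ¬0 → ¬0 (begin
          β q
            ≈⟨ sum-single β q ⟨
          sum (λ q′ → β q′ * Residue.φ (T q) (nbc q) (y q′))
            ≈⟨ Φ-comb (List.map (Residue.D (T q) (nbc q)) (members (T q))) β y ⟨
          Residue.φ (T q) (nbc q) (comb β y)
            ≈⟨ Residue.φ-J (T q) (nbc q) i ⟩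
          0# ∎)
      ; spanning     = Spanned-from-monomials p λ S ∣S∣≡p → monomial-spanned y covers S (<-wellFounded _) ∣S∣≡p }
      where
      Lₚ : List (Subset n)
      Lₚ = ofSize p
      T : Fin (length Lₚ) → Subset n
      T = List.lookup Lₚ
      y : Fin (length Lₚ) → A n
      y q = e (T q)
      T∈ : ∀ q → T q ∈ₗ L × ∣ T q ∣ ≡ p
      T∈ q = ∈ₗₚ.∈-filter⁻ (λ S → ∣ S ∣ ℕ.≟ p) {xs = L} (∈ₗₚ.∈-lookup {xs = Lₚ} q)
      size : ∀ q → ∣ T q ∣ ≡ p
      size q = proj₂ (T∈ q)
      nbc : ∀ q → NBC (T q)
      nbc q = L-sound (proj₁ (T∈ q))
      covers : ∀ S → NBC S → ∣ S ∣ ≡ p → Spanned y (e S)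
      covers S nbcS eq = let S∈ = ∈ₗₚ.∈-filter⁺ (λ S → ∣ S ∣ ℕ.≟ p) (L-complete nbcS) eq in
        ≡.subst (λ S → Spanned y (e S)) (≡.sym (Anyₚ.lookup-index S∈)) (Spanned-element y (Any.index S∈))
      unique : ∀ q q′ → T q ≡ T q′ → q ≡ q′
      unique = unique-lookup-injective (Uniqueₚ.filter⁺ (λ S → ∣ S ∣ ℕ.≟ p) L-unique)
      φ-δ : ∀ q q′ → Residue.φ (T q) (nbc q) (y q′) ≈ δ q q′
      φ-δ q q′ with q Fin.≟ q′
      ... | yes ≡.refl = trans (Residue.φ-diagonal (T q) (nbc q)) (sym (δ-diag q))
      -- Distinct sets of equal size are not contained in each other, so `φ-off` always applies.
      ... | no q≢q′ with Finₚ.any? (λ s → (s Sub.∈? T q) ×-dec ¬? (s Sub.∈? T q′))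
      ...   | yes (s , s∈ , s∉) = trans (Residue.φ-off (T q) (nbc q) (nbc q′) s∈ s∉) (sym (δ-off q q′ q≢q′))
      ...   | no none = contradiction (unique q q′ (⊆∧∣∣≤⇒≡ (λ {s} s∈ → decidable-stable (s Sub.∈? T q′) (λ s∉ → none (s , s∈ , s∉)))
                (ℕₚ.≤-reflexive (≡.trans (size q′) (≡.sym (size q)))))) q≢q′
      sum-single : ∀ β q → sum (λ q′ → β q′ * Residue.φ (T q) (nbc q) (y q′)) ≈ β q
      sum-single β q = trans (sum-cong-≋ (λ q′ → trans (*-congˡ (φ-δ q q′)) (*-comm (β q′) (δ q q′)))) (sum-δ q β)

-- Hilbert series and divisibility by powers of 1 + t.

module HilbertSeries where
  open Taylor

  1+t· : (ℕ → ℕ) → ℕ → ℕ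
  1+t· h zero     = h zero
  1+t· h (suc p)  = h (suc p) ℕ.+ h p

  [1+t]^_·_ : ℕ → (ℕ → ℕ) → ℕ → ℕ
  [1+t]^ zero ·   h = h
  [1+t]^ suc s ·  h = 1+t· ([1+t]^ s · h)

  -- The Taylor coefficients at t = −1 of the polynomial with coefficients h p for p < N.
  series : ℕ → (ℕ → ℕ) → ℕ → ℤ
  series zero     h m = 0ℤ
  series (suc N)  h m = series N h m ℤ.+ ℤ.+ h N ℤ.* w N m

  series-cong : ∀ N {h h′} → (∀ p → h p ≡ h′ p) → ∀ m → series N h m ≡ series N h′ m
  series-cong zero     eq m = ≡.refl
  series-cong (suc N)  eq m = ≡.cong₂ ℤ._+_ (series-cong N eq m) (≡.cong (λ x → ℤ.+ x ℤ.* w N m) (eq N))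

  series-0 : ∀ N m → series N (λ _ → 0) m ≡ 0ℤ
  series-0 zero     m = ≡.refl
  series-0 (suc N)  m = ≡.trans (≡.cong (ℤ._+ 0ℤ ℤ.* w N m) (series-0 N m)) (≡.trans (ℤₚ.+-identityˡ (0ℤ ℤ.* w N m)) (ℤₚ.*-zeroˡ (w N m)))

  series-+ : ∀ N h h′ m → series N (λ p → h p ℕ.+ h′ p) m ≡ series N h m ℤ.+ series N h′ m
  series-+ zero     h h′ m = ≡.refl
  series-+ (suc N)  h h′ m rewrite series-+ N h h′ m | ℤₚ.pos-+ (h N) (h′ N) =
    solve 5 (λ s t a b w → (s :+ t) :+ (a :+ b) :* w := (s :+ a :* w) :+ (t :+ b :* w)) ≡.refl
      (series N h m) (series N h′ m) (ℤ.+ h N) (ℤ.+ h′ N) (w N m)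
    where open Data.Integer.Solver.+-*-Solver

  series-single : ∀ N k m → k ℕ.< N → series N (λ p → if k ≡ᵇ p then 1 else 0) m ≡ w k m
  series-single (suc N) k m k<N with k ℕ.≟ N
  ... | no k≢N rewrite series-single N k m (ℕₚ.≤∧≢⇒< (ℕₚ.≤-pred k<N) k≢N) | ≡ᵇ-false k≢N =
        ≡.trans (≡.cong (λ x → w k m ℤ.+ x) (ℤₚ.*-zeroˡ (w N m))) (ℤₚ.+-identityʳ (w k m))
  ... | yes ≡.refl rewrite ≡ᵇ-true {k} ≡.refl = ≡.trans (≡.cong₂ ℤ._+_ (below N ℕₚ.≤-refl) (ℤₚ.*-identityˡ (w k m))) (ℤₚ.+-identityˡ (w k m))
    where
    below : ∀ N → N ℕ.≤ k → series N (λ p → if k ≡ᵇ p then 1 else 0) m ≡ 0ℤ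
    below zero     le = ≡.refl
    below (suc N)  le rewrite below N (ℕₚ.<⇒≤ le) | ≡ᵇ-false (ℕₚ.>⇒≢ le) = ≡.trans (ℤₚ.+-identityˡ (0ℤ ℤ.* w N m)) (ℤₚ.*-zeroˡ (w N m))

  count : ∀ {n} → List (Subset n) → ℕ → ℕ
  count L p = length (List.filter (λ S → ∣ S ∣ ℕ.≟ p) L)

  count-∷ : ∀ {n} (T : Subset n) L p → count (T ∷ L) p ≡ (if ∣ T ∣ ≡ᵇ p then 1 else 0) ℕ.+ count L p
  count-∷ T L p with ∣ T ∣ ≡ᵇ p
  ... | true   = ≡.refl
  ... | false  = ≡.refl

  taylor≡series : ∀ {n} N (L : List (Subset n)) m → n ℕ.< N → taylor L m ≡ series N (count L) m
  taylor≡series N []       m n<N = ≡.sym (series-0 N m)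
  taylor≡series N (T ∷ L)  m n<N = ≡.trans
    (≡.cong₂ ℤ._+_ (≡.sym (series-single N ∣ T ∣ m (ℕₚ.≤-<-trans (Sub.∣p∣≤n T) n<N))) (taylor≡series N L m n<N))
    (≡.trans (≡.sym (series-+ N (λ p → if ∣ T ∣ ≡ᵇ p then 1 else 0) (count L) m)) (series-cong N (λ p → ≡.sym (count-∷ T L p)) m))

  private
    -- Truncation disturbs the multiplication by 1 + t only at the top: up to degree N the product
    -- is x times the part of h below N, plus the single term h(N) t ^ N.
    series-1+t-zero : ∀ N h → series (suc N) (1+t· h) 0 ≡ ℤ.+ h N ℤ.* w N 0
    series-1+t-zero zero     h = ℤₚ.+-identityˡ (ℤ.+ h 0 ℤ.* w 0 0)
    series-1+t-zero (suc N)  h rewrite series-1+t-zero N h | ℤₚ.pos-+ (h (suc N)) (h N) =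
      solve 3 (λ a b w → b :* w :+ (a :+ b) :* (:- w) := a :* (:- w)) ≡.refl (ℤ.+ h (suc N)) (ℤ.+ h N) (w N 0)
      where open Data.Integer.Solver.+-*-Solver

    series-1+t-suc : ∀ N h m → series (suc N) (1+t· h) (suc m) ≡ series N h m ℤ.+ ℤ.+ h N ℤ.* w N (suc m)
    series-1+t-suc zero     h m = ≡.refl
    series-1+t-suc (suc N)  h m rewrite series-1+t-suc N h m | ℤₚ.pos-+ (h (suc N)) (h N) =
      solve 5 (λ s a b x y → (s :+ b :* y) :+ (a :+ b) :* (x :- y) := (s :+ b :* x) :+ a :* (x :- y)) ≡.refl
        (series N h m) (ℤ.+ h (suc N)) (ℤ.+ h N) (w N m) (w N (suc m))
      where open Data.Integer.Solver.+-*-Solver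

    [1+t]-support : ∀ s {N h} → (∀ p → N ℕ.≤ p → h p ≡ 0) → ∀ p → N ℕ.+ s ℕ.≤ p → ([1+t]^ s · h) p ≡ 0
    [1+t]-support zero     {N} z p le = z p (≡.subst (ℕ._≤ p) (ℕₚ.+-identityʳ N) le)
    [1+t]-support (suc s)  {N} z zero le = contradiction (≡.subst (ℕ._≤ 0) (ℕₚ.+-suc N s) le) λ ()
    [1+t]-support (suc s)  {N} z (suc p) le = ≡.cong₂ ℕ._+_
      ([1+t]-support s z (suc p) (ℕₚ.≤-trans (ℕₚ.+-monoʳ-≤ N (ℕₚ.n≤1+n s)) le))
      ([1+t]-support s z p (ℕₚ.≤-pred (≡.subst (ℕ._≤ suc p) (ℕₚ.+-suc N s) le)))

  -- Each factor 1 + t shifts the Taylor coefficients by one; it also raises the degree by one,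
  -- hence the truncation at `N ℕ.+ s`.
  [1+t]-vanishing : ∀ s {N h} → (∀ p → N ℕ.≤ p → h p ≡ 0) → ∀ m → m ℕ.< s → series (N ℕ.+ s) ([1+t]^ s · h) m ≡ 0ℤ
  [1+t]-vanishing (suc s) {N} {h} z m lt rewrite ℕₚ.+-suc N s = go m lt
    where
    top : ([1+t]^ s · h) (N ℕ.+ s) ≡ 0
    top = [1+t]-support s z (N ℕ.+ s) ℕₚ.≤-refl
    go : ∀ m → m ℕ.< suc s → series (suc (N ℕ.+ s)) (1+t· ([1+t]^ s · h)) m ≡ 0ℤ
    go zero     lt = ≡.trans (series-1+t-zero (N ℕ.+ s) ([1+t]^ s · h))
      (≡.trans (≡.cong (λ x → ℤ.+ x ℤ.* w (N ℕ.+ s) 0) top) (ℤₚ.*-zeroˡ (w (N ℕ.+ s) 0)))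
    go (suc m)  lt = ≡.trans (series-1+t-suc (N ℕ.+ s) ([1+t]^ s · h) m)
      (≡.cong₂ ℤ._+_ ([1+t]-vanishing s z m (ℕₚ.≤-pred lt))
        (≡.trans (≡.cong (λ x → ℤ.+ x ℤ.* w (N ℕ.+ s) (suc m)) top) (ℤₚ.*-zeroˡ (w (N ℕ.+ s) (suc m)))))

-- Positions in a list.

module Positions {n : ℕ} where

  -- Counted from the end, so that positions do not change when a list without repetitions grows at
  -- the head; 0 means absence.
  position : List (Fin n) → Fin n → ℕ
  position []       x = 0
  position (i ∷ l)  x = if does (x Fin.≟ i) then suc (length l) else position l x

  position-≤ : ∀ l x → position l x ℕ.≤ length l
  position-≤ []       x = z≤n
  position-≤ (i ∷ l)  x with x Fin.≟ i
  ... | yes _ = ℕₚ.≤-refl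
  ... | no  _ = ℕₚ.m≤n⇒m≤1+n (position-≤ l x)

  position≢0 : ∀ {l x} → x ∈ₗ l → position l x ≢ 0
  position≢0 {i ∷ l} {x} x∈ eq with x Fin.≟ i
  ... | no x≢i with x∈
  ...   | here x≡i = x≢i x≡i
  ...   | there x∈l = position≢0 x∈l eq

  position-injective : ∀ {l x y} → x ∈ₗ l → y ∈ₗ l → position l x ≡ position l y → x ≡ y
  position-injective {i ∷ l} {x} {y} x∈ y∈ eq with x Fin.≟ i | y Fin.≟ i
  ... | yes ≡.refl | yes ≡.refl = ≡.refl
  ... | yes _ | no _ = contradiction (≡.subst (ℕ._≤ length l) (≡.sym eq) (position-≤ l y)) (ℕₚ.<⇒≱ ℕₚ.≤-refl)
  ... | no _ | yes _ = contradiction (≡.subst (ℕ._≤ length l) eq (position-≤ l x)) (ℕₚ.<⇒≱ ℕₚ.≤-refl)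
  ... | no x≢i | no y≢i with x∈ | y∈
  ...   | here x≡i | _ = contradiction x≡i x≢i
  ...   | there _ | here y≡i = contradiction y≡i y≢i
  ...   | there x∈l | there y∈l = position-injective x∈l y∈l eq

  position-head : ∀ i l → position (i ∷ l) i ≡ suc (length l)
  position-head i l with i Fin.≟ i
  ... | yes _ = ≡.refl
  ... | no i≢i = contradiction ≡.refl i≢i

  position-tail : ∀ {i x} l → x ≢ i → position (i ∷ l) x ≡ position l x
  position-tail {i} {x} l x≢i with x Fin.≟ i
  ... | yes x≡i = contradiction x≡i x≢i
  ... | no _ = ≡.refl

-- Regular sequences have at most k elements.

module UpperBound {c ℓ} (K : Field c ℓ) {n : ℕ} (M : Matroid n) (loopless : Loopless M) {k : ℕ} (components : HasComponents M k) where
  open ExteriorAlgebra K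
  open ExteriorAlgebra.Comparison K using (∧E≋·)
  open LinearAlgebra K
  open OrlikSolomon K M
  open MatroidTheory M
  open DoubleNegation
  open Taylor
  open HilbertSeries
  open Positions
  open DecisionTree M using (tree; tree-unique)
  open Growth M loopless components using (grow; Grown-unique; Lowest-Grown)
  open Exterior K n using (InE₁; gen; resp)
  open Field K using (+-congˡ; -‿cong)

  RegFrom : List (A n) → List (A n) → Set (c ⊔ ℓ)
  RegFrom = Exterior.RegFrom K n M

  private module _ (vs : List (A n)) where
    open Bases (subspace vs) public using () renaming (Basis to BasisMod)

  -- `h` is the Hilbert function of the quotient by the whole sequence. It is found at the end of
  -- the recursion, and on the way back each regular element contributes a factor 1 + t through
  -- `BasisStep`.
  hilbert : ∀ {vs} → All InE₁ vs → ∀ ws → RegFrom vs ws →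
            ¬ ¬ ∃ λ h → (∀ p → suc n ℕ.≤ p → h p ≡ 0) × (∀ p → BasisMod vs p (([1+t]^ length ws · h) p))
  hilbert {vs} hs [] _ = ¬¬-∀ {n = suc n} (λ i → Bases.basis-exists (subspace vs) (toℕ i)) >>= λ bases →
    let total : ∀ p → ∃ λ m → (suc n ℕ.≤ p → m ≡ 0) × BasisMod vs p m
        total p = case p ℕ.<? suc n of λ
          { (yes lt) → let (m , b) = bases (Fin.fromℕ< lt) in m , (λ ge → contradiction lt (ℕₚ.≤⇒≯ ge)) ,
              ≡.subst (λ p → BasisMod vs p m) (Finₚ.toℕ-fromℕ< lt) b
          ; (no ≮) → 0 , (λ _ → ≡.refl) , Bases.basis-empty (subspace vs) p (ℕₚ.≮⇒≥ ≮) }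
    in return ((λ p → proj₁ (total p)) , (λ p → proj₁ (proj₂ (total p))) , (λ p → proj₂ (proj₂ (total p))))
  hilbert {vs} hs (v ∷ ws) (hv , reg , rest) = hilbert (Allₚ.++⁺ hs (hv ∷ [])) ws rest >>= λ { (h , support , bases) →
      return (h , support , λ { zero → step-zero (bases zero) ; (suc p) → step-suc (bases (suc p)) (bases p) }) }
    where
    v≋ : v ≋ lin (λ i → v ⁅ i ⁆)
    v≋ = Hom₁⇒lin hv
    exact : ∀ {x} → Ideal vs (lin (λ i → v ⁅ i ⁆) · x) → ∃ λ y → Ideal vs (x ⊕ neg (lin (λ i → v ⁅ i ⁆) · y))
    exact {x} p = let (y , q) = proj₁ (reg x) (resp (≋-trans (·-congʳ (≋-sym v≋)) (≋-sym (∧E≋· v x))) p) in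
      y , resp (λ S → +-congˡ (-‿cong (≋-trans (∧E≋· v y) (·-congʳ v≋) S))) q
    open BasisStep (subspace vs) (subspace (vs ++ [ v ])) (λ i → v ⁅ i ⁆)
      (Ideal-mono ∈ₗₚ.∈-++⁺ˡ)
      (λ x → resp (·-congʳ v≋) (I-·ʳ {vs ++ [ v ]} x (gen (inj₂ (∈ₗₚ.∈-++⁺ʳ vs (here ≡.refl))))))
      (I-·ˡ (lin (λ i → v ⁅ i ⁆)))
      (adjoin⇒ hv)
      exact
      (I-π hs)

  -- In each degree the two bases have the same size, so the polynomial of the tree vanishes at x =
  -- 0 to the order `length vs`, while `Lowest-Grown` allows at most `k`.
  length-≤ : ∀ vs → Exterior.IsRegular K n M vs → length vs ℕ.≤ k
  length-≤ vs reg = decidable-stable (length vs ℕ.≤? k) (λ ≰k → hilbert [] vs reg λ { (h , support , bases) →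
      bound h support bases ≰k })
    where
    l : List (Fin n)
    l = proj₁ grow
    l-grown = proj₁ (proj₂ grow)
    l-all = proj₂ (proj₂ grow)
    l-unique : Unique l
    l-unique = Grown-unique l-grown
    pos : Fin n → ℕ
    pos = position l
    pos-injective : ∀ {x y} → pos x ≡ pos y → x ≡ y
    pos-injective {x} {y} = position-injective (l-all x) (l-all y)
    pos≢0 : ∀ x → pos x ≢ 0
    pos≢0 x = position≢0 (l-all x)
    open Ordered pos pos-injective pos≢0 (length l) (position-≤ l)
    open BrokenCircuitTree M pos pos-injective pos≢0 (length l) (position-≤ l)
    ranked : Ranked l
    ranked = go l l-unique (λ _ → ≡.refl)
      where
      go : ∀ l′ → Unique l′ → (∀ {x} → x ∈ₗ l′ → pos x ≡ position l′ x) → Ranked l′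
      go []        u eq = tt
      go (i ∷ l′)  (i∉ ∷ u) eq = ≡.trans (eq (here ≡.refl)) (position-head i l′) ,
        go l′ u (λ x∈ → ≡.trans (eq (there x∈)) (position-tail l′ (λ { ≡.refl → All.lookup i∉ x∈ ≡.refl })))
    L : List (Subset n)
    L = tree ∅ l
    open BrokenCircuitBasis K M loopless pos pos-injective pos≢0 (length l) (position-≤ l) using (nbc-basis)
    basisJ : ∀ p → BasisMod [] p (count L p)
    basisJ = nbc-basis L (tree-unique l (l-unique , λ _ → Sub.∉⊥))
      (λ {S} nbc → NBC⇒∈tree nbc l ranked (Sub.Empty-unique λ (x , x∈) → ℕₚ.<⇒≱ (proj₂ (∈above⁻ x∈)) (position-≤ l x)))
      (λ {S} S∈ i → proj₂ (∈tree⇒NBC l ranked (λ x∈∅ → contradiction x∈∅ Sub.∉⊥) S∈) (l-all i))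
    bound : ∀ h → (∀ p → suc n ℕ.≤ p → h p ≡ 0) → (∀ p → BasisMod [] p (([1+t]^ length vs · h) p)) → ¬ ¬ (length vs ℕ.≤ k)
    bound h support bases ≰k =
      let (j , j≤k , low) = Lowest-Grown l-grown (λ x∈∅ → contradiction x∈∅ Sub.∉⊥) (λ {x} _ → inj₂ (l-all x)) (λ _ → Sub.∉⊥)
          same = λ p → ℕₚ.≤-antisym (Bases.basis-≤ (subspace []) (basisJ p) (bases p)) (Bases.basis-≤ (subspace []) (bases p) (basisJ p))
          -- Beyond every degree in which the leaves or the product with (1 + t) ^ s can contribute.
          N = suc n ℕ.+ length vs
          taylor≡0 : taylor L j ≡ 0ℤ
          taylor≡0 = ≡.trans (taylor≡series N L j (ℕₚ.m≤m+n (suc n) (length vs)))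
            (≡.trans (series-cong N same j) ([1+t]-vanishing (length vs) support j (ℕₚ.≤-<-trans j≤k (ℕₚ.≰⇒> ≰k))))
          rank = r (DecisionTree.ground M ∅ l)
      in ℤₚ.<-irrefl ≡.refl (≡.subst (0ℤ ℤ.<_) (≡.trans (≡.cong (sg (rank ℕ.+ j)) taylor≡0) (sg-0 (rank ℕ.+ j))) (Lowest.sign low))

-- Construction and extension of regular sequences.

module RegularSequences {c ℓ} (K : Field c ℓ) {n : ℕ} (M : Matroid n) (loopless : Loopless M) {k : ℕ} (components : HasComponents M k) where
  open Field K hiding (zero)
  open RingSolver commutativeRing
  open ExteriorAlgebra K
  open LinearAlgebra K
  open OrlikSolomon K M
  open DoubleNegation
  open Growth M loopless components using (component; circuit⇒component; root; component-root)
  open UpperBound K M loopless components using (RegFrom; length-≤)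
  open Exterior K n using (InE₁)
  open Algebra.Properties.Semiring.Sum semiring using (sum; sum-cong-≋; ∑-comm; *-distribˡ-sum; *-distribʳ-sum)
  open Relation.Binary.Reasoning.Setoid setoid

  private
    lin-coeff : ∀ {m} (a : Fin m → Carrier) i → lin a ⁅ i ⁆ ≈ a i
    lin-coeff {suc m} a zero     = trans (*-congˡ (𝟏-∅ m)) (*-identityʳ _)
    lin-coeff {suc m} a (suc i)  = lin-coeff (a ∘ suc) i

    RegFrom⇒InE₁ : ∀ vs ws → RegFrom vs ws → All InE₁ ws
    RegFrom⇒InE₁ vs []        _              = []
    RegFrom⇒InE₁ vs (v ∷ ws)  (hv , _ , reg)  = hv ∷ RegFrom⇒InE₁ (vs ++ [ v ]) ws reg

    RegFrom-snoc : ∀ vs ws {v} → InE₁ v → Exterior.RegularOn K n M (Ideal (vs ++ ws)) v → RegFrom (vs ++ ws ++ [ v ]) [] →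
                   RegFrom vs ws → RegFrom vs (ws ++ [ v ])
    RegFrom-snoc vs [] {v} hv reg proper _ =
      hv , ≡.subst (λ us → Exterior.RegularOn K n M (Ideal us) v) (Listₚ.++-identityʳ vs) reg , proper
    RegFrom-snoc vs (w ∷ ws) {v} hv reg proper (hw , reg-w , rest) = hw , reg-w ,
      RegFrom-snoc (vs ++ [ w ]) ws hv
        (≡.subst (λ us → Exterior.RegularOn K n M (Ideal us) v) (≡.sym (Listₚ.++-assoc vs [ w ] ws)) reg)
        (≡.subst (λ us → RegFrom us []) (≡.sym (Listₚ.++-assoc vs [ w ] (ws ++ [ v ]))) proper) rest

  root-form : Fin k → A n
  root-form c = lin (δ (root c))

  root-form-pairing : ∀ c (d : Fin n → Carrier) → sum (λ i → root-form c ⁅ i ⁆ * d i) ≈ d (root c)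
  root-form-pairing c d = trans (sum-cong-≋ (λ i → *-congʳ (lin-coeff (δ (root c)) i))) (sum-δ (root c) d)

  root-forms-regular : ∀ cs cs′ → (∀ {c c′} → c ∈ₗ cs → c′ ∈ₗ cs′ → c ≢ c′) → Unique cs′ →
                       RegFrom (List.map root-form cs) (List.map root-form cs′)
  root-forms-regular cs [] _ _ = proper loopless (Allₚ.map⁺ (All.tabulate λ {c} _ → Hom-lin (δ (root c))))
  root-forms-regular cs (c′ ∷ cs′) disjoint (c′∉ ∷ unique) = Hom-lin (δ (root c′)) ,
      regular d (λ circ i∈ j∈ → reflexive (≡.cong (δ c′) (circuit⇒component circ i∈ j∈)))
        (Allₚ.map⁺ (All.tabulate λ {c} _ → Hom-lin (δ (root c)))) zeros (Hom-lin (δ (root c′)))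
        (trans (root-form-pairing c′ d) (trans (reflexive (≡.cong (δ c′) (component-root c′))) (δ-diag c′))) ,
      ≡.subst (λ us → RegFrom us (List.map root-form cs′)) (Listₚ.map-++ root-form cs [ c′ ])
        (root-forms-regular (cs ++ [ c′ ]) cs′ disjoint′ unique)
    where
    -- The indicator of the component `c′`: it is 1 at the root of `c′` and 0 at the roots already
    -- used.
    d : Fin n → Carrier
    d i = δ c′ (component i)
    zeros : ∀ {v} → v ∈ₗ List.map root-form cs → sum (λ i → v ⁅ i ⁆ * d i) ≈ 0#
    zeros v∈ with ∈ₗₚ.∈-map⁻ root-form v∈
    ... | c , c∈ , ≡.refl = trans (root-form-pairing c d) (trans (reflexive (≡.cong (δ c′) (component-root c)))
            (δ-off c′ c (disjoint c∈ (here ≡.refl) ∘ ≡.sym)))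
    disjoint′ : ∀ {c c″} → c ∈ₗ cs ++ [ c′ ] → c″ ∈ₗ cs′ → c ≢ c″
    disjoint′ c∈ c″∈ with ∈ₗₚ.∈-++⁻ cs c∈
    ... | inj₁ c∈cs = disjoint c∈cs (there c″∈)
    ... | inj₂ (here ≡.refl) = All.lookup c′∉ c″∈

  -- Fewer than k linear forms are annihilated by a non-zero antiderivation with weights that are
  -- constant on components; a suitable root form is then regular modulo them.
  extendable : ∀ vs → Exterior.IsRegular K n M vs → length vs ℕ.< k → ¬ ¬ ∃ λ v → Exterior.IsRegular K n M (vs ++ [ v ])
  extendable vs reg lt = kernel lt (λ j c → sum (λ i → List.lookup vs j ⁅ i ⁆ * δ (component i) c)) >>= λ
    { (β , (c₀ , nz) , eqs) → let (a , βa≈1) = inverse (β c₀) nz in return (root-form c₀ , extension β c₀ a βa≈1 eqs) }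
    where
    hs : All InE₁ vs
    hs = RegFrom⇒InE₁ [] vs reg
    extension : ∀ β c₀ a → β c₀ * a ≈ 1# →
                (∀ j → sum (λ c → sum (λ i → List.lookup vs j ⁅ i ⁆ * δ (component i) c) * β c) ≈ 0#) →
                Exterior.IsRegular K n M (vs ++ [ root-form c₀ ])
    extension β c₀ a βa≈1 eqs = RegFrom-snoc [] vs (Hom-lin (δ (root c₀)))
        (regular d (λ circ i∈ j∈ → reflexive (≡.cong (λ c → a * β c) (circuit⇒component circ i∈ j∈))) hs zeros (Hom-lin (δ (root c₀)))
          (trans (root-form-pairing c₀ d) (trans (reflexive (≡.cong (λ c → a * β c) (component-root c₀))) (trans (*-comm a (β c₀)) βa≈1))))
        (proper loopless (Allₚ.++⁺ hs (Hom-lin (δ (root c₀)) ∷ []))) reg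
      where
      -- Scaled by the inverse of `β c₀`, so that the pairing with the root form of `c₀` is 1.
      d : Fin n → Carrier
      d i = a * β (component i)
      zeros : ∀ {v} → v ∈ₗ vs → sum (λ i → v ⁅ i ⁆ * d i) ≈ 0#
      zeros {v} v∈ = begin
        sum (λ i → v ⁅ i ⁆ * (a * β (component i)))
          ≈⟨ sum-cong-≋ (λ i → solve 3 (λ v a b → v :* (a :* b) := a :* (v :* b)) refl (v ⁅ i ⁆) a (β (component i))) ⟩
        sum (λ i → a * (v ⁅ i ⁆ * β (component i)))
          ≈⟨ *-distribˡ-sum a (λ i → v ⁅ i ⁆ * β (component i)) ⟨
        -- The sum over elements is regrouped by components, which brings it into the form of the
        -- kernel equations.
        a * sum (λ i → v ⁅ i ⁆ * β (component i))
          ≈⟨ *-congˡ (sum-cong-≋ (λ i → *-congˡ (sum-δ (component i) β))) ⟨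
        a * sum (λ i → v ⁅ i ⁆ * sum (λ c → δ (component i) c * β c))
          ≈⟨ *-congˡ (sum-cong-≋ (λ i → *-distribˡ-sum (v ⁅ i ⁆) (λ c → δ (component i) c * β c))) ⟩
        a * sum (λ i → sum (λ c → v ⁅ i ⁆ * (δ (component i) c * β c)))
          ≈⟨ *-congˡ (∑-comm (λ i c → v ⁅ i ⁆ * (δ (component i) c * β c))) ⟩
        a * sum (λ c → sum (λ i → v ⁅ i ⁆ * (δ (component i) c * β c)))
          ≈⟨ *-congˡ (sum-cong-≋ (λ c → trans (sum-cong-≋ (λ i → sym (*-assoc (v ⁅ i ⁆) (δ (component i) c) (β c))))
               (sym (*-distribʳ-sum (β c) (λ i → v ⁅ i ⁆ * δ (component i) c))))) ⟩
        a * sum (λ c → sum (λ i → v ⁅ i ⁆ * δ (component i) c) * β c)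
          ≈⟨ *-congˡ (≡.subst (λ v → sum (λ c → sum (λ i → v ⁅ i ⁆ * δ (component i) c) * β c) ≈ 0#)
               (≡.sym (Anyₚ.lookup-index v∈)) (eqs (Any.index v∈))) ⟩
        a * 0#
          ≈⟨ zeroʳ a ⟩
        0# ∎

  depth : Exterior.DepthEq K n M k
  depth = (root-forms , (root-forms-reg , λ v reg → ℕₚ.<⇒≱ (too-long v) (length-≤ (root-forms ++ [ v ]) reg)) , root-forms-length) ,
      λ vs (reg , maximal) → ℕₚ.≤-antisym (length-≤ vs reg)
        (ℕₚ.≮⇒≥ (λ lt → extendable vs reg lt (λ (v , reg′) → maximal v reg′)))
    where
    root-forms : List (A n)
    root-forms = List.map root-form (allFin k)
    root-forms-reg : Exterior.IsRegular K n M root-forms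
    root-forms-reg = root-forms-regular [] (allFin k) (λ ()) (Uniqueₚ.allFin⁺ k)
    root-forms-length : length root-forms ≡ k
    root-forms-length = ≡.trans (Listₚ.length-map root-form (allFin k)) (Listₚ.length-tabulate id)
    too-long : ∀ v → k ℕ.< length (root-forms ++ [ v ])
    too-long v = ℕₚ.≤-reflexive (≡.sym (≡.trans (Listₚ.length-++ root-forms)
      (≡.trans (ℕₚ.+-comm _ 1) (≡.cong suc root-forms-length))))

theorem6p5 : ∀ {c ℓ} (K : Field c ℓ) → Infinite K →
    (n : ℕ) (M : Matroid n) → Loopless M →
    (k : ℕ) → HasComponents M k →
    Exterior.DepthEq K n M k
theorem6p5 K _ n M loopless k components = RegularSequences.depth K M loopless components
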